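{- Let $q$ be an odd prime power and $\mathcal{E}\subseteq\mathbb{F}_q^d$. \begin{itemize} \item If $q\geq5$, $d\in\{2,4\}$, $r\in\mathbb{F}_q^*$ and $|\mathcal{E}|\geq 36q^{(2d+1)/3}$, then $\mathcal{E}$ contains a pair of $4$-paths with dilation ratio $r$. \item If $d=3$, $r\in\mathbb{F}_q^+$ and $|\mathcal{E}|\geq 9q^{(2d+1)/3}$, then $\mathcal{E}$ contains a pair of $4$-paths with dilation ratio $r$. \item If $d=5$, $r\in\mathbb{F}_q^+$ and $|\mathcal{E}|\geq 12q^{3}$, then $\mathcal{E}$ contains a pair of $4$-paths with dilation ratio $r$. \item If $q\geq5$, $d\geq6$ is even, $r\in\mathbb{F}_q^*$ and $|\mathcal{E}|\geq 313q^{d/2}$, then $\mathcal{E}$ contains a pair of $4$-paths with dilation ratio $r$. \item If $d\geq7$ is odd, $r\in\mathbb{F}_q^+$ and $|\mathcal{E}|\geq 313q^{d/2}$, then $\mathcal{E}$ contains a pair of $4$-paths with dilation ratio $r$. \end{itemize}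
   Context: $\mathbb{F}_q$ is the finite field with $q$ elements, $\mathbb{F}_q^*$ its nonzero elements, and $\mathbb{F}_q^+$ the set of nonzero quadratic residues (nonzero squares) in $\mathbb{F}_q$. For $\bm{x}=(x_1,\ldots,x_d)\in\mathbb{F}_q^d$, $\|\bm{x}\|:=x_1^2+\cdots+x_d^2$. Let $G=(V,E)$ be a graph with $V=\{1,\ldots,n\}$ and $E\subseteq\binom{V}{2}$. A set $\mathcal{E}\subseteq\mathbb{F}_q^d$ contains a pair of $G$ with dilation ratio $r$ if there exist distinct $\bm{x}_1,\ldots,\bm{x}_n\in\mathcal{E}$ and distinct $\bm{y}_1,\ldots,\bm{y}_n\in\mathcal{E}$ such that $\|\bm{y}_i-\bm{y}_j\|=r\|\bm{x}_i-\bm{x}_j\|\neq0$ whenever $\{i,j\}\in E$. A $4$-path is the graph with vertex set $\{1,2,3,4,5\}$ and edge set $\{\{1,2\},\{2,3\},\{3,4\},\{4,5\}\}$. -}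

module Defs where

open import Level using (Level; 0ℓ) renaming (suc to lsuc)
open import Algebra.Core using (Op₁; Op₂)
open import Algebra.Structures using (IsCommutativeRing)
open import Data.Fin using (Fin; toℕ)
open import Data.List using (List; length)
import Data.List.Membership.Propositional as List
open import Data.List.Relation.Unary.Unique.Propositional using (Unique)
open import Data.Nat as ℕ using (ℕ; _^_; _≤_; NonZero)
open import Data.Nat.Divisibility using (_∣_)
open import Data.Nat.Primality using (Prime)
open import Data.Nat.Properties using (1+n≢n)
open import Data.Product using (∃; ∃-syntax; _×_)
open import Data.Sum using (_⊎_; inj₁; inj₂; swap)
open import Data.Vec using (Vec; foldr′; map; zipWith)
open import Function.Bundles using (_↔_)
open import Function.Definitions using (Injective)
open import Relation.Binary.Core using (Rel)
open import Relation.Binary.Definitions using (Symmetric)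
open import Relation.Binary.PropositionalEquality using (_≡_; _≢_)
open import Relation.Nullary using (¬_)

OddPrimePower : ℕ → Set
OddPrimePower q =
  ¬ (2 ∣ q) × (∃[ p ] ∃[ k ] Prime p × 1 ≤ k × q ≡ p ^ k)

record FiniteField (c : Level) (q : ℕ) : Set (lsuc c) where
  infixl 7 _*_
  infixl 6 _+_ _-_
  infix  8 -_
  field
    Carrier           : Set c
    _+_ _*_           : Op₂ Carrier
    -_                : Op₁ Carrier
    0# 1#             : Carrier
    isCommutativeRing : IsCommutativeRing _≡_ _+_ _*_ -_ 0# 1#
    1≢0               : 1# ≢ 0#
    inverse           : ∀ x → x ≢ 0# → ∃[ y ] x * y ≡ 1#
    enumeration       : Carrier ↔ Fin q

  _-_ : Op₂ Carrier
  x - y = x + (- y)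

  NonzeroSquare : Carrier → Set c
  NonzeroSquare r = r ≢ 0# × (∃[ s ] r ≡ s * s)

  Point : ℕ → Set c
  Point d = Vec Carrier d

  _-ᵛ_ : ∀ {d} → Op₂ (Point d)
  _-ᵛ_ = zipWith _-_

  -- Not a square root: the sum of the squared coordinates, valued in the field.
  ‖_‖ : ∀ {d} → Point d → Carrier
  ‖ x ‖ = foldr′ _+_ 0# (map (λ a → a * a) x)

-- A finite set, given by a list of its elements without repetitions, so that
-- its cardinality is the length of the list.  Classically, every subset of a
-- finite type arises in this way.
record FiniteSubset {a} (A : Set a) : Set a where
  field
    elements : List A
    distinct : Unique elements

infix 4 _∈_
_∈_ : ∀ {a} {A : Set a} → A → FiniteSubset A → Set a
x ∈ S = x List.∈ FiniteSubset.elements S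

∣_∣ : ∀ {a} {A : Set a} → FiniteSubset A → ℕ
∣ S ∣ = length (FiniteSubset.elements S)

record Graph (n : ℕ) : Set₁ where
  field
    Adj    : Rel (Fin n) 0ℓ
    sym    : Symmetric Adj
    irrefl : ∀ {i} → ¬ Adj i i

4-path : Graph 5
4-path = record
  { Adj    = λ i j → ℕ.suc (toℕ i) ≡ toℕ j ⊎ ℕ.suc (toℕ j) ≡ toℕ i
  ; sym    = swap
  ; irrefl = λ { (inj₁ e) → 1+n≢n e ; (inj₂ e) → 1+n≢n e }
  }

module _ {c q} (F : FiniteField c q) where
  open FiniteField F

  ContainsPair : ∀ {n d} → Graph n → Carrier → FiniteSubset (Point d) → Set c
  ContainsPair {n} {d} G r E =
    ∃[ x ] ∃[ y ]
      Injective {A = Fin n} {B = Point d} _≡_ _≡_ x ×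
      Injective {A = Fin n} {B = Point d} _≡_ _≡_ y ×
      (∀ i → x i ∈ E) ×
      (∀ i → y i ∈ E) ×
      (∀ i j → Graph.Adj G i j →
        ‖ y i -ᵛ y j ‖ ≡ r * ‖ x i -ᵛ x j ‖ ×
        r * ‖ x i -ᵛ x j ‖ ≢ 0#)

-- N ≥ C · q^(a/b) as real numbers.  Both sides are nonnegative and b > 0, so
-- raising to the b-th power turns this into an inequality of naturals.
infix 4 _≥_·_^[_/_]
_≥_·_^[_/_] : (N C q a b : ℕ) → .{{NonZero b}} → Set
N ≥ C · q ^[ a / b ] = (q ^ a) ℕ.* (C ^ b) ≤ N ^ b

{-# OPTIONS --safe #-}
-- Everything rests on the function ψ(a) = q·[a = 0] − 1, the sum of all nontrivial additive characters at a: it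
-- turns Fourier analysis on the field into identities between integers.  Write n = |E| and D = q^d, let ν count the
-- isotropic pairs of E, and let N count the pairs of pairs with ‖y − y′‖ = r‖x − x′‖.  On F^d × F^d the form
-- ‖y‖ − r‖x‖ has Gauss sum exactly D when d is even or r is a square, so summing the energies
-- Σψ(ξ·(a − a′)) ≥ 0 of E × E over its cone evaluates to a positive multiple of D(qN − n⁴) + D²n².  For odd d
-- nonnegativity of this sum suffices, since ν is small: adding one variable gives a form in even dimension, whose cone
-- bounds ν.  For even d, ν² can exceed n⁴/q, but the frequencies (ξ, ζ) with ξ and ζ both isotropic lie in the cone
-- and their energies sum to the square of the corresponding sum for ν, which cancels ν².  Either way
-- 25q(N − ν²) ≥ 8n⁴ once n² ≥ 400D, so the graph on E × E whose edges are the nonisotropic pairs in ratio r has more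
-- than 12n³ ordered edges.  Passing to a subgraph of minimum degree above 6n, a path can be extended while avoiding
-- the at most 6n vertices that repeat one of three earlier coordinates x or y.
module Submission where

open import Algebra.Bundles using (CommutativeRing)
import Algebra.Properties.Ring as RingProperties
import Algebra.Solver.Ring.NaturalCoefficients.Default as NaturalCoefficients
open import Data.Empty using (⊥-elim)
open import Data.Fin as Fin using (Fin; zero; suc; toℕ)
import Data.Fin.Properties as Fin
open import Data.List using (List; []; _∷_; _++_; map; length; allFin; cartesianProduct; cartesianProductWith)
open import Data.List.Properties using (length-map; length-tabulate; length-++)
open import Data.List.Membership.Propositional using (_∈_; find; lose)
open import Data.List.Membership.Propositional.Properties using (∈-map⁺; ∈-allFin; ∈-∃++; ∈-++⁻; ∈-++⁺ˡ; ∈-++⁺ʳ; ∈-cartesianProduct⁻)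
open import Data.List.Relation.Unary.All as All using (All; []; _∷_)
open import Data.List.Relation.Unary.AllPairs using ([]; _∷_)
open import Data.List.Relation.Unary.Any using (any?; here; there)
open import Data.List.Relation.Unary.Unique.Propositional using (Unique)
import Data.List.Relation.Unary.Unique.Propositional.Properties as Unique
open import Data.Nat as ℕ using (ℕ; zero; suc; z≤n; s≤s)
open import Data.Nat.Divisibility using (_∣_; divides)
open import Data.Product using (_×_; _,_; proj₁; proj₂; ∃; ∃-syntax)
open import Data.Sum using (_⊎_; inj₁; inj₂; [_,_]′)
open import Data.Unit using (tt)
open import Data.Vec using ([]; _∷_; zipWith; replicate)
import Data.Vec as Vec
open import Data.Vec.Properties using (≡-dec; ∷-injective)
open import Function.Base using (id)
open import Function.Bundles using (Inverse)
open import Function.Definitions using (Injective)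
open import Level using (Level; _⊔_)
open import Relation.Binary.Core using (Rel)
open import Relation.Binary.Definitions using (Decidable; DecidableEquality; Symmetric; tri<; tri≈; tri>)
open import Relation.Binary.PropositionalEquality hiding ([_])
open import Relation.Nullary using (Dec; yes; no; ¬_)
open import Relation.Nullary.Decidable using (map′; _×-dec_; ¬?)

open import Defs using (FiniteField; FiniteSubset; Graph; 4-path; ContainsPair; _≥_·_^[_/_])

-- Since `ψ` adds up all nontrivial characters, single characters are out of reach: a Gauss sum can
-- be factored out only if it is the same for all of them. Nondegenerate forms in an even number of
-- variables have this property. In an odd number of variables the Gauss sum changes sign with the
-- quadratic character of the frequency, so every form whose cone is used lives on d variables with
-- d even, on d + 1 variables with d odd, or on 2d variables. The sign matters as well. Nonnegative
-- energies bound N from below because the Gauss sum of ‖y‖ - r‖x‖ is +D. For odd d and nonsquare r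
-- it is -D, and the same sum would bound N from above. The constants: each avoided vertex costs at
-- most n choices per coordinate, three of them cost 6n, and minimum degree above 6n on n² vertices
-- asks for 2 · 6n · n² = 12n³ ordered edges. The bound 25q(N - ν²) ≥ 8n⁴ exceeds this once 2n >
-- 75q. So the size hypotheses enter only through n² ≥ 400D and 2n > 75q.

-- Indicators and finite sums of integers over lists.

module IntegerSums where
  open import Data.Integer as ℤ using (ℤ; +_; 0ℤ; 1ℤ; _+_; _*_; -_; _-_; _≤_; _<_; +≤+)
  open import Data.Integer.Properties hiding (_≟_)
  open import Data.Integer.Tactic.RingSolver using (solve-∀)

  private variable
    a b p : Level
    A : Set a
    B : Set b
    P : Set p

  [_] : Dec P → ℤ
  [ yes _ ] = 1ℤ
  [ no  _ ] = 0ℤ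

  []-yes : (D : Dec P) → P → [ D ] ≡ 1ℤ
  []-yes (yes _) _ = refl
  []-yes (no ¬p) p = ⊥-elim (¬p p)

  []-no : (D : Dec P) → ¬ P → [ D ] ≡ 0ℤ
  []-no (yes p) ¬p = ⊥-elim (¬p p)
  []-no (no _)  _  = refl

  []-nonneg : (D : Dec P) → 0ℤ ≤ [ D ]
  []-nonneg (yes _) = +≤+ z≤n
  []-nonneg (no  _) = +≤+ z≤n

  []-≤1 : (D : Dec P) → [ D ] ≤ 1ℤ
  []-≤1 (yes _) = ≤-refl
  []-≤1 (no  _) = +≤+ z≤n

  []-⇔ : ∀ {p p′} {P : Set p} {P′ : Set p′} (D : Dec P) (D′ : Dec P′) →
    (P → P′) → (P′ → P) → [ D ] ≡ [ D′ ]
  []-⇔ D (yes p′) _ g = []-yes D (g p′)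
  []-⇔ D (no ¬p′) f _ = []-no D λ p → ¬p′ (f p)

  []-× : ∀ {p p′ p″} {P : Set p} {P′ : Set p′} {P″ : Set p″} (D : Dec P) (D′ : Dec P′) (D″ : Dec P″) →
    (P → P′ → P″) → (P″ → P × P′) → [ D ] * [ D′ ] ≡ [ D″ ]
  []-× (yes p) (yes p′) D″ f g = sym ([]-yes D″ (f p p′))
  []-× (yes _) (no ¬p′) D″ f g = sym ([]-no D″ λ p″ → ¬p′ (proj₂ (g p″)))
  []-× (no ¬p) (yes _)  D″ f g = sym ([]-no D″ λ p″ → ¬p (proj₁ (g p″)))
  []-× (no ¬p) (no _)   D″ f g = sym ([]-no D″ λ p″ → ¬p (proj₁ (g p″)))

  ∑ : List A → (A → ℤ) → ℤ
  ∑ []       f = 0ℤ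
  ∑ (x ∷ xs) f = f x + ∑ xs f

  infix 5 ∑
  syntax ∑ xs (λ x → e) = ∑[ x ← xs ] e

  ∑-cong : ∀ (xs : List A) {f g : A → ℤ} → (∀ x → f x ≡ g x) → ∑ xs f ≡ ∑ xs g
  ∑-cong []       f≗g = refl
  ∑-cong (x ∷ xs) f≗g = cong₂ _+_ (f≗g x) (∑-cong xs f≗g)

  ∑-cong-∈ : ∀ {a} {A : Set a} (xs : List A) {f g : A → ℤ} → (∀ {x} → x ∈ xs → f x ≡ g x) → ∑ xs f ≡ ∑ xs g
  ∑-cong-∈ []       f≗g = refl
  ∑-cong-∈ (x ∷ xs) f≗g = cong₂ _+_ (f≗g (here refl)) (∑-cong-∈ xs λ x∈ → f≗g (there x∈))

  ∑-mono-∈ : ∀ (xs : List A) {f g : A → ℤ} → (∀ {x} → x ∈ xs → f x ≤ g x) → ∑ xs f ≤ ∑ xs g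
  ∑-mono-∈ []       f≤g = ≤-refl
  ∑-mono-∈ (x ∷ xs) f≤g = +-mono-≤ (f≤g (here refl)) (∑-mono-∈ xs λ x∈ → f≤g (there x∈))

  ∑-mono : ∀ (xs : List A) {f g : A → ℤ} → (∀ x → f x ≤ g x) → ∑ xs f ≤ ∑ xs g
  ∑-mono xs f≤g = ∑-mono-∈ xs λ {x} _ → f≤g x

  ∑-const : ∀ (xs : List A) k → ∑[ x ← xs ] k ≡ + length xs * k
  ∑-const []       k = refl
  ∑-const (x ∷ xs) k = trans (cong (_+_ k) (∑-const xs k)) (sym (suc-* (+ length xs) k))

  ∑-zero : ∀ (xs : List A) {f : A → ℤ} → (∀ x → f x ≡ 0ℤ) → ∑ xs f ≡ 0ℤ
  ∑-zero xs f≗0 = trans (∑-cong xs f≗0) (trans (∑-const xs 0ℤ) (*-zeroʳ (+ length xs)))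

  ∑-nonneg : ∀ (xs : List A) {f : A → ℤ} → (∀ x → 0ℤ ≤ f x) → 0ℤ ≤ ∑ xs f
  ∑-nonneg xs {f} 0≤f = subst (_≤ ∑ xs f) (∑-zero xs λ _ → refl) (∑-mono xs 0≤f)

  ∑-+ : ∀ (xs : List A) (f g : A → ℤ) → ∑[ x ← xs ] (f x + g x) ≡ ∑ xs f + ∑ xs g
  ∑-+ []       f g = refl
  ∑-+ (x ∷ xs) f g = trans (cong (_+_ (f x + g x)) (∑-+ xs f g)) (lemma (f x) (g x) _ _)
    where
    lemma : ∀ i j k l → (i + j) + (k + l) ≡ (i + k) + (j + l)
    lemma = solve-∀

  ∑-*ˡ : ∀ (xs : List A) k (f : A → ℤ) → ∑[ x ← xs ] (k * f x) ≡ k * ∑ xs f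
  ∑-*ˡ []       k f = sym (*-zeroʳ k)
  ∑-*ˡ (x ∷ xs) k f = trans (cong (_+_ (k * f x)) (∑-*ˡ xs k f)) (sym (*-distribˡ-+ k (f x) _))

  ∑-*ʳ : ∀ (xs : List A) (f : A → ℤ) k → ∑[ x ← xs ] (f x * k) ≡ ∑ xs f * k
  ∑-*ʳ xs f k = trans (∑-cong xs λ x → *-comm (f x) k) (trans (∑-*ˡ xs k f) (*-comm k _))

  ∑-swap : ∀ (xs : List A) (ys : List B) (f : A → B → ℤ) →
    ∑[ x ← xs ] ∑[ y ← ys ] f x y ≡ ∑[ y ← ys ] ∑[ x ← xs ] f x y
  ∑-swap []       ys f = sym (∑-zero ys λ _ → refl)
  ∑-swap (x ∷ xs) ys f = trans (cong (_+_ (∑ ys (f x))) (∑-swap xs ys f)) (sym (∑-+ ys (f x) _))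

  ∑-swap₃ : ∀ {a b c} {A : Set a} {B : Set b} {C : Set c} (xs : List A) (ys : List B) (zs : List C) (f : A → B → C → ℤ) →
    ∑[ x ← xs ] ∑[ y ← ys ] ∑[ z ← zs ] f x y z ≡ ∑[ z ← zs ] ∑[ x ← xs ] ∑[ y ← ys ] f x y z
  ∑-swap₃ xs ys zs f = trans (∑-cong xs λ x → ∑-swap ys zs (f x)) (∑-swap xs zs _)

  ∑-*-∑ : ∀ (xs : List A) (ys : List B) (f : A → ℤ) (g : B → ℤ) →
    ∑ xs f * ∑ ys g ≡ ∑[ x ← xs ] ∑[ y ← ys ] (f x * g y)
  ∑-*-∑ xs ys f g =
    trans (sym (∑-*ʳ xs f (∑ ys g))) (∑-cong xs λ x → sym (∑-*ˡ ys (f x) g))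

  ∑-++ : ∀ (xs ys : List A) (f : A → ℤ) → ∑ (xs ++ ys) f ≡ ∑ xs f + ∑ ys f
  ∑-++ []       ys f = sym (+-identityˡ _)
  ∑-++ (x ∷ xs) ys f = trans (cong (_+_ (f x)) (∑-++ xs ys f)) (sym (+-assoc (f x) _ _))

  ∑-delete : ∀ {a} {A : Set a} (ys zs : List A) x (f : A → ℤ) →
    ∑ (ys ++ x ∷ zs) f ≡ f x + ∑ (ys ++ zs) f
  ∑-delete ys zs x f = trans (∑-++ ys (x ∷ zs) f)
    (trans (lemma (∑ ys f) (f x) (∑ zs f)) (cong (_+_ (f x)) (sym (∑-++ ys zs f))))
    where
    lemma : ∀ i j k → i + (j + k) ≡ j + (i + k)
    lemma = solve-∀

  ∑-map : ∀ (h : A → B) (xs : List A) (f : B → ℤ) → ∑ (map h xs) f ≡ ∑[ x ← xs ] f (h x)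
  ∑-map h []       f = refl
  ∑-map h (x ∷ xs) f = cong (_+_ (f (h x))) (∑-map h xs f)

  ∑-cartesian : ∀ {c} {C : Set c} (h : A → B → C) (xs : List A) (ys : List B) (f : C → ℤ) →
    ∑ (cartesianProductWith h xs ys) f ≡ ∑[ x ← xs ] ∑[ y ← ys ] f (h x y)
  ∑-cartesian h []       ys f = refl
  ∑-cartesian h (x ∷ xs) ys f =
    trans (∑-++ (map (h x) ys) _ f) (cong₂ _+_ (∑-map (h x) ys f) (∑-cartesian h xs ys f))

  ∑∑-+ : ∀ (xs : List A) (ys : List B) (f g : A → B → ℤ) →
    ∑[ x ← xs ] ∑[ y ← ys ] (f x y + g x y) ≡
    (∑[ x ← xs ] ∑[ y ← ys ] f x y) + (∑[ x ← xs ] ∑[ y ← ys ] g x y)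
  ∑∑-+ xs ys f g = trans (∑-cong xs λ x → ∑-+ ys (f x) (g x)) (∑-+ xs _ _)

  ∑∑-*ˡ : ∀ (xs : List A) (ys : List B) k (f : A → B → ℤ) →
    ∑[ x ← xs ] ∑[ y ← ys ] (k * f x y) ≡ k * (∑[ x ← xs ] ∑[ y ← ys ] f x y)
  ∑∑-*ˡ xs ys k f = trans (∑-cong xs λ x → ∑-*ˡ ys k (f x)) (∑-*ˡ xs k _)

  ∑∑-const : ∀ (xs : List A) (ys : List B) k →
    ∑[ x ← xs ] ∑[ y ← ys ] k ≡ + length xs * (+ length ys * k)
  ∑∑-const xs ys k = trans (∑-cong xs λ _ → ∑-const ys k) (∑-const xs _)

  module _ (_≟_ : DecidableEquality A) where

    -- Multiplicity exactly one, phrased as a sum so that reindexing becomes an exchange of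
    -- summations.
    Enumerates : List A → Set _
    Enumerates xs = ∀ b → ∑[ x ← xs ] [ x ≟ b ] ≡ 1ℤ

    ∉⇒∑≡0 : ∀ {xs b} → All (λ x → b ≢ x) xs → ∑[ x ← xs ] [ x ≟ b ] ≡ 0ℤ
    ∉⇒∑≡0 [] = refl
    ∉⇒∑≡0 {x ∷ xs} {b} (b≢x ∷ b∉) =
      cong₂ _+_ ([]-no (x ≟ b) (λ x≡b → b≢x (sym x≡b))) (∉⇒∑≡0 b∉)

    unique⇒∑≡1 : ∀ {xs b} → Unique xs → b ∈ xs → ∑[ x ← xs ] [ x ≟ b ] ≡ 1ℤ
    unique⇒∑≡1 {x ∷ xs} (x∉ ∷ u) (here refl) =
      cong₂ _+_ ([]-yes (x ≟ x) refl) (∉⇒∑≡0 x∉)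
    unique⇒∑≡1 {x ∷ xs} {b} (x∉ ∷ u) (there b∈) =
      cong₂ _+_ ([]-no (x ≟ b) λ x≡b → All.lookup x∉ b∈ x≡b) (unique⇒∑≡1 u b∈)

    unique⇒∑≤1 : ∀ {xs} → Unique xs → ∀ b → ∑[ x ← xs ] [ x ≟ b ] ≤ 1ℤ
    unique⇒∑≤1 {[]} [] b = +≤+ z≤n
    unique⇒∑≤1 {x ∷ xs} (x∉ ∷ u) b with x ≟ b
    ... | yes refl = ≤-reflexive (cong (λ k → 1ℤ + k) (∉⇒∑≡0 x∉))
    ... | no  _    = subst (_≤ 1ℤ) (sym (+-identityˡ _)) (unique⇒∑≤1 u b)

    ∑-pick : ∀ xs → Enumerates xs → (g : A → ℤ) → ∀ b → ∑[ x ← xs ] [ x ≟ b ] * g x ≡ g b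
    ∑-pick xs enum g b = begin
      ∑[ x ← xs ] [ x ≟ b ] * g x  ≡⟨ ∑-cong xs same ⟩
      ∑[ x ← xs ] [ x ≟ b ] * g b  ≡⟨ ∑-*ʳ xs _ (g b) ⟩
      (∑[ x ← xs ] [ x ≟ b ]) * g b  ≡⟨ cong (_* g b) (enum b) ⟩
      1ℤ * g b  ≡⟨ *-identityˡ (g b) ⟩
      g b  ∎
      where
      open ≡-Reasoning
      same : ∀ x → [ x ≟ b ] * g x ≡ [ x ≟ b ] * g b
      same x with x ≟ b
      ... | yes refl = refl
      ... | no  _    = refl

    -- Writing `g (φ x)` as a sum over point masses at `φ x` and exchanging the sums leaves, for
    -- each `y`, the number of preimages of `y`, which is one. No permutation of the list is ever
    -- constructed.
    ∑-reindex : ∀ xs → Enumerates xs → (φ φ⁻¹ : A → A) →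
      (∀ x → φ (φ⁻¹ x) ≡ x) → (∀ x → φ⁻¹ (φ x) ≡ x) →
      (g : A → ℤ) → ∑[ x ← xs ] g (φ x) ≡ ∑ xs g
    ∑-reindex xs enum φ φ⁻¹ φφ⁻¹ φ⁻¹φ g = begin
      ∑[ x ← xs ] g (φ x)
        ≡⟨ ∑-cong xs (λ x → sym (∑-pick xs enum g (φ x))) ⟩
      ∑[ x ← xs ] ∑[ y ← xs ] [ y ≟ φ x ] * g y
        ≡⟨ ∑-swap xs xs _ ⟩
      ∑[ y ← xs ] ∑[ x ← xs ] [ y ≟ φ x ] * g y
        ≡⟨ ∑-cong xs (λ y → ∑-*ʳ xs _ (g y)) ⟩
      ∑[ y ← xs ] (∑[ x ← xs ] [ y ≟ φ x ]) * g y
        ≡⟨ ∑-cong xs (λ y → cong (_* g y) (trans (∑-cong xs (flip y)) (enum (φ⁻¹ y)))) ⟩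
      ∑[ y ← xs ] 1ℤ * g y
        ≡⟨ ∑-cong xs (λ y → *-identityˡ (g y)) ⟩
      ∑ xs g ∎
      where
      open ≡-Reasoning
      flip : ∀ y x → [ y ≟ φ x ] ≡ [ x ≟ φ⁻¹ y ]
      flip y x with x ≟ φ⁻¹ y
      ... | yes refl = []-yes (y ≟ φ (φ⁻¹ y)) (sym (φφ⁻¹ y))
      ... | no  x≢   = []-no (y ≟ φ x) λ { refl → x≢ (sym (φ⁻¹φ x)) }

-- Polynomial inequalities that turn Fourier estimates into a count of edges.

module IntegerBounds where
  open import Data.Integer as ℤ using (ℤ; +_; 0ℤ; 1ℤ; _+_; _*_; -_; _-_; _≤_; _<_; +≤+; +<+)
  open import Data.Integer.Properties hiding (_≟_)
  open import Data.Integer.Tactic.RingSolver using (solve-∀)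

  square-nonneg : ∀ i → 0ℤ ≤ i * i
  square-nonneg (+ n) = subst (0ℤ ≤_) (pos-* n n) (+≤+ z≤n)
  square-nonneg (ℤ.negsuc n) = +≤+ z≤n

  nonneg-* : ∀ {i j} → 0ℤ ≤ i → 0ℤ ≤ j → 0ℤ ≤ i * j
  nonneg-* {+ m} {+ n} _ _ = subst (0ℤ ≤_) (pos-* m n) (+≤+ z≤n)

  nonneg-+ : ∀ {i j} → 0ℤ ≤ i → 0ℤ ≤ j → 0ℤ ≤ i + j
  nonneg-+ = +-mono-≤

  positive-* : ∀ {i j} → 0ℤ < i → 0ℤ < j → 0ℤ < i * j
  positive-* {i} {j} 0<i 0<j = subst (_< i * j) (*-zeroʳ i) (*-monoˡ-<-pos i {{ℤ.positive 0<i}} 0<j)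

  nonneg-cancel : ∀ k {i} → 0ℤ < k → 0ℤ ≤ k * i → 0ℤ ≤ i
  nonneg-cancel k {i} 0<k 0≤ki = *-cancelˡ-≤-pos 0ℤ i k {{ℤ.positive 0<k}} (subst (_≤ k * i) (sym (*-zeroʳ k)) 0≤ki)

  -- The sign of `i` is free: `j < i` together with `0 ≤ j` makes both `i - j` and `i + j` positive.
  square-≤⇒≤ : ∀ {i j} → 0ℤ ≤ j → 0ℤ ≤ j * j - i * i → i ≤ j
  square-≤⇒≤ {i} {j} 0≤j h = ≮⇒≥ λ j<i → <-irrefl refl (≤-<-trans h (negative j<i))
    where
    lemma : ∀ i j → (j * j - i * i) ≡ - ((i - j) * (i + j))
    lemma = solve-∀
    negative : j < i → j * j - i * i < 0ℤ
    negative j<i = subst (_< 0ℤ) (sym (lemma i j)) (neg-mono-< (positive-* (difference j<i) (+-mono-<-≤ (≤-<-trans 0≤j j<i) 0≤j)))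
      where
      difference : ∀ {m n} → m < n → 0ℤ < n - m
      difference {m} {n} m<n = subst (_< n - m) (+-inverseʳ m) (+-monoˡ-< (- m) m<n)

  -- k = q, D = q^d, n = |E|; N and v count the pairs of pairs in ratio r and the isotropic pairs.
  module _ {k D n N v g : ℤ} (3≤k : 0ℤ ≤ k - + 3) (0<D : 0ℤ < D) (0≤n : 0ℤ ≤ n)
    (large : 0ℤ ≤ n * n - + 400 * D) where

    private
      U W : ℤ
      U = k * v - n * n
      W = k * N - n * n * (n * n)

      0≤c : ∀ c → 0ℤ ≤ + c
      0≤c c = +≤+ z≤n

      0<k : 0ℤ < k
      0<k = <-≤-trans (+<+ (s≤s z≤n)) (0≤i-j⇒j≤i {k} {+ 3} 3≤k)

      0≤k : 0ℤ ≤ k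
      0≤k = <⇒≤ 0<k

      0≤D : 0ℤ ≤ D
      0≤D = <⇒≤ 0<D

      0<k*D : 0ℤ < k * D
      0<k*D = positive-* 0<k 0<D

      0<16*k : 0ℤ < + 16 * k
      0<16*k = positive-* {+ 16} (+<+ (s≤s z≤n)) 0<k

      0≤n² : 0ℤ ≤ n * n
      0≤n² = nonneg-* 0≤n 0≤n

    -- Since kv = U + n², the number k²(N - v²) equals kW + kn⁴ - (U + n²)². The term -U² is too
    -- large to be estimated away, but the main hypothesis bounds kW - U² as a whole. Only the cross
    -- term -2Un² still needs a bound on `U`, and 20U ≤ kn² is enough for it.
    count-even : g * g ≡ D →
      0ℤ ≤ k * (D * W + (D * n) * (D * n)) - (g * U + D * n) * (g * U + D * n) →
      0ℤ ≤ g * U + D * n → 0ℤ ≤ k * (D * n) - (g * U + D * n) →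
      0ℤ ≤ + 25 * (k * (N - v * v)) - + 8 * (n * n * (n * n))
    count-even refl main 0≤X X≤ = nonneg-cancel (+ 16 * k) 0<16*k (subst (0ℤ ≤_) (certificate k g n N v) sum≥0)
      where
      X A P H : ℤ
      X = g * U + D * n
      A = k * (W + D * (n * n)) - U * U - + 2 * (n * (g * U)) - D * (n * n)
      P = k * (n * n) - + 20 * U
      H = n * n - + 400 * D
      factor-A : ∀ k g n U W → k * (g * g * W + (g * g * n) * (g * g * n)) - (g * U + g * g * n) * (g * U + g * g * n)
        ≡ g * g * (k * (W + g * g * (n * n)) - U * U - + 2 * (n * (g * U)) - g * g * (n * n))
      factor-A = solve-∀
      0≤A : 0ℤ ≤ A
      0≤A = nonneg-cancel D 0<D (subst (0ℤ ≤_) (factor-A k g n U W) main)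
      -- The factors are kDn - gU and kDn + gU, written so that each is visibly nonnegative. With g²
      -- = D their product yields U² ≤ k²Dn².
      factor-U : ∀ k g n U → (k * (g * g * n) - (g * U + g * g * n) + g * g * n) * ((g * U + g * g * n) + (k - + 3 + + 2) * (g * g * n))
        ≡ g * g * (k * k * (g * g * (n * n)) - U * U)
      factor-U = solve-∀
      0≤U-bound : 0ℤ ≤ k * k * (D * (n * n)) - U * U
      0≤U-bound = nonneg-cancel D 0<D (subst (0ℤ ≤_) (factor-U k g n U)
        (nonneg-* (nonneg-+ X≤ (nonneg-* 0≤D 0≤n))
          (nonneg-+ 0≤X (nonneg-* (nonneg-+ 3≤k (0≤c 2)) (nonneg-* 0≤D 0≤n)))))
      squares : ∀ k D n U → k * k * (n * n) * (n * n - + 400 * D) + + 400 * (k * k * (D * (n * n)) - U * U)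
        ≡ k * (n * n) * (k * (n * n)) - + 20 * U * (+ 20 * U)
      squares = solve-∀
      0≤P : 0ℤ ≤ P
      0≤P = i≤j⇒0≤j-i (square-≤⇒≤ (nonneg-* 0≤k 0≤n²) (subst (0ℤ ≤_) (squares k D n U)
        (nonneg-+ (nonneg-* (nonneg-* (nonneg-* 0≤k 0≤k) 0≤n²) large) (nonneg-* (0≤c 400) 0≤U-bound))))
      -- The roles of the summands: `800nX` cancels the term -2ngU of `A`, `40Pn²` provides -2Un²,
      -- and (k + 1)n²H absorbs the 400(k + 1)Dn² left by the first two. What remains is a multiple
      -- of n⁴ that is positive because k ≥ 3.
      certificate : ∀ k g n N v → let D = g * g ; U = k * v - n * n ; W = k * N - n * n * (n * n) in
        + 400 * (k * (W + D * (n * n)) - U * U - + 2 * (n * (g * U)) - D * (n * n))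
          + + 800 * (n * (g * U + D * n)) + + 40 * ((k * (n * n) - + 20 * U) * (n * n))
          + (k - + 3 + + 4) * ((n * n) * (n * n - + 400 * D)) + (+ 231 * (k - + 3) + + 292) * (n * n * (n * n))
        ≡ + 16 * k * (+ 25 * (k * (N - v * v)) - + 8 * (n * n * (n * n)))
      certificate = solve-∀
      sum≥0 : 0ℤ ≤ + 400 * A + + 800 * (n * X) + + 40 * (P * (n * n)) + (k - + 3 + + 4) * ((n * n) * H)
        + (+ 231 * (k - + 3) + + 292) * (n * n * (n * n))
      sum≥0 = nonneg-+ (nonneg-+ (nonneg-+ (nonneg-+
        (nonneg-* (0≤c 400) 0≤A) (nonneg-* (0≤c 800) (nonneg-* 0≤n 0≤X)))
        (nonneg-* (0≤c 40) (nonneg-* 0≤P 0≤n²))) (nonneg-* (nonneg-+ 3≤k (0≤c 4)) (nonneg-* 0≤n² large)))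
        (nonneg-* (nonneg-+ (nonneg-* (0≤c 231) 3≤k) (0≤c 292)) (nonneg-* 0≤n² 0≤n²))

    -- Here U² ≤ kDn², a factor k better than in the even case, so the square can be given away: -(U
    -- + n²)² = (U - n²)² - 2U² - 2n⁴.
    count-odd : g * g ≡ k * D → 0ℤ ≤ D * W + (D * n) * (D * n) →
      0ℤ ≤ g * U + k * (D * n) → 0ℤ ≤ + 2 * (k * (D * n)) - (g * U + k * (D * n)) →
      0ℤ ≤ + 25 * (k * (N - v * v)) - + 8 * (n * n * (n * n))
    count-odd g²≡ main 0≤X X≤ = nonneg-cancel (+ 16 * k) 0<16*k (subst (0ℤ ≤_) (certificate k D n N v) sum≥0)
      where
      B H : ℤ
      B = k * (D * (n * n)) - U * U
      H = n * n - + 400 * D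
      factor-A : ∀ D n W → D * W + (D * n) * (D * n) ≡ D * (W + D * (n * n))
      factor-A = solve-∀
      0≤A : 0ℤ ≤ W + D * (n * n)
      0≤A = nonneg-cancel D 0<D (subst (0ℤ ≤_) (factor-A D n W) main)
      factor-B : ∀ k D n U g → (g * U + k * (D * n)) * (+ 2 * (k * (D * n)) - (g * U + k * (D * n)))
        ≡ k * D * (k * (D * (n * n))) - g * g * (U * U)
      factor-B = solve-∀
      factor-B′ : ∀ p x y → p * x - p * y ≡ p * (x - y)
      factor-B′ = solve-∀
      0≤B : 0ℤ ≤ B
      0≤B = nonneg-cancel (k * D) 0<k*D (subst (0ℤ ≤_) (trans (factor-B k D n U g)
        (trans (cong (λ z → k * D * (k * (D * (n * n))) - z * (U * U)) g²≡) (factor-B′ (k * D) _ _)))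
        (nonneg-* 0≤X X≤))
      -- The term 3kn²H pays for 1200kDn², of which 400 come from the main inequality and 800 from
      -- `B`. The final coefficient is 269k - 800, only 7 when k = 3.
      certificate : ∀ k D n N v → let U = k * v - n * n ; W = k * N - n * n * (n * n) in
        + 400 * (k * (W + D * (n * n))) + + 800 * (k * (D * (n * n)) - U * U) + + 400 * ((U - n * n) * (U - n * n))
          + + 3 * (k * ((n * n) * (n * n - + 400 * D))) + (+ 269 * (k - + 3) + + 7) * (n * n * (n * n))
        ≡ + 16 * k * (+ 25 * (k * (N - v * v)) - + 8 * (n * n * (n * n)))
      certificate = solve-∀
      sum≥0 : 0ℤ ≤ + 400 * (k * (W + D * (n * n))) + + 800 * B + + 400 * ((U - n * n) * (U - n * n))
        + + 3 * (k * ((n * n) * H)) + (+ 269 * (k - + 3) + + 7) * (n * n * (n * n))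
      sum≥0 = nonneg-+ (nonneg-+ (nonneg-+ (nonneg-+
        (nonneg-* (0≤c 400) (nonneg-* 0≤k 0≤A)) (nonneg-* (0≤c 800) 0≤B))
        (nonneg-* (0≤c 400) (square-nonneg (U - n * n)))) (nonneg-* (0≤c 3) (nonneg-* 0≤k (nonneg-* 0≤n² large))))
        (nonneg-* (nonneg-+ (nonneg-* (0≤c 269) 3≤k) (0≤c 7)) (nonneg-* 0≤n² 0≤n²))

  -- Comparing 8n⁴ with 25k · 12n³ = 300kn³ and dividing by 4n³ is the origin of 75.
  many⇒dense : ∀ {k n N} → 0ℤ ≤ k → 0ℤ ≤ n → 0ℤ < + 2 * n - + 75 * k →
    0ℤ ≤ + 25 * (k * N) - + 8 * (n * n * (n * n)) → + 12 * (n * (n * n)) < N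
  many⇒dense {k} {n} {N} 0≤k 0≤n steep many = ≰⇒> λ N≤ → <-irrefl refl (<-≤-trans (excess>0) (deficit N≤))
    where
    0<n : 0ℤ < n
    0<n = ≰⇒> λ n≤0 → <-irrefl refl (<-≤-trans steep (subst (λ i → + 2 * i - + 75 * k ≤ 0ℤ) (≤-antisym 0≤n n≤0)
      (subst (_≤ 0ℤ) (sym (+-identityˡ (- (+ 75 * k)))) (neg-mono-≤ (nonneg-* {+ 75} (+≤+ z≤n) 0≤k)))))
    identity : ∀ k n N → (+ 25 * (k * N) - + 8 * (n * n * (n * n))) + + 4 * (n * n * n) * (+ 2 * n - + 75 * k)
      ≡ + 25 * k * (N - + 12 * (n * (n * n)))
    identity = solve-∀
    excess>0 : 0ℤ < + 25 * k * (N - + 12 * (n * (n * n)))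
    excess>0 = subst (0ℤ <_) (identity k n N)
      (+-mono-≤-< many (positive-* (positive-* {+ 4} (+<+ (s≤s z≤n)) (positive-* (positive-* 0<n 0<n) 0<n)) steep))
    negate : ∀ a x y → - (a * (y - x)) ≡ a * (x - y)
    negate = solve-∀
    deficit : N ≤ + 12 * (n * (n * n)) → + 25 * k * (N - + 12 * (n * (n * n))) ≤ 0ℤ
    deficit N≤ = subst (_≤ 0ℤ) (negate (+ 25 * k) N (+ 12 * (n * (n * n))))
      (neg-mono-≤ (nonneg-* (nonneg-* {+ 25} (+≤+ z≤n) 0≤k) (i≤j⇒0≤j-i N≤)))

-- Reduction of the size hypotheses to two inequalities.

module Thresholds where
  open import Data.Nat
  open import Data.Nat.Properties
  open import Data.Nat.Tactic.RingSolver using (solve-∀)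

  ^-reflects-≤ : ∀ k .{{_ : NonZero k}} {a b} → a ^ k ≤ b ^ k → a ≤ b
  ^-reflects-≤ k aᵏ≤bᵏ = ≮⇒≥ λ b<a → <⇒≱ (^-monoˡ-< k b<a) aᵏ≤bᵏ

  ^-distribʳ-* : ∀ k m n → (m * n) ^ k ≡ m ^ k * n ^ k
  ^-distribʳ-* zero    m n = refl
  ^-distribʳ-* (suc k) m n = trans (cong (m * n *_) (^-distribʳ-* k m n)) (lemma m n (m ^ k) (n ^ k))
    where
    lemma : ∀ a b c d → (a * b) * (c * d) ≡ (a * c) * (b * d)
    lemma = solve-∀

  -- The first inequality makes error terms of order Dn² small against n⁴; the second makes n⁴/q
  -- large against the n³ edges that the path needs.
  Large : ℕ → ℕ → ℕ → Set
  Large q d n = 400 * q ^ d ≤ n * n × 75 * q < 2 * n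

  private
    rotate : ∀ a b c → a * b * c ≡ b * a * c
    rotate = solve-∀

    -- 38 is the least integer above 75/2.
    scaled : ∀ {k q n} → 0 < q → 38 ≤ k → k * q ≤ n → 75 * q < 2 * n
    scaled {k} {q} {n} 0<q 38≤k kq≤n = begin-strict
      75 * q        <⟨ *-monoˡ-< q {{>-nonZero 0<q}} (≤ᵇ⇒≤ 76 76 tt) ⟩
      76 * q        ≡⟨ *-assoc 2 38 q ⟩
      2 * (38 * q)  ≤⟨ *-monoʳ-≤ 2 (≤-trans (*-monoˡ-≤ q 38≤k) kq≤n) ⟩
      2 * n         ∎
      where open ≤-Reasoning

    squared : ∀ {k x n} → 20 ≤ k → k * x ≤ n → 400 * (x * x) ≤ n * n
    squared {k} {x} {n} 20≤k kx≤n = begin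
      400 * (x * x)          ≡⟨ lemma x ⟩
      (20 * x) * (20 * x)    ≤⟨ *-mono-≤ (≤-trans (*-monoˡ-≤ x 20≤k) kx≤n) (≤-trans (*-monoˡ-≤ x 20≤k) kx≤n) ⟩
      n * n                  ∎
      where
      open ≤-Reasoning
      lemma : ∀ x → 400 * (x * x) ≡ (20 * x) * (20 * x)
      lemma = solve-∀

  -- The constant 36 alone lies below 75/2, but the exponent 5/3 leaves q² to spare after cubing,
  -- and q² ≥ 8 doubles the constant to 72.
  large-2 : ∀ {q n} → 5 ≤ q → n ≥ 36 · q ^[ 2 * 2 + 1 / 3 ] → Large q 2 n
  large-2 {q} {n} 5≤q h = subst (λ x → 400 * x ≤ n * n) (cong (q *_) (sym (*-identityʳ q))) (squared {72} {q} (≤ᵇ⇒≤ 20 72 tt) 72q≤n) ,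
    scaled {72} (≤-trans (s≤s z≤n) 5≤q) (≤ᵇ⇒≤ 38 72 tt) 72q≤n
    where
    open ≤-Reasoning
    72q≤n : 72 * q ≤ n
    72q≤n = ^-reflects-≤ 3 (begin
      (72 * q) ^ 3              ≡⟨ ^-distribʳ-* 3 72 q ⟩
      (8 * 36 ^ 3) * q ^ 3      ≤⟨ *-monoˡ-≤ (q ^ 3) (*-monoˡ-≤ (36 ^ 3) (≤-trans (≤ᵇ⇒≤ 8 25 tt) (^-monoˡ-≤ 2 5≤q))) ⟩
      (q ^ 2 * 36 ^ 3) * q ^ 3  ≡⟨ trans (rotate (q ^ 2) (36 ^ 3) (q ^ 3)) (trans (*-assoc (36 ^ 3) (q ^ 2) (q ^ 3)) (*-comm (36 ^ 3) (q ^ 2 * q ^ 3))) ⟩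
      (q ^ 2 * q ^ 3) * 36 ^ 3  ≡⟨ cong (_* 36 ^ 3) (sym (^-distribˡ-+-* q 2 3)) ⟩
      q ^ 5 * 36 ^ 3            ≤⟨ h ⟩
      n ^ 3                     ∎)

  large-4 : ∀ {q n} → 5 ≤ q → n ≥ 36 · q ^[ 2 * 4 + 1 / 3 ] → Large q 4 n
  large-4 {q} {n} 5≤q h = subst (λ x → 400 * x ≤ n * n) (sym (^-distribˡ-+-* q 2 2)) (squared {36} {q ^ 2} (≤ᵇ⇒≤ 20 36 tt) 36q²≤n) ,
    scaled {36 * q} 0<q (≤-trans (≤ᵇ⇒≤ 38 180 tt) (*-monoʳ-≤ 36 5≤q))
      (≤-trans (≤-reflexive (trans (*-assoc 36 q q) (cong (λ x → 36 * (q * x)) (sym (*-identityʳ q))))) 36q²≤n)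
    where
    open ≤-Reasoning
    0<q : 0 < q
    0<q = ≤-trans (s≤s z≤n) 5≤q
    36q²≤n : 36 * q ^ 2 ≤ n
    36q²≤n = ^-reflects-≤ 3 (begin
      (36 * q ^ 2) ^ 3         ≡⟨ trans (^-distribʳ-* 3 36 (q ^ 2)) (trans (cong (36 ^ 3 *_) (^-*-assoc q 2 3)) (*-comm (36 ^ 3) (q ^ 6))) ⟩
      q ^ 6 * 36 ^ 3           ≤⟨ *-monoˡ-≤ (36 ^ 3) (^-monoʳ-≤ q {{>-nonZero 0<q}} (≤ᵇ⇒≤ 6 9 tt)) ⟩
      q ^ 9 * 36 ^ 3           ≤⟨ h ⟩
      n ^ 3                    ∎)

  -- Cubing removes the exponent 7/3. Both inequalities then spend surplus powers of q ≥ 3 on the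
  -- constants: 3⁵ · 9⁶ exceeds 400³, and 3⁴ · 9³ = 59049 just exceeds 38³ = 54872.
  large-3 : ∀ {q n} → 3 ≤ q → n ≥ 9 · q ^[ 2 * 3 + 1 / 3 ] → Large q 3 n
  large-3 {q} {n} 3≤q h = ^-reflects-≤ 3 {400 * q ^ 3} {n * n} (begin
      (400 * q ^ 3) ^ 3                   ≡⟨ trans (^-distribʳ-* 3 400 (q ^ 3)) (cong (400 ^ 3 *_) (^-*-assoc q 3 3)) ⟩
      400 ^ 3 * q ^ 9                     ≤⟨ *-monoˡ-≤ (q ^ 9) (≤ᵇ⇒≤ (400 ^ 3) (3 ^ 5 * (9 ^ 3 * 9 ^ 3)) tt) ⟩
      (3 ^ 5 * (9 ^ 3 * 9 ^ 3)) * q ^ 9   ≤⟨ *-monoˡ-≤ (q ^ 9) (*-monoˡ-≤ (9 ^ 3 * 9 ^ 3) (^-monoˡ-≤ 5 3≤q)) ⟩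
      (q ^ 5 * (9 ^ 3 * 9 ^ 3)) * q ^ 9   ≡⟨ regroup (q ^ 5) (9 ^ 3 * 9 ^ 3) (q ^ 9) ⟩
      (q ^ 5 * q ^ 9) * (9 ^ 3 * 9 ^ 3)   ≡⟨ cong (_* (9 ^ 3 * 9 ^ 3)) (trans (sym (^-distribˡ-+-* q 5 9)) (^-distribˡ-+-* q 7 7)) ⟩
      (q ^ 7 * q ^ 7) * (9 ^ 3 * 9 ^ 3)   ≡⟨ interchange (q ^ 7) (9 ^ 3) ⟩
      (q ^ 7 * 9 ^ 3) * (q ^ 7 * 9 ^ 3)   ≤⟨ *-mono-≤ h h ⟩
      n ^ 3 * n ^ 3                       ≡⟨ sym (^-distribʳ-* 3 n n) ⟩
      (n * n) ^ 3                         ∎) ,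
    scaled {38} {q} {n} (≤-trans (s≤s z≤n) 3≤q) ≤-refl (^-reflects-≤ 3 {38 * q} {n} (begin
      (38 * q) ^ 3                  ≡⟨ ^-distribʳ-* 3 38 q ⟩
      38 ^ 3 * q ^ 3                ≤⟨ *-monoˡ-≤ (q ^ 3) (≤ᵇ⇒≤ (38 ^ 3) (3 ^ 4 * 9 ^ 3) tt) ⟩
      (3 ^ 4 * 9 ^ 3) * q ^ 3       ≤⟨ *-monoˡ-≤ (q ^ 3) (*-monoˡ-≤ (9 ^ 3) (^-monoˡ-≤ 4 3≤q)) ⟩
      (q ^ 4 * 9 ^ 3) * q ^ 3       ≡⟨ regroup (q ^ 4) (9 ^ 3) (q ^ 3) ⟩
      (q ^ 4 * q ^ 3) * 9 ^ 3       ≡⟨ cong (_* 9 ^ 3) (sym (^-distribˡ-+-* q 4 3)) ⟩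
      q ^ 7 * 9 ^ 3                 ≤⟨ h ⟩
      n ^ 3                         ∎))
    where
    open ≤-Reasoning
    regroup : ∀ a b c → a * b * c ≡ a * c * b
    regroup = solve-∀
    interchange : ∀ a b → (a * a) * (b * b) ≡ (a * b) * (a * b)
    interchange = solve-∀

  -- 12² = 144 falls short of 400; the spare factor of q⁶ over q⁵ raises it to 432.
  large-5 : ∀ {q n} → 3 ≤ q → 12 * q ^ 3 ≤ n → Large q 5 n
  large-5 {q} {n} 3≤q h = (begin
      400 * q ^ 5                  ≤⟨ *-monoˡ-≤ (q ^ 5) (≤ᵇ⇒≤ 400 432 tt) ⟩
      (3 * 144) * q ^ 5            ≤⟨ *-monoˡ-≤ (q ^ 5) (*-monoˡ-≤ 144 3≤q) ⟩
      (q * 144) * q ^ 5            ≡⟨ regroup q 144 (q ^ 5) ⟩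
      (q * q ^ 5) * (12 * 12)      ≡⟨ cong (_* (12 * 12)) (^-distribˡ-+-* q 3 3) ⟩
      (q ^ 3 * q ^ 3) * (12 * 12)  ≡⟨ interchange (q ^ 3) 12 ⟩
      (12 * q ^ 3) * (12 * q ^ 3)  ≤⟨ *-mono-≤ h h ⟩
      n * n                        ∎) ,
    scaled {12 * q ^ 2} (≤-trans (s≤s z≤n) 3≤q) (≤-trans (≤ᵇ⇒≤ 38 108 tt) (*-monoʳ-≤ 12 (^-monoˡ-≤ 2 3≤q)))
      (≤-trans (≤-reflexive (trans (*-assoc 12 (q ^ 2) q) (cong (12 *_) (*-comm (q ^ 2) q)))) h)
    where
    open ≤-Reasoning
    regroup : ∀ a b c → a * b * c ≡ a * c * b
    regroup = solve-∀
    interchange : ∀ a b → (a * a) * (b * b) ≡ (b * a) * (b * a)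
    interchange = solve-∀

  large-≥6 : ∀ {q n d} → 3 ≤ q → 6 ≤ d → n ≥ 313 · q ^[ d / 2 ] → Large q d n
  large-≥6 {q} {n} {d} 3≤q 6≤d h = (begin
      400 * q ^ d      ≤⟨ *-monoˡ-≤ (q ^ d) (≤ᵇ⇒≤ 400 (313 ^ 2) tt) ⟩
      313 ^ 2 * q ^ d  ≡⟨ *-comm (313 ^ 2) (q ^ d) ⟩
      q ^ d * 313 ^ 2  ≤⟨ h ⟩
      n ^ 2            ≡⟨ cong (n *_) (*-identityʳ n) ⟩
      n * n            ∎) ,
    scaled {313} {q} {n} 0<q (≤ᵇ⇒≤ 38 313 tt) (^-reflects-≤ 2 {313 * q} {n} (begin
      (313 * q) ^ 2    ≡⟨ trans (^-distribʳ-* 2 313 q) (*-comm (313 ^ 2) (q ^ 2)) ⟩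
      q ^ 2 * 313 ^ 2  ≤⟨ *-monoˡ-≤ (313 ^ 2) (^-monoʳ-≤ q {{>-nonZero 0<q}} (≤-trans (s≤s (s≤s z≤n)) 6≤d)) ⟩
      q ^ d * 313 ^ 2  ≤⟨ h ⟩
      n ^ 2            ∎))
    where
    open ≤-Reasoning
    0<q : 0 < q
    0<q = ≤-trans (s≤s z≤n) 3≤q

-- Subgraphs of large minimum degree.

module DenseGraphs where
  open import Data.Integer as ℤ using (ℤ; +_; 0ℤ; 1ℤ; _+_; _*_; -_; _-_; _≤_; _<_; _≤?_; +≤+)
  open import Data.Integer.Properties hiding (_≟_; _≤?_)
  open import Data.Integer.Tactic.RingSolver using (solve-∀)
  import Data.Nat.Properties as ℕ
  open IntegerSums
  open IntegerBounds

  module _ {v ℓ} {V : Set v} {Adj : Rel V ℓ} (adj? : Decidable Adj) (adj-sym : Symmetric Adj) where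

    degree : List V → V → ℤ
    degree L a = ∑[ b ← L ] [ adj? a b ]

    -- The field `∑-≤` is inclusion with multiplicities, in the form in which it is applied: an
    -- upper bound for a nonnegative sum over `L` passes to `vertices`. For lists, `⊆` alone would
    -- not give this.
    record DenseSubgraph (L : List V) (k : ℤ) : Set (v ⊔ ℓ) where
      field
        vertices : List V
        root     : V
        root∈    : root ∈ vertices
        ⊆        : ∀ {a} → a ∈ vertices → a ∈ L
        ∑-≤      : ∀ (f : V → ℤ) → (∀ a → 0ℤ ≤ f a) → ∑ vertices f ≤ ∑ L f
        degree-> : ∀ {a} → a ∈ vertices → k < degree vertices a

    -- Deleting a vertex of degree at most k costs at most 2k in the degree sum.
    dense-subgraph : ∀ k (L : List V) → + 2 * k * + length L < ∑ L (degree L) → DenseSubgraph L k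
    dense-subgraph k L = peel (length L) L ℕ.≤-refl
      where
      peel : ∀ m L → length L ℕ.≤ m → + 2 * k * + length L < ∑ L (degree L) → DenseSubgraph L k
      -- The strict inequality is false for the empty list, so the deletion stops while vertices
      -- remain; this also provides the root.
      peel m [] _ dense = ⊥-elim (<-irrefl (*-zeroʳ (+ 2 * k)) dense)
      peel (suc m) L@(r ∷ _) ≤m dense with any? (λ a → degree L a ≤? k) L
      ... | no none = record
        { vertices = L ; root = r ; root∈ = here refl ; ⊆ = λ a∈ → a∈ ; ∑-≤ = λ _ _ → ≤-refl
        ; degree-> = λ a∈ → ≰⇒> λ ≤k → none (lose a∈ ≤k) }
      ... | yes some with find some
      ...   | a , a∈ , deg≤k with ∈-∃++ a∈
      ...     | ys , zs , L≡ = extend (peel m L′ (ℕ.≤-pred (subst (ℕ._≤ suc m) length≡ ≤m)) dense′)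
        where
        L′ : List V
        L′ = ys ++ zs
        length≡ : length L ≡ suc (length L′)
        length≡ = trans (cong length L≡) (trans (length-++ ys) (trans (ℕ.+-suc _ _) (cong suc (sym (length-++ ys)))))
        delete : ∀ f → ∑ L f ≡ f a + ∑ L′ f
        delete f = trans (cong (λ l → ∑ l f) L≡) (∑-delete ys zs a f)
        -- `Adj` may have loops, so deleting `a` can lower its own degree; it never raises it.
        deg′≤k : degree L′ a ≤ k
        deg′≤k = ≤-trans (subst (_≤ degree L a) (+-identityˡ _)
          (subst (0ℤ + degree L′ a ≤_) (sym (delete λ b → [ adj? a b ])) (+-monoˡ-≤ (degree L′ a) ([]-nonneg (adj? a a))))) deg≤k
        ∑≡ : ∑ L (degree L) ≡ degree L a + degree L′ a + ∑ L′ (degree L′)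
        ∑≡ = begin
          ∑ L (degree L)
            ≡⟨ delete (degree L) ⟩
          degree L a + (∑[ b ← L′ ] degree L b)
            ≡⟨ cong (_+_ (degree L a)) (trans (∑-cong L′ λ b → delete (λ c → [ adj? b c ])) (∑-+ L′ _ _)) ⟩
          degree L a + ((∑[ b ← L′ ] [ adj? b a ]) + ∑ L′ (degree L′))
            ≡⟨ cong (λ s → degree L a + (s + ∑ L′ (degree L′))) (∑-cong L′ λ b → symmetric (adj? b a) (adj? a b)) ⟩
          degree L a + (degree L′ a + ∑ L′ (degree L′))
            ≡⟨ sym (+-assoc (degree L a) _ _) ⟩
          degree L a + degree L′ a + ∑ L′ (degree L′) ∎
          where
          open ≡-Reasoning
          symmetric : ∀ {b} (D₁ : Dec (Adj b a)) (D₂ : Dec (Adj a b)) → [ D₁ ] ≡ [ D₂ ]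
          symmetric (yes p) D₂ = sym ([]-yes D₂ (adj-sym p))
          symmetric (no ¬p) D₂ = sym ([]-no D₂ λ p → ¬p (adj-sym p))
        dense′ : + 2 * k * + length L′ < ∑ L′ (degree L′)
        dense′ = ≰⇒> λ small → <⇒≱ (≤-<-trans (≤-reflexive count) (<-≤-trans (subst (+ 2 * k * + length L <_) ∑≡ dense)
          (+-monoˡ-≤ (∑ L′ (degree L′)) (+-mono-≤ deg≤k deg′≤k)))) (+-monoʳ-≤ (k + k) small)
          where
          lemma : ∀ k l → (k + k) + + 2 * k * l ≡ + 2 * k * (1ℤ + l)
          lemma = solve-∀
          count : (k + k) + + 2 * k * + length L′ ≡ + 2 * k * + length L
          count = trans (lemma k (+ length L′)) (cong (λ l → + 2 * k * + l) (sym length≡))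
        extend : DenseSubgraph L′ k → DenseSubgraph L k
        extend S = record
          { vertices = vertices ; root = root ; root∈ = root∈ ; degree-> = degree->
          ; ⊆ = λ b∈ → subst (_ ∈_) (sym L≡) ([ ∈-++⁺ˡ , (λ b∈zs → ∈-++⁺ʳ ys (there b∈zs)) ]′ (∈-++⁻ ys (⊆ b∈)))
          ; ∑-≤ = λ f 0≤f → ≤-trans (∑-≤ f 0≤f) (subst (_≤ ∑ L f) (+-identityˡ _)
              (subst (0ℤ + ∑ L′ f ≤_) (sym (delete f)) (+-monoˡ-≤ (∑ L′ f) (0≤f a)))) }
          where open DenseSubgraph S

  -- Paths in a dense graph on pairs, without repeated coordinates.

  module _ {p ℓ} {P : Set p} (_≟_ : DecidableEquality P) {E : List P} (unique : Unique E)
    {n : ℤ} (|E|≡n : + length E ≡ n)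
    {Adj : Rel (P × P) ℓ} (adj? : Decidable Adj) (adj-sym : Symmetric Adj) where

    private
      0≤n : 0ℤ ≤ n
      0≤n = subst (0ℤ ≤_) |E|≡n (+≤+ z≤n)
      A : List (P × P)
      A = cartesianProduct E E

    Apart : Rel (P × P) p
    Apart a b = proj₁ a ≢ proj₁ b × proj₂ a ≢ proj₂ b

    apart? : Decidable Apart
    apart? a b = ¬? (proj₁ a ≟ proj₁ b) ×-dec ¬? (proj₂ a ≟ proj₂ b)

    private
      -- The number of shared coordinates, an upper bound for the indicator of not being apart.
      -- Unlike that indicator it sums over `A` to two separate fibre counts, each at most `n`.
      collision : P × P → P × P → ℤ
      collision b a = [ proj₁ a ≟ proj₁ b ] + [ proj₂ a ≟ proj₂ b ]

      collision-nonneg : ∀ b a → 0ℤ ≤ collision b a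
      collision-nonneg b a = nonneg-+ ([]-nonneg (proj₁ a ≟ proj₁ b)) ([]-nonneg (proj₂ a ≟ proj₂ b))

      ¬apart⇒collision : ∀ {a b} → ¬ Apart a b → 1ℤ ≤ collision b a
      ¬apart⇒collision {a} {b} ¬apart with proj₁ a ≟ proj₁ b | proj₂ a ≟ proj₂ b
      ... | yes _ | yes _ = +≤+ (s≤s z≤n)
      ... | yes _ | no  _ = +≤+ (s≤s z≤n)
      ... | no  _ | yes _ = +≤+ (s≤s z≤n)
      ... | no x≢ | no y≢ = ⊥-elim (¬apart (x≢ , y≢))

      ∑-collision : ∀ b → ∑ A (collision b) ≤ + 2 * n
      ∑-collision b = begin
        ∑ A (collision b)
          ≡⟨ trans (∑-+ A _ _) (cong₂ _+_ (∑-cartesian _,_ E E _) (trans (∑-cartesian _,_ E E _) (∑-swap E E _))) ⟩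
        (∑[ x ← E ] ∑[ y ← E ] [ x ≟ proj₁ b ]) + (∑[ y ← E ] ∑[ x ← E ] [ y ≟ proj₂ b ])
          ≤⟨ +-mono-≤ (fibre (proj₁ b)) (fibre (proj₂ b)) ⟩
        n + n
          ≡⟨ lemma n ⟩
        + 2 * n ∎
        where
        open ≤-Reasoning
        lemma : ∀ i → i + i ≡ + 2 * i
        lemma = solve-∀
        fibre : ∀ z → ∑[ x ← E ] ∑[ y ← E ] [ x ≟ z ] ≤ n
        fibre z = begin
          ∑[ x ← E ] ∑[ y ← E ] [ x ≟ z ]  ≡⟨ trans (∑-cong E λ x → trans (∑-const E [ x ≟ z ]) (cong (_* [ x ≟ z ]) |E|≡n)) (∑-*ˡ E n _) ⟩
          n * (∑[ x ← E ] [ x ≟ z ])       ≤⟨ *-monoˡ-≤-nonNeg n {{ℤ.nonNegative 0≤n}} (unique⇒∑≤1 _≟_ unique z) ⟩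
          n * 1ℤ                           ≡⟨ *-identityʳ n ⟩
          n                                ∎

    -- Consecutive vertices carry no apartness field: for the adjacency of the application it
    -- follows from the edge itself, since equal points have difference of norm zero. This is why a
    -- new vertex has to avoid at most three earlier ones, not four.
    record Path₅ : Set (p ⊔ ℓ) where
      field
        a₁ a₂ a₃ a₄ a₅ : P × P
        a₁∈ : a₁ ∈ A
        a₂∈ : a₂ ∈ A
        a₃∈ : a₃ ∈ A
        a₄∈ : a₄ ∈ A
        a₅∈ : a₅ ∈ A
        a₁₂ : Adj a₁ a₂
        a₂₃ : Adj a₂ a₃
        a₃₄ : Adj a₃ a₄
        a₄₅ : Adj a₄ a₅
        a₃-apart : All (Apart a₃) (a₁ ∷ [])
        a₄-apart : All (Apart a₄) (a₁ ∷ a₂ ∷ [])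
        a₅-apart : All (Apart a₅) (a₁ ∷ a₂ ∷ a₃ ∷ [])

    module _ (S : DenseSubgraph adj? adj-sym A (+ 6 * n)) where
      open DenseSubgraph S
      private
        Step : P × P → List (P × P) → Set _
        Step a T = ∃[ b ] b ∈ vertices × Adj a b × All (Apart b) T
        step : ∀ {a} → a ∈ vertices → ∀ T → length T ℕ.≤ 3 → Step a T
        step {a} a∈ T |T|≤3 with any? (λ b → adj? a b ×-dec All.all? (apart? b) T) vertices
        ... | yes some with find some
        ...   | b , b∈ , adj , apart = b , b∈ , adj , apart
        step {a} a∈ T |T|≤3 | no none = ⊥-elim (<-irrefl refl (<-≤-trans (degree-> a∈) (begin
          ∑[ b ← vertices ] [ adj? a b ]
            ≤⟨ ∑-mono-∈ vertices blocked ⟩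
          ∑[ b ← vertices ] ∑[ t ← T ] collision t b
            ≡⟨ ∑-swap vertices T _ ⟩
          ∑[ t ← T ] ∑[ b ← vertices ] collision t b
            ≤⟨ ∑-mono T (λ t → ≤-trans (∑-≤ (collision t) (collision-nonneg t)) (∑-collision t)) ⟩
          ∑[ t ← T ] + 2 * n
            ≡⟨ ∑-const T (+ 2 * n) ⟩
          + length T * (+ 2 * n)
            ≤⟨ *-monoʳ-≤-nonNeg (+ 2 * n) {{ℤ.nonNegative (nonneg-* {+ 2} {n} (+≤+ z≤n) 0≤n)}} {+ length T} {+ 3} (+≤+ |T|≤3) ⟩
          + 3 * (+ 2 * n)
            ≡⟨ sym (*-assoc (+ 3) (+ 2) n) ⟩
          + 6 * n ∎)))
          where
          open ≤-Reasoning
          not-all : ∀ b T → ¬ All (Apart b) T → 1ℤ ≤ ∑[ t ← T ] collision t b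
          not-all b [] ¬all = ⊥-elim (¬all [])
          not-all b (t ∷ T) ¬all with apart? b t
          ... | yes apart = +-mono-≤ (collision-nonneg t b) (not-all b T λ all → ¬all (apart ∷ all))
          ... | no ¬apart = +-mono-≤ (¬apart⇒collision ¬apart) (∑-nonneg T λ t → collision-nonneg t b)
          blocked : ∀ {b} → b ∈ vertices → [ adj? a b ] ≤ ∑[ t ← T ] collision t b
          blocked {b} b∈ with adj? a b
          ... | no _    = ∑-nonneg T λ t → collision-nonneg t b
          ... | yes adj = not-all b T λ all → none (lose b∈ (adj , all))
        s₂ : Step root []
        s₂ = step root∈ [] z≤n
        s₂∈ = proj₁ (proj₂ s₂)
        s₃ : Step (proj₁ s₂) (root ∷ [])
        s₃ = step s₂∈ _ (s≤s z≤n)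
        s₃∈ = proj₁ (proj₂ s₃)
        s₄ : Step (proj₁ s₃) (root ∷ proj₁ s₂ ∷ [])
        s₄ = step s₃∈ _ (s≤s (s≤s z≤n))
        s₄∈ = proj₁ (proj₂ s₄)
        s₅ : Step (proj₁ s₄) (root ∷ proj₁ s₂ ∷ proj₁ s₃ ∷ [])
        s₅ = step s₄∈ _ (s≤s (s≤s (s≤s z≤n)))

      path-in : Path₅
      path-in = record
        { a₁∈ = ⊆ root∈ ; a₂∈ = ⊆ s₂∈ ; a₃∈ = ⊆ s₃∈ ; a₄∈ = ⊆ s₄∈ ; a₅∈ = ⊆ (proj₁ (proj₂ s₅))
        ; a₁₂ = proj₁ (proj₂ (proj₂ s₂)) ; a₂₃ = proj₁ (proj₂ (proj₂ s₃)) ; a₃₄ = proj₁ (proj₂ (proj₂ s₄))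
        ; a₄₅ = proj₁ (proj₂ (proj₂ s₅))
        ; a₃-apart = proj₂ (proj₂ (proj₂ s₃)) ; a₄-apart = proj₂ (proj₂ (proj₂ s₄)) ; a₅-apart = proj₂ (proj₂ (proj₂ s₅)) }

    path₅ : + 12 * (n * (n * n)) < ∑ A (degree adj? adj-sym A) → Path₅
    path₅ dense = path-in (dense-subgraph adj? adj-sym (+ 6 * n) A
      (subst (_< ∑ A (degree adj? adj-sym A)) (trans (lemma n (n * n)) (cong (+ 2 * (+ 6 * n) *_) (sym size))) dense))
      where
      size : + length A ≡ n * n
      size = trans (sym (trans (∑-const A 1ℤ) (*-identityʳ _)))
        (trans (∑-cartesian _,_ E E _) (trans (∑∑-const E E 1ℤ) (cong₂ _*_ |E|≡n (trans (*-identityʳ _) |E|≡n))))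
      lemma : ∀ i j → + 12 * (i * j) ≡ + 2 * (+ 6 * i) * j
      lemma = solve-∀

module FiniteFields where
  open import Data.Integer as ℤ using (ℤ; +_; 0ℤ; 1ℤ; _+_; _*_; -_; _-_; _≤_; _<_; _^_; +≤+; +<+)
  open import Data.Integer.Properties hiding (_≟_)
  open import Data.Integer.Tactic.RingSolver using (solve-∀)
  import Data.Nat.Properties as ℕ
  open IntegerSums
  open IntegerBounds
  open Thresholds using (Large)
  open DenseGraphs

  -- Sums over a finite field and the function `ψ`.

  module Field {c q} (F : FiniteField c q) where
    open FiniteField F public
      renaming (_+_ to infixl 6 _⊕_; _*_ to infixl 7 _⊙_; -_ to infix 8 ⊖_; _-_ to infixl 6 _⊝_)

    commutativeRing : CommutativeRing c c
    commutativeRing = record { isCommutativeRing = isCommutativeRing }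

    module R where
      open CommutativeRing commutativeRing public
      open RingProperties ring public

    open NaturalCoefficients R.commutativeSemiring public using (solve; con; _:+_; _:*_; _:=_)

    infix 4 _≟_
    _≟_ : DecidableEquality Carrier
    x ≟ y = map′ injective (cong (Inverse.to enumeration)) (Inverse.to enumeration x Fin.≟ Inverse.to enumeration y)
      where
      injective : Inverse.to enumeration x ≡ Inverse.to enumeration y → x ≡ y
      injective e = trans (sym (Inverse.strictlyInverseʳ enumeration x))
        (trans (cong (Inverse.from enumeration) e) (Inverse.strictlyInverseʳ enumeration y))

    ⊝-zero⇒≡ : ∀ {x y} → x ⊝ y ≡ 0# → x ≡ y
    ⊝-zero⇒≡ = R.x∙y⁻¹≈ε⇒x≈y _ _

    ⊕-⊖ : ∀ x y → x ⊕ y ⊕ ⊖ y ≡ x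
    ⊕-⊖ x y = trans (R.+-assoc x y (⊖ y)) (trans (cong (x ⊕_) (R.-‿inverseʳ y)) (R.+-identityʳ x))

    ⊖-⊕ : ∀ x y → x ⊕ ⊖ y ⊕ y ≡ x
    ⊖-⊕ x y = trans (R.+-assoc x (⊖ y) y) (trans (cong (x ⊕_) (R.-‿inverseˡ y)) (R.+-identityʳ x))

    inv : ∀ {s} → s ≢ 0# → Carrier
    inv {s} s≢0 = proj₁ (inverse s s≢0)

    ⊙-inv : ∀ {s} (s≢0 : s ≢ 0#) x → s ⊙ (inv s≢0 ⊙ x) ≡ x
    ⊙-inv {s} s≢0 x =
      trans (sym (R.*-assoc s _ x)) (trans (cong (_⊙ x) (proj₂ (inverse s s≢0))) (R.*-identityˡ x))

    inv-⊙ : ∀ {s} (s≢0 : s ≢ 0#) x → inv s≢0 ⊙ (s ⊙ x) ≡ x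
    inv-⊙ {s} s≢0 x =
      trans (solve 3 (λ s t x → t :* (s :* x) := s :* (t :* x)) refl s (inv s≢0) x) (⊙-inv s≢0 x)

    ⊙-zero : ∀ {s x} → s ≢ 0# → s ⊙ x ≡ 0# → x ≡ 0#
    ⊙-zero {s} {x} s≢0 sx≡0 =
      trans (sym (inv-⊙ s≢0 x)) (trans (cong (inv s≢0 ⊙_) sx≡0) (R.zeroʳ _))

    ⊖-nonzero : ∀ {s} → s ≢ 0# → ⊖ s ≢ 0#
    ⊖-nonzero s≢0 e = s≢0 (trans (sym (R.-‿involutive _)) (trans (cong ⊖_ e) R.-0#≈0#))

    squares-≡ : ∀ a b → a ⊙ a ≡ b ⊙ b → a ≡ b ⊎ a ≡ ⊖ b
    squares-≡ a b e with a ⊝ b ≟ 0#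
    ... | yes a-b≡0 = inj₁ (⊝-zero⇒≡ a-b≡0)
    ... | no  a-b≢0 = inj₂ (⊝-zero⇒≡ (trans (cong (a ⊕_) (R.-‿involutive b)) (⊙-zero a-b≢0 product≡0)))
      where
      product≡0 : (a ⊝ b) ⊙ (a ⊕ b) ≡ 0#
      product≡0 = begin
        (a ⊕ ⊖ b) ⊙ (a ⊕ b)
          ≡⟨ solve 3 (λ a b n → (a :+ n) :* (a :+ b) := a :* a :+ n :* b :+ a :* (b :+ n)) refl a b (⊖ b) ⟩
        a ⊙ a ⊕ ⊖ b ⊙ b ⊕ a ⊙ (b ⊕ ⊖ b)
          ≡⟨ cong₂ _⊕_ (cong₂ _⊕_ e (sym (R.-‿distribˡ-* b b))) (trans (cong (a ⊙_) (R.-‿inverseʳ b)) (R.zeroʳ a)) ⟩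
        b ⊙ b ⊕ ⊖ (b ⊙ b) ⊕ 0#
          ≡⟨ trans (R.+-identityʳ _) (R.-‿inverseʳ _) ⟩
        0# ∎
        where open ≡-Reasoning

    Q : ℤ
    Q = + q

    elements : List Carrier
    elements = map (Inverse.from enumeration) (allFin q)

    ∈-elements : ∀ x → x ∈ elements
    ∈-elements x = subst (_∈ elements) (Inverse.strictlyInverseʳ enumeration x)
      (∈-map⁺ (Inverse.from enumeration) (∈-allFin (Inverse.to enumeration x)))

    enumerates : Enumerates _≟_ elements
    enumerates x = unique⇒∑≡1 _≟_ (Unique.map⁺ injective (Unique.allFin⁺ q)) (∈-elements x)
      where
      injective : ∀ {i j} → Inverse.from enumeration i ≡ Inverse.from enumeration j → i ≡ j
      injective {i} {j} e = trans (sym (Inverse.strictlyInverseˡ enumeration i))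
        (trans (cong (Inverse.to enumeration) e) (Inverse.strictlyInverseˡ enumeration j))

    ∑F : (Carrier → ℤ) → ℤ
    ∑F = ∑ elements

    infix 5 ∑F
    syntax ∑F (λ x → e) = ∑[ x ] e

    ∑F-const : ∀ k → ∑[ x ] k ≡ Q * k
    ∑F-const k = trans (∑-const elements k)
      (cong (λ n → + n * k) (trans (length-map _ (allFin q)) (length-tabulate {n = q} id)))

    pick : ∀ (g : Carrier → ℤ) b → ∑[ x ] [ x ≟ b ] * g x ≡ g b
    pick = ∑-pick _≟_ elements enumerates

    ∑-shift : ∀ t (g : Carrier → ℤ) → ∑[ x ] g (x ⊕ t) ≡ ∑F g
    ∑-shift t = ∑-reindex _≟_ elements enumerates (_⊕ t) (_⊕ ⊖ t) (λ x → ⊖-⊕ x t) (λ x → ⊕-⊖ x t)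

    ∑-scale : ∀ {s} → s ≢ 0# → (g : Carrier → ℤ) → ∑[ x ] g (s ⊙ x) ≡ ∑F g
    ∑-scale {s} s≢0 = ∑-reindex _≟_ elements enumerates (s ⊙_) (inv s≢0 ⊙_) (⊙-inv s≢0) (inv-⊙ s≢0)

    -- The sum of χ(a) over the nontrivial additive characters χ of the field.
    ψ : Carrier → ℤ
    ψ a = Q * [ a ≟ 0# ] - 1ℤ

    ψ-0 : ψ 0# ≡ Q - 1ℤ
    ψ-0 = trans (cong (λ b → Q * b - 1ℤ) ([]-yes (0# ≟ 0#) refl)) (cong (_- 1ℤ) (*-identityʳ Q))

    ψ-≢0 : ∀ {a} → a ≢ 0# → ψ a ≡ - 1ℤ
    ψ-≢0 {a} a≢0 = trans (cong (λ b → Q * b - 1ℤ) ([]-no (a ≟ 0#) a≢0)) (cong (_- 1ℤ) (*-zeroʳ Q))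

    ψ-⇔ : ∀ {a b} → (a ≡ 0# → b ≡ 0#) → (b ≡ 0# → a ≡ 0#) → ψ a ≡ ψ b
    ψ-⇔ {a} {b} f g = cong (λ k → Q * k - 1ℤ) ([]-⇔ (a ≟ 0#) (b ≟ 0#) f g)

    ψ-scale : ∀ {s} → s ≢ 0# → ∀ a → ψ (s ⊙ a) ≡ ψ a
    ψ-scale s≢0 a = ψ-⇔ (⊙-zero s≢0) (λ { refl → R.zeroʳ _ })

    ψ-⊖ : ∀ a → ψ (⊖ a) ≡ ψ a
    ψ-⊖ a = ψ-⇔ (λ e → trans (sym (R.-‿involutive a)) (trans (cong ⊖_ e) R.-0#≈0#)) (λ { refl → R.-0#≈0# })

    ∑ψ : ∑F ψ ≡ 0ℤ
    ∑ψ = begin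
      ∑[ x ] Q * [ x ≟ 0# ] - 1ℤ                   ≡⟨ ∑-+ elements _ _ ⟩
      (∑[ x ] Q * [ x ≟ 0# ]) + (∑[ x ] - 1ℤ)       ≡⟨ cong₂ _+_ (∑-*ˡ elements Q _) (∑F-const (- 1ℤ)) ⟩
      Q * (∑[ x ] [ x ≟ 0# ]) + Q * - 1ℤ            ≡⟨ cong (λ k → Q * k + Q * - 1ℤ) (enumerates 0#) ⟩
      Q * 1ℤ + Q * - 1ℤ                             ≡⟨ lemma Q ⟩
      0ℤ ∎
      where
      open ≡-Reasoning
      lemma : ∀ k → k * 1ℤ + k * - 1ℤ ≡ 0ℤ
      lemma = solve-∀

    ∑ψ-shift : ∀ t → ∑[ x ] ψ (x ⊕ t) ≡ 0ℤ
    ∑ψ-shift t = trans (∑-shift t ψ) ∑ψ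

    ∑ψ-affine : ∀ {s} → s ≢ 0# → ∀ t → ∑[ x ] ψ (s ⊙ x ⊕ t) ≡ 0ℤ
    ∑ψ-affine s≢0 t = trans (∑-scale s≢0 λ x → ψ (x ⊕ t)) (∑ψ-shift t)

    -- The sum over l ≢ 0# alone is ψ a * ψ b.
    ∑ψ-pencil : ∀ a b → ∑[ l ] ψ (l ⊙ a ⊕ b) ≡ Q * [ a ≟ 0# ] * ψ b
    ∑ψ-pencil a b with a ≟ 0#
    ... | yes refl = trans (∑-cong elements λ l → cong ψ (trans (cong (_⊕ b) (R.zeroʳ l)) (R.+-identityˡ b)))
                       (trans (∑F-const (ψ b)) (cong (_* ψ b) (sym (*-identityʳ Q))))
    ... | no a≢0   = begin
      ∑[ l ] ψ (l ⊙ a ⊕ b)  ≡⟨ ∑-cong elements (λ l → cong (λ x → ψ (x ⊕ b)) (R.*-comm l a)) ⟩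
      ∑[ l ] ψ (a ⊙ l ⊕ b)  ≡⟨ ∑ψ-affine a≢0 b ⟩
      0ℤ                    ≡⟨ sym (trans (cong (_* ψ b) (*-zeroʳ Q)) (*-zeroˡ (ψ b))) ⟩
      Q * 0ℤ * ψ b          ∎
      where open ≡-Reasoning

    ∑-ψ-pick : ∀ u (g : Carrier → ℤ) → ∑[ t ] ψ (t ⊕ u) * g t ≡ Q * g (⊖ u) - ∑F g
    ∑-ψ-pick u g = begin
      ∑[ t ] ψ (t ⊕ u) * g t
        ≡⟨ ∑-cong elements (λ t → trans (cong (λ b → (Q * b - 1ℤ) * g t) ([]-⇔ (t ⊕ u ≟ 0#) (t ≟ ⊖ u) (to t) (from t)))
                                    (lemma Q [ t ≟ ⊖ u ] (g t))) ⟩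
      ∑[ t ] (Q * ([ t ≟ ⊖ u ] * g t) + - 1ℤ * g t)
        ≡⟨ ∑-+ elements _ _ ⟩
      (∑[ t ] Q * ([ t ≟ ⊖ u ] * g t)) + (∑[ t ] - 1ℤ * g t)
        ≡⟨ cong₂ _+_ (trans (∑-*ˡ elements Q _) (cong (Q *_) (pick g (⊖ u)))) (trans (∑-*ˡ elements (- 1ℤ) g) (-1*i≡-i _)) ⟩
      Q * g (⊖ u) - ∑F g ∎
      where
      open ≡-Reasoning
      to : ∀ t → t ⊕ u ≡ 0# → t ≡ ⊖ u
      to t e = trans (sym (⊕-⊖ t u)) (trans (cong (_⊕ ⊖ u) e) (R.+-identityˡ _))
      from : ∀ t → t ≡ ⊖ u → t ⊕ u ≡ 0#
      from t refl = R.-‿inverseˡ u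
      lemma : ∀ k b x → (k * b - 1ℤ) * x ≡ k * (b * x) + - 1ℤ * x
      lemma = solve-∀

    -- Orthogonality of characters: in the product of the two character sums only conjugate
    -- characters survive the sum over `t`, each contributing `Q` times its value at the difference.
    ∑ψψ : ∀ u v → ∑[ t ] ψ (t ⊕ u) * ψ (t ⊕ v) ≡ Q * ψ (v ⊝ u)
    ∑ψψ u v = begin
      ∑[ t ] ψ (t ⊕ u) * ψ (t ⊕ v)             ≡⟨ ∑-ψ-pick u (λ t → ψ (t ⊕ v)) ⟩
      Q * ψ (⊖ u ⊕ v) - (∑[ t ] ψ (t ⊕ v))     ≡⟨ cong₂ (λ x y → Q * ψ x - y) (R.+-comm (⊖ u) v) (∑ψ-shift v) ⟩
      Q * ψ (v ⊝ u) - 0ℤ                       ≡⟨ +-identityʳ _ ⟩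
      Q * ψ (v ⊝ u)                            ∎
      where open ≡-Reasoning

    -- For equal lists and functions the right-hand side is a sum of integer squares. This is the
    -- positive definiteness of `ψ`, in place of absolute squares of complex exponential sums.
    ∑ψ-differences : ∀ {a b} {A : Set a} {B : Set b} (xs : List A) (ys : List B) (u : A → Carrier) (v : B → Carrier) →
      Q * (∑[ x ← xs ] ∑[ y ← ys ] ψ (v y ⊝ u x)) ≡
      ∑[ t ] (∑[ x ← xs ] ψ (t ⊕ u x)) * (∑[ y ← ys ] ψ (t ⊕ v y))
    ∑ψ-differences xs ys u v = sym (begin
      ∑[ t ] (∑[ x ← xs ] ψ (t ⊕ u x)) * (∑[ y ← ys ] ψ (t ⊕ v y))
        ≡⟨ ∑-cong elements (λ t → ∑-*-∑ xs ys _ _) ⟩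
      ∑[ t ] ∑[ x ← xs ] ∑[ y ← ys ] ψ (t ⊕ u x) * ψ (t ⊕ v y)
        ≡⟨ ∑-swap elements xs _ ⟩
      ∑[ x ← xs ] ∑[ t ] ∑[ y ← ys ] ψ (t ⊕ u x) * ψ (t ⊕ v y)
        ≡⟨ ∑-cong xs (λ x → ∑-swap elements ys _) ⟩
      ∑[ x ← xs ] ∑[ y ← ys ] ∑[ t ] ψ (t ⊕ u x) * ψ (t ⊕ v y)
        ≡⟨ ∑-cong xs (λ x → ∑-cong ys λ y → ∑ψψ (u x) (v y)) ⟩
      ∑[ x ← xs ] ∑[ y ← ys ] Q * ψ (v y ⊝ u x)
        ≡⟨ ∑∑-*ˡ xs ys Q _ ⟩
      Q * (∑[ x ← xs ] ∑[ y ← ys ] ψ (v y ⊝ u x)) ∎)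
      where open ≡-Reasoning

  -- Odd order: square roots and hyperbolic planes.

  module OddField {c q} (F : FiniteField c q) (odd : ¬ (2 ∣ q)) where
    open Field F public

    3≤q : 3 ℕ.≤ q
    3≤q = cases q odd enumeration
      where
      cases : ∀ n → ¬ (2 ∣ n) → Inverse (setoid Carrier) (setoid (Fin n)) → 3 ℕ.≤ n
      cases 0 odd _ = ⊥-elim (odd (divides 0 refl))
      cases 1 _ e = ⊥-elim (1≢0 (trans (sym (Inverse.strictlyInverseʳ e 1#))
        (trans (cong (Inverse.from e) (all≡ (Inverse.to e 1#) (Inverse.to e 0#))) (Inverse.strictlyInverseʳ e 0#))))
        where
        all≡ : (i j : Fin 1) → i ≡ j
        all≡ Fin.zero Fin.zero = refl
      cases 2 odd _ = ⊥-elim (odd (divides 1 refl))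
      cases (suc (suc (suc n))) _ _ = s≤s (s≤s (s≤s z≤n))

    instance
      Q-positive : ℤ.Positive Q
      Q-positive = ℤ.positive (+<+ (ℕ.≤-trans (s≤s z≤n) 3≤q))

    two : Carrier
    two = 1# ⊕ 1#

    two-⊙ : ∀ x → two ⊙ x ≡ x ⊕ x
    two-⊙ x = trans (R.distribʳ x 1# 1#) (cong₂ _⊕_ (R.*-identityˡ x) (R.*-identityˡ x))

    -- In characteristic 2 the involution x ↦ x + 1 would split the field into pairs.
    two≢0 : two ≢ 0#
    two≢0 two≡0 = odd (halve s (trans (sym ∑ascents) (trans (∑F-const 1ℤ) (*-identityʳ Q))))
      where
      index : Carrier → ℕ
      index x = toℕ (Inverse.to enumeration x)
      ascent? : ∀ x → Dec (index x ℕ.< index (x ⊕ 1#))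
      ascent? x = index x ℕ.<? index (x ⊕ 1#)
      s : ℤ
      s = ∑[ x ] [ ascent? x ]
      involutive : ∀ x → x ⊕ 1# ⊕ 1# ≡ x
      involutive x = trans (R.+-assoc x 1# 1#) (trans (cong (x ⊕_) two≡0) (R.+-identityʳ x))
      fixpoint-free : ∀ x → index x ≢ index (x ⊕ 1#)
      fixpoint-free x e = 1≢0 (sym (R.+-cancelˡ x 0# 1# (trans (R.+-identityʳ x) x≡x+1)))
        where
        x≡x+1 : x ≡ x ⊕ 1#
        x≡x+1 = trans (sym (Inverse.strictlyInverseʳ enumeration x))
          (trans (cong (Inverse.from enumeration) (Fin.toℕ-injective e)) (Inverse.strictlyInverseʳ enumeration (x ⊕ 1#)))
      one-ascent : ∀ x → [ ascent? x ] + [ ascent? (x ⊕ 1#) ] ≡ 1ℤ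
      one-ascent x with ℕ.<-cmp (index x) (index (x ⊕ 1#))
      ... | tri< l _ g = cong₂ _+_ ([]-yes (ascent? x) l)
                           ([]-no (ascent? (x ⊕ 1#)) λ h → g (subst (λ y → index (x ⊕ 1#) ℕ.< index y) (involutive x) h))
      ... | tri≈ _ e _ = ⊥-elim (fixpoint-free x e)
      ... | tri> l _ g = cong₂ _+_ ([]-no (ascent? x) l)
                           ([]-yes (ascent? (x ⊕ 1#)) (subst (λ y → index (x ⊕ 1#) ℕ.< index y) (sym (involutive x)) g))
      ∑ascents : (∑[ x ] 1ℤ) ≡ s + s
      ∑ascents = trans (∑-cong elements λ x → sym (one-ascent x))
        (trans (∑-+ elements _ _) (cong (_+_ s) (∑-shift 1# λ x → [ ascent? x ])))
      halve : ∀ s → s + s ≡ Q → 2 ∣ q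
      halve (+ m) e = divides m (trans (sym (+-injective e)) (trans (cong (ℕ._+_ m) (sym (ℕ.+-identityʳ m))) (ℕ.*-comm 2 m)))
      halve (ℤ.negsuc m) ()

    ≢⊖ : ∀ {b} → b ≢ 0# → b ≢ ⊖ b
    ≢⊖ {b} b≢0 b≡-b = b≢0 (⊙-zero two≢0 (trans (two-⊙ b) (trans (cong (b ⊕_) b≡-b) (R.-‿inverseʳ b))))

    ⊖-square : ∀ b → ⊖ b ⊙ ⊖ b ≡ b ⊙ b
    ⊖-square b = trans (sym (R.-‿distribˡ-* b (⊖ b)))
      (trans (cong ⊖_ (sym (R.-‿distribʳ-* b b))) (R.-‿involutive _))

    private
      two-points : ∀ b → ∑[ a ] ([ a ≟ b ] + [ a ≟ ⊖ b ]) ≡ + 2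
      two-points b = trans (∑-+ elements _ _) (cong₂ _+_ (enumerates b) (enumerates (⊖ b)))

    ∑-roots : ∀ {b} → b ≢ 0# → ∑[ a ] [ a ⊙ a ≟ b ⊙ b ] ≡ + 2
    ∑-roots {b} b≢0 = trans (∑-cong elements split) (two-points b)
      where
      split : ∀ a → [ a ⊙ a ≟ b ⊙ b ] ≡ [ a ≟ b ] + [ a ≟ ⊖ b ]
      split a with a ≟ b | a ≟ ⊖ b
      ... | yes refl | yes e    = ⊥-elim (≢⊖ b≢0 e)
      ... | yes refl | no _     = []-yes (b ⊙ b ≟ b ⊙ b) refl
      ... | no _     | yes refl = []-yes (_ ≟ _) (⊖-square b)
      ... | no a≢b   | no a≢-b  = []-no (a ⊙ a ≟ b ⊙ b) λ e → [ a≢b , a≢-b ]′ (squares-≡ a b e)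

    ∑-roots≤2 : ∀ s → ∑[ a ] [ a ⊙ a ≟ s ] ≤ + 2
    ∑-roots≤2 s with any? (λ b → b ⊙ b ≟ s) elements
    ... | no none = subst (_≤ + 2) (sym (∑-zero elements λ a → []-no (a ⊙ a ≟ s) λ e → none (lose (∈-elements a) e))) (+≤+ z≤n)
    ... | yes some with find some
    ...   | b , _ , refl = subst (∑F (λ a → [ a ⊙ a ≟ b ⊙ b ]) ≤_) (two-points b) (∑-mono elements bound)
      where
      bound : ∀ a → [ a ⊙ a ≟ b ⊙ b ] ≤ [ a ≟ b ] + [ a ≟ ⊖ b ]
      bound a with a ⊙ a ≟ b ⊙ b
      ... | no _ = +-mono-≤ ([]-nonneg (a ≟ b)) ([]-nonneg (a ≟ ⊖ b))
      ... | yes e with squares-≡ a b e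
      ...   | inj₁ a≡b  = +-mono-≤ (≤-reflexive (sym ([]-yes (a ≟ b) a≡b))) ([]-nonneg (a ≟ ⊖ b))
      ...   | inj₂ a≡-b = +-mono-≤ ([]-nonneg (a ≟ b)) (≤-reflexive (sym ([]-yes (a ≟ ⊖ b) a≡-b)))

    ∑ψ-square-pencil : ∀ s → ∑[ l ] ψ (l ⊙ l ⊙ s) ≡ (Q - 1ℤ) * (1ℤ + ψ s)
    ∑ψ-square-pencil s = begin
      ∑[ l ] ψ (l ⊙ l ⊙ s)
        ≡⟨ ∑-cong elements split ⟩
      ∑[ l ] ([ l ≟ 0# ] * (Q - 1ℤ - ψ s) + ψ s)
        ≡⟨ ∑-+ elements _ _ ⟩
      (∑[ l ] [ l ≟ 0# ] * (Q - 1ℤ - ψ s)) + (∑[ l ] ψ s)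
        ≡⟨ cong₂ _+_ (pick (λ _ → Q - 1ℤ - ψ s) 0#) (∑F-const (ψ s)) ⟩
      Q - 1ℤ - ψ s + Q * ψ s
        ≡⟨ lemma Q (ψ s) ⟩
      (Q - 1ℤ) * (1ℤ + ψ s) ∎
      where
      open ≡-Reasoning
      lemma : ∀ k x → k - 1ℤ - x + k * x ≡ (k - 1ℤ) * (1ℤ + x)
      lemma = solve-∀
      lemma₀ : ∀ k x → k - 1ℤ ≡ 1ℤ * (k - 1ℤ - x) + x
      lemma₀ = solve-∀
      split : ∀ l → ψ (l ⊙ l ⊙ s) ≡ [ l ≟ 0# ] * (Q - 1ℤ - ψ s) + ψ s
      split l with l ≟ 0#
      ... | yes refl = trans (cong ψ (trans (cong (_⊙ s) (R.zeroˡ 0#)) (R.zeroˡ s))) (trans ψ-0 (lemma₀ Q (ψ s)))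
      ... | no l≢0   = trans (cong ψ (R.*-assoc l l s)) (trans (ψ-scale l≢0 _)
                         (trans (ψ-scale l≢0 s) (sym (+-identityˡ (ψ s)))))

    ∑F-nonneg-zero : ∀ {g : Carrier → ℤ} → (∀ x → 0ℤ ≤ g x) → ∑F g ≡ 0ℤ → ∀ b → g b ≡ 0ℤ
    ∑F-nonneg-zero {g} 0≤g ∑≡0 b = ≤-antisym (subst₂ _≤_ (pick g b) ∑≡0 (∑-mono elements below)) (0≤g b)
      where
      below : ∀ x → [ x ≟ b ] * g x ≤ g x
      below x with x ≟ b
      ... | yes _ = ≤-reflexive (*-identityˡ (g x))
      ... | no  _ = 0≤g x

    -- The shift of `y` by `s ⊙ x` removes x² and leaves y² + 2sxy, which is linear in `x`. The sum
    -- over `x` then forces y = 0, because 2s is invertible.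
    hyperbolic-plane : ∀ {s} → s ≢ 0# → ∀ t →
      ∑[ x ] ∑[ y ] ψ (y ⊙ y ⊕ ⊖ (s ⊙ s) ⊙ (x ⊙ x) ⊕ t) ≡ Q * ψ t
    hyperbolic-plane {s} s≢0 t = begin
      ∑[ x ] ∑[ y ] ψ (y ⊙ y ⊕ ⊖ (s ⊙ s) ⊙ (x ⊙ x) ⊕ t)
        ≡⟨ ∑-cong elements (λ x → sym (∑-shift (s ⊙ x) λ y → ψ (y ⊙ y ⊕ ⊖ (s ⊙ s) ⊙ (x ⊙ x) ⊕ t))) ⟩
      ∑[ x ] ∑[ y ] ψ ((y ⊕ s ⊙ x) ⊙ (y ⊕ s ⊙ x) ⊕ ⊖ (s ⊙ s) ⊙ (x ⊙ x) ⊕ t)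
        ≡⟨ ∑-cong elements (λ x → ∑-cong elements λ y → cong ψ (identity x y)) ⟩
      ∑[ x ] ∑[ y ] ψ (x ⊙ (two ⊙ s ⊙ y) ⊕ (y ⊙ y ⊕ t))
        ≡⟨ ∑-swap elements elements _ ⟩
      ∑[ y ] ∑[ x ] ψ (x ⊙ (two ⊙ s ⊙ y) ⊕ (y ⊙ y ⊕ t))
        ≡⟨ ∑-cong elements (λ y → ∑ψ-pencil (two ⊙ s ⊙ y) (y ⊙ y ⊕ t)) ⟩
      ∑[ y ] Q * [ two ⊙ s ⊙ y ≟ 0# ] * ψ (y ⊙ y ⊕ t)
        ≡⟨ ∑-cong elements (λ y → trans (*-assoc Q _ _) (cong (λ k → Q * (k * ψ (y ⊙ y ⊕ t)))
              ([]-⇔ (two ⊙ s ⊙ y ≟ 0#) (y ≟ 0#) (⊙-zero 2s≢0) λ { refl → R.zeroʳ _ }))) ⟩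
      ∑[ y ] Q * ([ y ≟ 0# ] * ψ (y ⊙ y ⊕ t))
        ≡⟨ trans (∑-*ˡ elements Q _) (cong (Q *_) (pick (λ y → ψ (y ⊙ y ⊕ t)) 0#)) ⟩
      Q * ψ (0# ⊙ 0# ⊕ t)
        ≡⟨ cong (λ z → Q * ψ z) (trans (cong (_⊕ t) (R.zeroˡ 0#)) (R.+-identityˡ t)) ⟩
      Q * ψ t ∎
      where
      open ≡-Reasoning
      2s≢0 : two ⊙ s ≢ 0#
      2s≢0 e = s≢0 (⊙-zero two≢0 e)
      identity : ∀ x y → (y ⊕ s ⊙ x) ⊙ (y ⊕ s ⊙ x) ⊕ ⊖ (s ⊙ s) ⊙ (x ⊙ x) ⊕ t ≡ x ⊙ (two ⊙ s ⊙ y) ⊕ (y ⊙ y ⊕ t)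
      identity x y = begin
        (y ⊕ s ⊙ x) ⊙ (y ⊕ s ⊙ x) ⊕ ⊖ (s ⊙ s) ⊙ (x ⊙ x) ⊕ t
          ≡⟨ solve 5 (λ x y s n t → (y :+ s :* x) :* (y :+ s :* x) :+ n :* (x :* x) :+ t
                        := (x :* (s :* y :+ s :* y) :+ (y :* y :+ t)) :+ (s :* s :+ n) :* (x :* x)) refl x y s (⊖ (s ⊙ s)) t ⟩
        (x ⊙ (s ⊙ y ⊕ s ⊙ y) ⊕ (y ⊙ y ⊕ t)) ⊕ (s ⊙ s ⊕ ⊖ (s ⊙ s)) ⊙ (x ⊙ x)
          ≡⟨ cong₂ (λ u v → (x ⊙ u ⊕ (y ⊙ y ⊕ t)) ⊕ v)
               (trans (sym (two-⊙ (s ⊙ y))) (sym (R.*-assoc two s y)))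
               (trans (cong (_⊙ (x ⊙ x)) (R.-‿inverseʳ (s ⊙ s))) (R.zeroˡ _)) ⟩
        (x ⊙ (two ⊙ s ⊙ y) ⊕ (y ⊙ y ⊕ t)) ⊕ 0#
          ≡⟨ R.+-identityʳ _ ⟩
        x ⊙ (two ⊙ s ⊙ y) ⊕ (y ⊙ y ⊕ t) ∎

    difference-of-squares : ∀ t → ∑[ x ] ∑[ y ] ψ ((y ⊙ y ⊝ x ⊙ x) ⊕ t) ≡ Q * ψ t
    difference-of-squares t =
      trans (∑-cong elements λ x → ∑-cong elements λ y → cong (λ z → ψ (z ⊕ t)) (square⊖ x y))
        (hyperbolic-plane 1≢0 t)
      where
      square⊖ : ∀ x y → y ⊙ y ⊝ x ⊙ x ≡ y ⊙ y ⊕ ⊖ (1# ⊙ 1#) ⊙ (x ⊙ x)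
      square⊖ x y = cong (y ⊙ y ⊕_)
        (trans (sym (R.-1*x≈-x _)) (cong (λ z → ⊖ z ⊙ (x ⊙ x)) (sym (R.*-identityˡ 1#))))

    -- The Gauss sum of a sum of two squares.

    -- This integer is the square of the quadratic Gauss sum of the field. The Gauss sum itself
    -- depends on the character up to sign; its square does not.
    Γ : ℤ
    Γ = ∑[ a ] ψ (a ⊙ a ⊕ 1#)

    -- If -1 has no square root, every summand is -1 and the total is -Q. Otherwise there are
    -- exactly two roots, and the total is 2Q - Q = Q.
    Γ² : Γ * Γ ≡ Q * Q
    Γ² with any? (λ b → b ⊙ b ⊕ 1# ≟ 0#) elements
    ... | no none = trans (cong (λ g → g * g) Γ≡-Q) (lemma Q)
      where
      Γ≡-Q : Γ ≡ Q * - 1ℤ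
      Γ≡-Q = trans (∑-cong elements λ a → ψ-≢0 λ e → none (lose (∈-elements a) e)) (∑F-const (- 1ℤ))
      lemma : ∀ k → (k * - 1ℤ) * (k * - 1ℤ) ≡ k * k
      lemma = solve-∀
    ... | yes some with find some
    ...   | i , _ , i²+1≡0 = cong₂ _*_ Γ≡Q Γ≡Q
      where
      i≢0 : i ≢ 0#
      i≢0 refl = 1≢0 (trans (sym (R.+-identityˡ 1#)) (trans (cong (_⊕ 1#) (sym (R.zeroˡ 0#))) i²+1≡0))
      root : ∀ a → [ a ⊙ a ⊕ 1# ≟ 0# ] ≡ [ a ⊙ a ≟ i ⊙ i ]
      root a = []-⇔ (a ⊙ a ⊕ 1# ≟ 0#) (a ⊙ a ≟ i ⊙ i)
        (λ e → R.+-cancelʳ 1# _ _ (trans e (sym i²+1≡0))) (λ e → trans (cong (_⊕ 1#) e) i²+1≡0)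
      lemma : ∀ k → k * + 2 + k * - 1ℤ ≡ k
      lemma = solve-∀
      Γ≡Q : Γ ≡ Q
      Γ≡Q = begin
        ∑[ a ] Q * [ a ⊙ a ⊕ 1# ≟ 0# ] - 1ℤ
          ≡⟨ ∑-cong elements (λ a → cong (λ k → Q * k - 1ℤ) (root a)) ⟩
        ∑[ a ] Q * [ a ⊙ a ≟ i ⊙ i ] - 1ℤ
          ≡⟨ ∑-+ elements _ _ ⟩
        (∑[ a ] Q * [ a ⊙ a ≟ i ⊙ i ]) + (∑[ a ] - 1ℤ)
          ≡⟨ cong₂ _+_ (trans (∑-*ˡ elements Q _) (cong (Q *_) (∑-roots i≢0))) (∑F-const (- 1ℤ)) ⟩
        Q * + 2 + Q * - 1ℤ
          ≡⟨ lemma Q ⟩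
        Q ∎
        where open ≡-Reasoning

    private
      -- If -1 is not a square, the form a² + b² is anisotropic and admits no substitution like that
      -- for the hyperbolic plane. `T` is therefore determined through its moments.
      T : Carrier → ℤ
      T t = ∑[ a ] ∑[ b ] ψ (t ⊕ (a ⊙ a ⊕ b ⊙ b))

      T-0 : T 0# ≡ Γ * (Q - 1ℤ)
      T-0 = begin
        ∑[ a ] ∑[ b ] ψ (0# ⊕ (a ⊙ a ⊕ b ⊙ b))
          ≡⟨ ∑-cong elements row ⟩
        ∑[ a ] ([ a ≟ 0# ] * - Γ + Γ)
          ≡⟨ ∑-+ elements _ _ ⟩
        (∑[ a ] [ a ≟ 0# ] * - Γ) + (∑[ a ] Γ)
          ≡⟨ cong₂ _+_ (pick (λ _ → - Γ) 0#) (∑F-const Γ) ⟩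
        - Γ + Q * Γ
          ≡⟨ lemma Q Γ ⟩
        Γ * (Q - 1ℤ) ∎
        where
        open ≡-Reasoning
        lemma : ∀ k g → - g + k * g ≡ g * (k - 1ℤ)
        lemma = solve-∀
        row : ∀ a → ∑[ b ] ψ (0# ⊕ (a ⊙ a ⊕ b ⊙ b)) ≡ [ a ≟ 0# ] * - Γ + Γ
        row a with a ≟ 0#
        -- `ψ` only sees whether its argument vanishes, so b² may be replaced by b.
        ... | yes refl = trans (trans (∑-cong elements λ b → ψ-⇔ (to b) (from b)) ∑ψ) (lemma₀ Γ)
          where
          lemma₀ : ∀ g → 0ℤ ≡ 1ℤ * - g + g
          lemma₀ = solve-∀
          expand : ∀ b → 0# ⊕ (0# ⊙ 0# ⊕ b ⊙ b) ≡ b ⊙ b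
          expand b = trans (R.+-identityˡ _) (trans (cong (_⊕ b ⊙ b) (R.zeroˡ 0#)) (R.+-identityˡ _))
          to : ∀ b → 0# ⊕ (0# ⊙ 0# ⊕ b ⊙ b) ≡ 0# → b ≡ 0#
          to b e with b ≟ 0#
          ... | yes b≡0 = b≡0
          ... | no  b≢0 = ⊙-zero b≢0 (trans (sym (expand b)) e)
          from : ∀ b → b ≡ 0# → 0# ⊕ (0# ⊙ 0# ⊕ b ⊙ b) ≡ 0#
          from b refl = trans (expand b) (R.zeroˡ 0#)
        ... | no a≢0 = begin
          ∑[ b ] ψ (0# ⊕ (a ⊙ a ⊕ b ⊙ b))
            ≡⟨ sym (∑-scale a≢0 λ b → ψ (0# ⊕ (a ⊙ a ⊕ b ⊙ b))) ⟩
          ∑[ b ] ψ (0# ⊕ (a ⊙ a ⊕ a ⊙ b ⊙ (a ⊙ b)))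
            ≡⟨ ∑-cong elements (λ b → trans (cong ψ (identity b)) (trans (ψ-scale a≢0 _) (ψ-scale a≢0 _))) ⟩
          ∑[ b ] ψ (b ⊙ b ⊕ 1#)
            ≡⟨ sym (+-identityˡ Γ) ⟩
          0ℤ + Γ ∎
          where
          identity : ∀ b → 0# ⊕ (a ⊙ a ⊕ a ⊙ b ⊙ (a ⊙ b)) ≡ a ⊙ (a ⊙ (b ⊙ b ⊕ 1#))
          identity b = trans (R.+-identityˡ _) (trans
            (cong (_⊕ a ⊙ b ⊙ (a ⊙ b)) (sym (R.*-identityʳ (a ⊙ a))))
            (solve 3 (λ a b e → a :* a :* e :+ a :* b :* (a :* b) := a :* (a :* (b :* b :+ e))) refl a b 1#))

      -- The difference of two copies of a² + b² is a sum of two differences of squares, hence a sum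
      -- of hyperbolic planes whether or not -1 is a square.
      ∑T² : ∑[ t ] T t * T t ≡ Q * (Q * (Q * (Q - 1ℤ)))
      ∑T² = trans (∑-cong elements λ t → cong₂ _*_ (sym (flat t)) (sym (flat t)))
        (trans (sym (∑ψ-differences pairs pairs g g)) (cong (Q *_) differences))
        where
        open ≡-Reasoning
        open import Data.List using (cartesianProduct)
        pairs : List (Carrier × Carrier)
        pairs = cartesianProduct elements elements
        g : Carrier × Carrier → Carrier
        g (a , b) = a ⊙ a ⊕ b ⊙ b
        flat : ∀ t → ∑[ p ← pairs ] ψ (t ⊕ g p) ≡ T t
        flat t = ∑-cartesian _,_ elements elements _
        regroup : ∀ a b a′ b′ → (a′ ⊙ a′ ⊕ b′ ⊙ b′) ⊝ (a ⊙ a ⊕ b ⊙ b) ≡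
          (a′ ⊙ a′ ⊝ a ⊙ a) ⊕ (b′ ⊙ b′ ⊝ b ⊙ b)
        regroup a b a′ b′ = trans (cong (a′ ⊙ a′ ⊕ b′ ⊙ b′ ⊕_) (sym (R.-‿+-comm (a ⊙ a) (b ⊙ b))))
          (solve 4 (λ w x y z → (w :+ x) :+ (y :+ z) := (w :+ y) :+ (x :+ z)) refl
            (a′ ⊙ a′) (b′ ⊙ b′) (⊖ (a ⊙ a)) (⊖ (b ⊙ b)))
        differences : ∑[ p ← pairs ] ∑[ p′ ← pairs ] ψ (g p′ ⊝ g p) ≡ Q * (Q * (Q - 1ℤ))
        differences = begin
          ∑[ p ← pairs ] ∑[ p′ ← pairs ] ψ (g p′ ⊝ g p)
            ≡⟨ ∑-cong pairs (λ p → ∑-cartesian _,_ elements elements _) ⟩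
          ∑[ p ← pairs ] ∑[ a′ ] ∑[ b′ ] ψ ((a′ ⊙ a′ ⊕ b′ ⊙ b′) ⊝ g p)
            ≡⟨ ∑-cartesian _,_ elements elements _ ⟩
          ∑[ a ] ∑[ b ] ∑[ a′ ] ∑[ b′ ] ψ ((a′ ⊙ a′ ⊕ b′ ⊙ b′) ⊝ (a ⊙ a ⊕ b ⊙ b))
            ≡⟨ ∑-cong elements (λ a → ∑-swap elements elements _) ⟩
          ∑[ a ] ∑[ a′ ] ∑[ b ] ∑[ b′ ] ψ ((a′ ⊙ a′ ⊕ b′ ⊙ b′) ⊝ (a ⊙ a ⊕ b ⊙ b))
            ≡⟨ ∑-cong elements (λ a → ∑-cong elements λ a′ → trans
                 (∑-cong elements λ b → ∑-cong elements λ b′ →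
                   cong ψ (trans (regroup a b a′ b′) (R.+-comm _ _)))
                 (difference-of-squares (a′ ⊙ a′ ⊝ a ⊙ a))) ⟩
          ∑[ a ] ∑[ a′ ] Q * ψ (a′ ⊙ a′ ⊝ a ⊙ a)
            ≡⟨ ∑∑-*ˡ elements elements Q _ ⟩
          Q * (∑[ a ] ∑[ a′ ] ψ (a′ ⊙ a′ ⊝ a ⊙ a))
            ≡⟨ cong (Q *_) (trans (∑-cong elements λ a → ∑-cong elements λ a′ → cong ψ (sym (R.+-identityʳ _)))
                 (trans (difference-of-squares 0#) (cong (Q *_) ψ-0))) ⟩
          Q * (Q * (Q - 1ℤ)) ∎

      ∑ψT : ∑[ t ] ψ (t ⊕ 0#) * T t ≡ Q * (Γ * (Q - 1ℤ))
      ∑ψT = begin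
        ∑[ t ] ψ (t ⊕ 0#) * T t
          ≡⟨ ∑-ψ-pick 0# T ⟩
        Q * T (⊖ 0#) - ∑F T
          ≡⟨ cong₂ (λ x y → Q * x - y) (trans (cong T R.-0#≈0#) T-0) ∑T ⟩
        Q * (Γ * (Q - 1ℤ)) - 0ℤ
          ≡⟨ +-identityʳ _ ⟩
        Q * (Γ * (Q - 1ℤ)) ∎
        where
        open ≡-Reasoning
        ∑T : ∑F T ≡ 0ℤ
        ∑T = trans (∑-swap elements elements _) (∑-zero elements λ a →
          trans (∑-swap elements elements _) (∑-zero elements λ b → ∑ψ-shift _))

    -- The second moment over t of the difference of the two sides vanishes.
    sum-of-two-squares : ∀ t → ∑[ a ] ∑[ b ] ψ (t ⊕ (a ⊙ a ⊕ b ⊙ b)) ≡ Γ * ψ t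
    sum-of-two-squares t = trans (i-j≡0⇒i≡j _ _ (square-zero _ (∑F-nonneg-zero (λ t → square-nonneg (deviation t)) second-moment t)))
      (cong (λ x → Γ * ψ x) (R.+-identityʳ t))
      where
      open ≡-Reasoning
      deviation : Carrier → ℤ
      deviation t = T t - Γ * ψ (t ⊕ 0#)
      square-zero : ∀ i → i * i ≡ 0ℤ → i ≡ 0ℤ
      square-zero i e = [ (λ z → z) , (λ z → z) ]′ (i*j≡0⇒i≡0∨j≡0 i e)
      expand : ∀ x g p → (x - g * p) * (x - g * p) ≡ x * x + (- (g + g)) * (p * x) + (g * g) * (p * p)
      expand = solve-∀
      cancel : ∀ k g → g * g ≡ k * k →
        k * (k * (k * (k - 1ℤ))) + (- (g + g)) * (k * (g * (k - 1ℤ))) + (g * g) * (k * (k - 1ℤ)) ≡ 0ℤ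
      cancel k g e = trans (lemma k g) (trans (cong (λ z → (k * k - z) * (k * (k - 1ℤ))) e) (lemma′ k))
        where
        lemma : ∀ k g → k * (k * (k * (k - 1ℤ))) + (- (g + g)) * (k * (g * (k - 1ℤ))) + (g * g) * (k * (k - 1ℤ))
          ≡ (k * k - g * g) * (k * (k - 1ℤ))
        lemma = solve-∀
        lemma′ : ∀ k → (k * k - k * k) * (k * (k - 1ℤ)) ≡ 0ℤ
        lemma′ = solve-∀
      second-moment : ∑[ t ] deviation t * deviation t ≡ 0ℤ
      second-moment = begin
        ∑[ t ] deviation t * deviation t
          ≡⟨ ∑-cong elements (λ t → expand (T t) Γ (ψ (t ⊕ 0#))) ⟩
        ∑[ t ] T t * T t + (- (Γ + Γ)) * (ψ (t ⊕ 0#) * T t) + (Γ * Γ) * (ψ (t ⊕ 0#) * ψ (t ⊕ 0#))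
          ≡⟨ trans (∑-+ elements _ _) (cong₂ _+_ (trans (∑-+ elements _ _)
               (cong₂ _+_ ∑T² (trans (∑-*ˡ elements (- (Γ + Γ)) _) (cong ((- (Γ + Γ)) *_) ∑ψT))))
               (trans (∑-*ˡ elements (Γ * Γ) _) (cong ((Γ * Γ) *_) (trans (∑ψψ 0# 0#)
                 (cong (Q *_) (trans (cong ψ (R.-‿inverseʳ 0#)) ψ-0)))))) ⟩
        Q * (Q * (Q * (Q - 1ℤ))) + (- (Γ + Γ)) * (Q * (Γ * (Q - 1ℤ))) + (Γ * Γ) * (Q * (Q - 1ℤ))
          ≡⟨ cancel Q Γ Γ² ⟩
        0ℤ ∎

  -- Quadratic forms on vectors, their Gauss sums and their cones.

  module QuadraticForms {c q} (F : FiniteField c q) (odd : ¬ (2 ∣ q)) where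
    open OddField F odd public

    infixl 6 _⊕ᵛ_
    infixl 7 _•_ _·_

    _⊕ᵛ_ : ∀ {d} → Point d → Point d → Point d
    _⊕ᵛ_ = zipWith _⊕_

    _•_ : ∀ {d} → Carrier → Point d → Point d
    l • z = Vec.map (l ⊙_) z

    _·_ : ∀ {d} → Point d → Point d → Carrier
    []      · []      = 0#
    (a ∷ x) · (b ∷ y) = a ⊙ b ⊕ x · y

    vectors : ∀ d → List (Point d)
    vectors zero    = [] ∷ []
    vectors (suc d) = cartesianProductWith _∷_ elements (vectors d)

    ∑-vectors : ∀ {d} (h : Point (suc d) → ℤ) →
      ∑ (vectors (suc d)) h ≡ ∑[ a ] ∑[ x ← vectors d ] h (a ∷ x)
    ∑-vectors {d} = ∑-cartesian _∷_ elements (vectors d)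

    ∑-shiftᵛ : ∀ {d} (w : Point d) (h : Point d → ℤ) →
      ∑[ x ← vectors d ] h (x ⊕ᵛ w) ≡ ∑ (vectors d) h
    ∑-shiftᵛ [] h = refl
    ∑-shiftᵛ {suc d} (b ∷ w) h = begin
      ∑[ x ← vectors (suc d) ] h (x ⊕ᵛ (b ∷ w))         ≡⟨ ∑-vectors _ ⟩
      ∑[ a ] ∑[ x ← vectors d ] h (a ⊕ b ∷ x ⊕ᵛ w)      ≡⟨ ∑-shift b (λ a → ∑[ x ← vectors d ] h (a ∷ x ⊕ᵛ w)) ⟩
      ∑[ a ] ∑[ x ← vectors d ] h (a ∷ x ⊕ᵛ w)          ≡⟨ ∑-cong elements (λ a → ∑-shiftᵛ w λ x → h (a ∷ x)) ⟩
      ∑[ a ] ∑[ x ← vectors d ] h (a ∷ x)               ≡⟨ sym (∑-vectors h) ⟩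
      ∑ (vectors (suc d)) h                             ∎
      where open ≡-Reasoning

    ∑-scaleᵛ : ∀ {d l} → l ≢ 0# → (h : Point d → ℤ) →
      ∑[ x ← vectors d ] h (l • x) ≡ ∑ (vectors d) h
    ∑-scaleᵛ {zero} _ h = refl
    ∑-scaleᵛ {suc d} {l} l≢0 h = begin
      ∑[ x ← vectors (suc d) ] h (l • x)               ≡⟨ ∑-vectors _ ⟩
      ∑[ a ] ∑[ x ← vectors d ] h (l ⊙ a ∷ l • x)      ≡⟨ ∑-scale l≢0 (λ a → ∑[ x ← vectors d ] h (a ∷ l • x)) ⟩
      ∑[ a ] ∑[ x ← vectors d ] h (a ∷ l • x)          ≡⟨ ∑-cong elements (λ a → ∑-scaleᵛ l≢0 λ x → h (a ∷ x)) ⟩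
      ∑[ a ] ∑[ x ← vectors d ] h (a ∷ x)              ≡⟨ sym (∑-vectors h) ⟩
      ∑ (vectors (suc d)) h                            ∎
      where open ≡-Reasoning

    ‖•‖ : ∀ {d} l (x : Point d) → ‖ l • x ‖ ≡ l ⊙ l ⊙ ‖ x ‖
    ‖•‖ l [] = sym (R.zeroʳ _)
    ‖•‖ l (a ∷ x) = trans (cong (l ⊙ a ⊙ (l ⊙ a) ⊕_) (‖•‖ l x))
      (solve 3 (λ l a n → l :* a :* (l :* a) :+ l :* l :* n := l :* l :* (a :* a :+ n)) refl l a ‖ x ‖)

    •-· : ∀ {d} l (x z : Point d) → (l • x) · z ≡ l ⊙ (x · z)
    •-· l [] [] = sym (R.zeroʳ l)
    •-· l (a ∷ x) (b ∷ z) = trans (cong (l ⊙ a ⊙ b ⊕_) (•-· l x z))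
      (solve 4 (λ l a b p → l :* a :* b :+ l :* p := l :* (a :* b :+ p)) refl l a b (x · z))

    ‖⊕•‖ : ∀ {d} l (x z : Point d) → ‖ x ⊕ᵛ l • z ‖ ≡ l ⊙ (two ⊙ (x · z)) ⊕ ‖ x ‖ ⊕ l ⊙ l ⊙ ‖ z ‖
    ‖⊕•‖ l x z = trans (expand l x z) (cong (λ p → l ⊙ p ⊕ ‖ x ‖ ⊕ l ⊙ l ⊙ ‖ z ‖) (sym (two-⊙ (x · z))))
      where
      expand : ∀ {d} l (x z : Point d) → ‖ x ⊕ᵛ l • z ‖ ≡ l ⊙ (x · z ⊕ x · z) ⊕ ‖ x ‖ ⊕ l ⊙ l ⊙ ‖ z ‖
      expand l [] [] = solve 1 (λ l → con 0 := l :* (con 0 :+ con 0) :+ con 0 :+ l :* l :* con 0) refl l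
      expand l (a ∷ x) (b ∷ z) = trans (cong ((a ⊕ l ⊙ b) ⊙ (a ⊕ l ⊙ b) ⊕_) (expand l x z))
        (solve 6 (λ l a b p m n →
           (a :+ l :* b) :* (a :+ l :* b) :+ (l :* (p :+ p) :+ m :+ l :* l :* n)
           := l :* ((a :* b :+ p) :+ (a :* b :+ p)) :+ (a :* a :+ m) :+ l :* l :* (b :* b :+ n))
           refl l a b (x · z) ‖ x ‖ ‖ z ‖)

    -- The function `h` is arbitrary so that it can contain the remaining variables of a larger
    -- form, even a sum over them.
    complete-square : ∀ {d} l (z : Point d) (h : Carrier → ℤ) →
      ∑[ x ← vectors d ] h (l ⊙ (two ⊙ (x · z)) ⊕ ‖ x ‖) ≡ ∑[ x ← vectors d ] h (‖ x ‖ ⊝ l ⊙ l ⊙ ‖ z ‖)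
    complete-square {d} l z h = trans (∑-cong (vectors d) λ x → cong h (sym (trans
        (cong (_⊝ l ⊙ l ⊙ ‖ z ‖) (‖⊕•‖ l x z)) (⊕-⊖ _ _))))
      (∑-shiftᵛ (l • z) λ x → h (‖ x ‖ ⊝ l ⊙ l ⊙ ‖ z ‖))

    -- By Fourier inversion in `t` this says that every nontrivial character has the same sum `g`
    -- over the values of `f`.
    GaussSum : ∀ {a} {A : Set a} → List A → (A → Carrier) → ℤ → Set c
    GaussSum V f g = ∀ t → ∑[ x ← V ] ψ (t ⊕ f x) ≡ g * ψ t

    norm-even : ∀ m → ∃ λ g → g * g ≡ Q ^ (m ℕ.* 2) × GaussSum (vectors (m ℕ.* 2)) ‖_‖ g
    norm-even zero = 1ℤ , refl , λ t → trans (+-identityʳ _) (trans (cong ψ (R.+-identityʳ t)) (sym (*-identityˡ _)))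
    norm-even (suc m) with norm-even m
    ... | g , g²≡ , gauss = g * Γ , squared , λ t → begin
      ∑[ x ← vectors (suc m ℕ.* 2) ] ψ (t ⊕ ‖ x ‖)
        ≡⟨ trans (∑-vectors (λ x → ψ (t ⊕ ‖ x ‖))) (∑-cong elements λ a → ∑-vectors λ x → ψ (t ⊕ (a ⊙ a ⊕ ‖ x ‖))) ⟩
      ∑[ a ] ∑[ b ] ∑[ x ← vectors (m ℕ.* 2) ] ψ (t ⊕ (a ⊙ a ⊕ (b ⊙ b ⊕ ‖ x ‖)))
        ≡⟨ ∑-cong elements (λ a → ∑-cong elements λ b → trans
             (∑-cong (vectors (m ℕ.* 2)) λ x → cong ψ (solve 4 (λ t u v n → t :+ (u :+ (v :+ n)) := t :+ (u :+ v) :+ n)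
               refl t (a ⊙ a) (b ⊙ b) ‖ x ‖))
             (gauss (t ⊕ (a ⊙ a ⊕ b ⊙ b)))) ⟩
      ∑[ a ] ∑[ b ] g * ψ (t ⊕ (a ⊙ a ⊕ b ⊙ b))
        ≡⟨ ∑∑-*ˡ elements elements g _ ⟩
      g * (∑[ a ] ∑[ b ] ψ (t ⊕ (a ⊙ a ⊕ b ⊙ b)))
        ≡⟨ cong (g *_) (sum-of-two-squares t) ⟩
      g * (Γ * ψ t)
        ≡⟨ sym (*-assoc g Γ (ψ t)) ⟩
      g * Γ * ψ t ∎
      where
      open ≡-Reasoning
      lemma : ∀ g x → g * x * (g * x) ≡ x * x * (g * g)
      lemma = solve-∀
      squared : g * Γ * (g * Γ) ≡ Q * (Q * Q ^ (m ℕ.* 2))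
      squared = trans (lemma g Γ) (trans (cong₂ _*_ Γ² g²≡) (*-assoc Q Q _))

    -- Subtracting one more square turns the norm in odd dimension into a form of even dimension.
    normWithSquare : ∀ {d} → Point d × Carrier → Carrier
    normWithSquare (x , a) = ‖ x ‖ ⊝ a ⊙ a

    -- The added square and the first coordinate form a hyperbolic plane, contributing `Q`; the
    -- other coordinates carry a norm in even dimension.
    norm-odd : ∀ m → let d = suc (m ℕ.* 2) in
      ∃ λ g → g * g ≡ Q * Q ^ d × GaussSum (cartesianProduct (vectors d) elements) normWithSquare g
    norm-odd m with norm-even m
    ... | g , g²≡ , gauss = g * Q , squared , λ t → begin
      ∑[ p ← cartesianProduct (vectors (suc (m ℕ.* 2))) elements ] ψ (t ⊕ normWithSquare p)
        ≡⟨ trans (∑-cartesian _,_ (vectors (suc (m ℕ.* 2))) elements _) (∑-vectors _) ⟩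
      ∑[ b ] ∑[ x ← vectors (m ℕ.* 2) ] ∑[ a ] ψ (t ⊕ (b ⊙ b ⊕ ‖ x ‖ ⊝ a ⊙ a))
        ≡⟨ trans (∑-cong elements λ b → ∑-swap (vectors (m ℕ.* 2)) elements _) (∑-swap elements elements _) ⟩
      ∑[ a ] ∑[ b ] ∑[ x ← vectors (m ℕ.* 2) ] ψ (t ⊕ (b ⊙ b ⊕ ‖ x ‖ ⊝ a ⊙ a))
        ≡⟨ ∑-cong elements (λ a → ∑-cong elements λ b → trans
             (∑-cong (vectors (m ℕ.* 2)) λ x → cong ψ (solve 4 (λ t u v n → t :+ (u :+ n :+ v) := u :+ v :+ t :+ n)
               refl t (b ⊙ b) (⊖ (a ⊙ a)) ‖ x ‖))
             (gauss (b ⊙ b ⊝ a ⊙ a ⊕ t))) ⟩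
      ∑[ a ] ∑[ b ] g * ψ (b ⊙ b ⊝ a ⊙ a ⊕ t)
        ≡⟨ ∑∑-*ˡ elements elements g _ ⟩
      g * (∑[ a ] ∑[ b ] ψ (b ⊙ b ⊝ a ⊙ a ⊕ t))
        ≡⟨ cong (g *_) (difference-of-squares t) ⟩
      g * (Q * ψ t)
        ≡⟨ sym (*-assoc g Q (ψ t)) ⟩
      g * Q * ψ t ∎
      where
      open ≡-Reasoning
      lemma : ∀ g x → g * x * (g * x) ≡ x * (x * (g * g))
      lemma = solve-∀
      squared : g * Q * (g * Q) ≡ Q * (Q * Q ^ (m ℕ.* 2))
      squared = trans (lemma g Q) (cong (λ y → Q * (Q * y)) g²≡)

    pairs : ∀ d → List (Point d × Point d)
    pairs d = cartesianProduct (vectors d) (vectors d)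

    pairForm : ∀ {d} → Carrier → Point d × Point d → Carrier
    pairForm ρ (x , y) = ‖ y ‖ ⊕ ρ ⊙ ‖ x ‖

    -- Scaling a form by `ρ` permutes the nontrivial characters, which does not affect a Gauss sum
    -- common to all of them. Hence both halves contribute `g`, for every nonzero ratio.
    pairForm-even : ∀ {d g ρ} → ρ ≢ 0# → g * g ≡ Q ^ d → GaussSum (vectors d) ‖_‖ g →
      GaussSum (pairs d) (pairForm ρ) (Q ^ d)
    pairForm-even {d} {g} {ρ} ρ≢0 g²≡ gauss t = begin
      ∑[ p ← pairs d ] ψ (t ⊕ pairForm ρ p)
        ≡⟨ ∑-cartesian _,_ (vectors d) (vectors d) _ ⟩
      ∑[ x ← vectors d ] ∑[ y ← vectors d ] ψ (t ⊕ (‖ y ‖ ⊕ ρ ⊙ ‖ x ‖))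
        ≡⟨ ∑-cong (vectors d) (λ x → trans (∑-cong (vectors d) λ y → cong ψ
             (solve 3 (λ t u v → t :+ (u :+ v) := t :+ v :+ u) refl t ‖ y ‖ (ρ ⊙ ‖ x ‖))) (gauss (t ⊕ ρ ⊙ ‖ x ‖))) ⟩
      ∑[ x ← vectors d ] g * ψ (t ⊕ ρ ⊙ ‖ x ‖)
        ≡⟨ ∑-*ˡ (vectors d) g _ ⟩
      g * (∑[ x ← vectors d ] ψ (t ⊕ ρ ⊙ ‖ x ‖))
        ≡⟨ cong (g *_) (trans (∑-cong (vectors d) λ x → trans (cong ψ (factor x)) (ψ-scale ρ≢0 _)) (gauss (inv ρ≢0 ⊙ t))) ⟩
      g * (g * ψ (inv ρ≢0 ⊙ t))
        ≡⟨ trans (sym (*-assoc g g _)) (cong₂ _*_ g²≡ (trans (sym (ψ-scale ρ≢0 _)) (cong ψ (⊙-inv ρ≢0 t)))) ⟩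
      Q ^ d * ψ t ∎
      where
      open ≡-Reasoning
      factor : ∀ x → t ⊕ ρ ⊙ ‖ x ‖ ≡ ρ ⊙ (inv ρ≢0 ⊙ t ⊕ ‖ x ‖)
      factor x = sym (trans (R.distribˡ ρ _ _) (cong (_⊕ ρ ⊙ ‖ x ‖) (⊙-inv ρ≢0 t)))

    -- In odd dimension the two norms cannot be summed separately. They are paired coordinate by
    -- coordinate into `d` hyperbolic planes, which is where the ratio has to be a square.
    pairForm-square : ∀ {s} → s ≢ 0# → ∀ d → GaussSum (pairs d) (pairForm (⊖ (s ⊙ s))) (Q ^ d)
    pairForm-square {s} s≢0 d t = trans (∑-cartesian _,_ (vectors d) (vectors d) _) (split d t)
      where
      open ≡-Reasoning
      ρ : Carrier
      ρ = ⊖ (s ⊙ s)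
      split : ∀ d t → ∑[ x ← vectors d ] ∑[ y ← vectors d ] ψ (t ⊕ (‖ y ‖ ⊕ ρ ⊙ ‖ x ‖)) ≡ Q ^ d * ψ t
      split zero t = trans (trans (+-identityʳ _) (+-identityʳ _))
        (trans (cong ψ (trans (cong (t ⊕_) (trans (R.+-identityˡ _) (R.zeroʳ ρ))) (R.+-identityʳ t))) (sym (*-identityˡ _)))
      split (suc d) t = begin
        ∑[ x ← vectors (suc d) ] ∑[ y ← vectors (suc d) ] ψ (t ⊕ (‖ y ‖ ⊕ ρ ⊙ ‖ x ‖))
          ≡⟨ trans (∑-vectors (λ x → ∑[ y ← vectors (suc d) ] ψ (t ⊕ (‖ y ‖ ⊕ ρ ⊙ ‖ x ‖))))
               (∑-cong elements λ a → ∑-cong (vectors d) λ x → ∑-vectors λ y → ψ (t ⊕ (‖ y ‖ ⊕ ρ ⊙ (a ⊙ a ⊕ ‖ x ‖)))) ⟩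
        ∑[ a ] ∑[ x ← vectors d ] ∑[ b ] ∑[ y ← vectors d ] ψ (t ⊕ ((b ⊙ b ⊕ ‖ y ‖) ⊕ ρ ⊙ (a ⊙ a ⊕ ‖ x ‖)))
          ≡⟨ ∑-cong elements (λ a → ∑-swap (vectors d) elements _) ⟩
        ∑[ a ] ∑[ b ] ∑[ x ← vectors d ] ∑[ y ← vectors d ] ψ (t ⊕ ((b ⊙ b ⊕ ‖ y ‖) ⊕ ρ ⊙ (a ⊙ a ⊕ ‖ x ‖)))
          ≡⟨ ∑-cong elements (λ a → ∑-cong elements λ b → trans
               (∑-cong (vectors d) λ x → ∑-cong (vectors d) λ y → cong ψ
                 (solve 6 (λ t u v r m n → t :+ ((u :+ n) :+ r :* (v :+ m)) := u :+ r :* v :+ t :+ (n :+ r :* m))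
                   refl t (b ⊙ b) (a ⊙ a) ρ ‖ x ‖ ‖ y ‖))
               (split d (b ⊙ b ⊕ ρ ⊙ (a ⊙ a) ⊕ t))) ⟩
        ∑[ a ] ∑[ b ] Q ^ d * ψ (b ⊙ b ⊕ ρ ⊙ (a ⊙ a) ⊕ t)
          ≡⟨ ∑∑-*ˡ elements elements (Q ^ d) _ ⟩
        Q ^ d * (∑[ a ] ∑[ b ] ψ (b ⊙ b ⊕ ρ ⊙ (a ⊙ a) ⊕ t))
          ≡⟨ cong (Q ^ d *_) (hyperbolic-plane s≢0 t) ⟩
        Q ^ d * (Q * ψ t)
          ≡⟨ trans (sym (*-assoc (Q ^ d) Q (ψ t))) (cong (_* ψ t) (*-comm (Q ^ d) Q)) ⟩
        Q * Q ^ d * ψ t ∎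

    -- The Fourier transform of the cone f = 0. The product ψ(f)ψ(b) is expanded through b, and
    -- Q[b = 0]ψ(f) is the pencil of ψ(lb + f) over all l. Completing the square evaluates each
    -- member of the pencil, with `s` the value of the form at the dual point.
    cone : ∀ {a} {A : Set a} (V : List A) (f b : A → Carrier) (g : ℤ) (s : Carrier) →
      (∀ l → ∑[ x ← V ] ψ (l ⊙ b x ⊕ f x) ≡ g * ψ (l ⊙ l ⊙ s)) →
      Q * (∑[ x ← V ] [ f x ≟ 0# ] * ψ (b x)) ≡ (Q - 1ℤ) * (g * ψ s) + (∑[ x ← V ] ψ (b x))
    cone V f b g s square = begin
      Q * (∑[ x ← V ] [ f x ≟ 0# ] * ψ (b x))
        ≡⟨ sym (∑-*ˡ V Q _) ⟩
      ∑[ x ← V ] Q * ([ f x ≟ 0# ] * ψ (b x))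
        ≡⟨ ∑-cong V (λ x → swap Q [ f x ≟ 0# ] [ b x ≟ 0# ]) ⟩
      ∑[ x ← V ] (Q * [ b x ≟ 0# ] * ψ (f x) + - 1ℤ * ψ (f x) + ψ (b x))
        ≡⟨ trans (∑-+ V _ _) (cong (_+ ∑ V (λ x → ψ (b x))) (∑-+ V _ _)) ⟩
      (∑[ x ← V ] Q * [ b x ≟ 0# ] * ψ (f x)) + (∑[ x ← V ] - 1ℤ * ψ (f x)) + ∑ V (λ x → ψ (b x))
        ≡⟨ cong₂ (λ i j → i + j + ∑ V (λ x → ψ (b x))) pencils (trans (∑-*ˡ V (- 1ℤ) _) (cong (- 1ℤ *_) total)) ⟩
      g * ((Q - 1ℤ) * (1ℤ + ψ s)) + - 1ℤ * (g * (Q - 1ℤ)) + ∑ V (λ x → ψ (b x))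
        ≡⟨ cong (_+ ∑ V (λ x → ψ (b x))) (collect Q g (ψ s)) ⟩
      (Q - 1ℤ) * (g * ψ s) + (∑[ x ← V ] ψ (b x)) ∎
      where
      open ≡-Reasoning
      swap : ∀ k x y → k * (x * (k * y - 1ℤ)) ≡ k * y * (k * x - 1ℤ) + - 1ℤ * (k * x - 1ℤ) + (k * y - 1ℤ)
      swap = solve-∀
      collect : ∀ k g p → g * ((k - 1ℤ) * (1ℤ + p)) + - 1ℤ * (g * (k - 1ℤ)) ≡ (k - 1ℤ) * (g * p)
      collect = solve-∀
      pencils : ∑[ x ← V ] Q * [ b x ≟ 0# ] * ψ (f x) ≡ g * ((Q - 1ℤ) * (1ℤ + ψ s))
      pencils = begin
        ∑[ x ← V ] Q * [ b x ≟ 0# ] * ψ (f x)       ≡⟨ ∑-cong V (λ x → sym (∑ψ-pencil (b x) (f x))) ⟩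
        ∑[ x ← V ] ∑[ l ] ψ (l ⊙ b x ⊕ f x)         ≡⟨ ∑-swap V elements _ ⟩
        ∑[ l ] ∑[ x ← V ] ψ (l ⊙ b x ⊕ f x)         ≡⟨ ∑-cong elements square ⟩
        ∑[ l ] g * ψ (l ⊙ l ⊙ s)                    ≡⟨ ∑-*ˡ elements g _ ⟩
        g * (∑[ l ] ψ (l ⊙ l ⊙ s))                  ≡⟨ cong (g *_) (∑ψ-square-pencil s) ⟩
        g * ((Q - 1ℤ) * (1ℤ + ψ s))                 ∎
      total : ∑[ x ← V ] ψ (f x) ≡ g * (Q - 1ℤ)
      total = begin
        ∑[ x ← V ] ψ (f x)                  ≡⟨ ∑-cong V (λ x → cong ψ (sym (trans (cong (_⊕ f x) (R.zeroˡ (b x))) (R.+-identityˡ _)))) ⟩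
        ∑[ x ← V ] ψ (0# ⊙ b x ⊕ f x)       ≡⟨ square 0# ⟩
        g * ψ (0# ⊙ 0# ⊙ s)                 ≡⟨ cong (g *_) (trans (cong ψ (trans (cong (_⊙ s) (R.zeroˡ 0#)) (R.zeroˡ s))) ψ-0) ⟩
        g * (Q - 1ℤ)                        ∎

  -- Fourier transforms of the cones of the norm and of the pair form.

  module Counting {c q} (F : FiniteField c q) (odd : ¬ (2 ∣ q)) where
    open QuadraticForms F odd public

    infix 4 _≟ᵛ_
    _≟ᵛ_ : ∀ {d} → DecidableEquality (Point d)
    _≟ᵛ_ = ≡-dec _≟_

    0ᵛ : ∀ {d} → Point d
    0ᵛ {d} = replicate d 0#

    -ᵛ-zero⇒≡ : ∀ {d} (x y : Point d) → x -ᵛ y ≡ 0ᵛ → x ≡ y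
    -ᵛ-zero⇒≡ []      []      _ = refl
    -ᵛ-zero⇒≡ (a ∷ x) (b ∷ y) e with ∷-injective e
    ... | a-b≡0 , x-y≡0 = cong₂ _∷_ (⊝-zero⇒≡ a-b≡0) (-ᵛ-zero⇒≡ x y x-y≡0)

    -ᵛ-self : ∀ {d} (x : Point d) → x -ᵛ x ≡ 0ᵛ
    -ᵛ-self []      = refl
    -ᵛ-self (a ∷ x) = cong₂ _∷_ (R.-‿inverseʳ a) (-ᵛ-self x)

    ·-difference : ∀ {d} (ξ x y : Point d) → ξ · (x -ᵛ y) ≡ ξ · x ⊝ ξ · y
    ·-difference []      []      []      = sym (R.-‿inverseʳ 0#)
    ·-difference (k ∷ ξ) (a ∷ x) (b ∷ y) = begin
      k ⊙ (a ⊝ b) ⊕ ξ · (x -ᵛ y)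
        ≡⟨ cong₂ _⊕_ (trans (R.distribˡ k a (⊖ b)) (cong (k ⊙ a ⊕_) (sym (R.-‿distribʳ-* k b)))) (·-difference ξ x y) ⟩
      (k ⊙ a ⊕ ⊖ (k ⊙ b)) ⊕ (ξ · x ⊕ ⊖ (ξ · y))
        ≡⟨ solve 4 (λ s t u v → (s :+ t) :+ (u :+ v) := (s :+ u) :+ (t :+ v)) refl
             (k ⊙ a) (⊖ (k ⊙ b)) (ξ · x) (⊖ (ξ · y)) ⟩
      (k ⊙ a ⊕ ξ · x) ⊕ (⊖ (k ⊙ b) ⊕ ⊖ (ξ · y))
        ≡⟨ cong (k ⊙ a ⊕ ξ · x ⊕_) (R.-‿+-comm _ _) ⟩
      (k ⊙ a ⊕ ξ · x) ⊝ (k ⊙ b ⊕ ξ · y) ∎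
      where open ≡-Reasoning

    -- The offset `t` carries the coordinates not yet summed, and later the contribution of a second
    -- vector variable.
    ∑ψ-linear : ∀ {d} (z : Point d) t → ∑[ ξ ← vectors d ] ψ (t ⊕ ξ · z) ≡ [ z ≟ᵛ 0ᵛ ] * (Q ^ d * ψ t)
    ∑ψ-linear [] t = trans (+-identityʳ _) (trans (cong ψ (R.+-identityʳ t))
      (sym (trans (*-identityˡ _) (*-identityˡ _))))
    ∑ψ-linear {suc d} (b ∷ z) t = begin
      ∑[ ξ ← vectors (suc d) ] ψ (t ⊕ ξ · (b ∷ z))
        ≡⟨ trans (∑-vectors λ ξ → ψ (t ⊕ ξ · (b ∷ z))) (∑-swap elements (vectors d) _) ⟩
      ∑[ ξ ← vectors d ] ∑[ a ] ψ (t ⊕ (a ⊙ b ⊕ ξ · z))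
        ≡⟨ ∑-cong (vectors d) (λ ξ → trans
             (∑-cong elements λ a → cong ψ (solve 3 (λ t u v → t :+ (u :+ v) := u :+ (t :+ v)) refl t (a ⊙ b) (ξ · z)))
             (∑ψ-pencil b (t ⊕ ξ · z))) ⟩
      ∑[ ξ ← vectors d ] Q * [ b ≟ 0# ] * ψ (t ⊕ ξ · z)
        ≡⟨ ∑-*ˡ (vectors d) (Q * [ b ≟ 0# ]) _ ⟩
      Q * [ b ≟ 0# ] * (∑[ ξ ← vectors d ] ψ (t ⊕ ξ · z))
        ≡⟨ cong (Q * [ b ≟ 0# ] *_) (∑ψ-linear z t) ⟩
      Q * [ b ≟ 0# ] * ([ z ≟ᵛ 0ᵛ ] * (Q ^ d * ψ t))
        ≡⟨ lemma Q [ b ≟ 0# ] [ z ≟ᵛ 0ᵛ ] (Q ^ d) (ψ t) ⟩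
      [ b ≟ 0# ] * [ z ≟ᵛ 0ᵛ ] * (Q * Q ^ d * ψ t)
        ≡⟨ cong (_* (Q * Q ^ d * ψ t)) both ⟩
      [ b ∷ z ≟ᵛ 0ᵛ ] * (Q * Q ^ d * ψ t) ∎
      where
      open ≡-Reasoning
      lemma : ∀ k i j m p → k * i * (j * (m * p)) ≡ i * j * (k * m * p)
      lemma = solve-∀
      both : [ b ≟ 0# ] * [ z ≟ᵛ 0ᵛ ] ≡ [ b ∷ z ≟ᵛ 0ᵛ ]
      both = []-× (b ≟ 0#) (z ≟ᵛ 0ᵛ) (b ∷ z ≟ᵛ 0ᵛ) (λ b≡0 z≡0 → cong₂ _∷_ b≡0 z≡0) ∷-injective

    ∑ψ-dot : ∀ {d} (z : Point d) → ∑[ ξ ← vectors d ] ψ (ξ · z) ≡ (Q - 1ℤ) * (Q ^ d * [ z ≟ᵛ 0ᵛ ])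
    ∑ψ-dot {d} z = trans (∑-cong (vectors d) λ ξ → cong ψ (sym (R.+-identityˡ _)))
      (trans (∑ψ-linear z 0#) (trans (cong (λ p → [ z ≟ᵛ 0ᵛ ] * (Q ^ d * p)) ψ-0) (lemma Q (Q ^ d) [ z ≟ᵛ 0ᵛ ])))
      where
      lemma : ∀ k m i → i * (m * (k - 1ℤ)) ≡ (k - 1ℤ) * (m * i)
      lemma = solve-∀

    ∑∑ψ-differences-nonneg : ∀ {a} {A : Set a} (xs : List A) (u : A → Carrier) →
      0ℤ ≤ ∑[ x ← xs ] ∑[ y ← xs ] ψ (u x ⊝ u y)
    ∑∑ψ-differences-nonneg xs u = nonneg-cancel Q (positive⁻¹ Q) (subst (0ℤ ≤_)
      (trans (sym (∑ψ-differences xs xs u u)) (cong (Q *_) (∑-swap xs xs _)))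
      (∑-nonneg elements λ t → square-nonneg (∑[ x ← xs ] ψ (t ⊕ u x))))

    0<Q-1 : 0ℤ < Q - 1ℤ
    0<Q-1 = <-≤-trans (+<+ (s≤s z≤n)) (+-monoˡ-≤ (- 1ℤ) (+≤+ 3≤q))

    coneKernel : ∀ {d} → Point d → ℤ
    coneKernel {d} z = ∑[ ξ ← vectors d ] [ ‖ ξ ‖ ≟ 0# ] * ψ (ξ · z)

    coneKernel-Gauss : ∀ {d g} → GaussSum (vectors d) ‖_‖ g → ∀ z →
      Q * coneKernel z ≡ (Q - 1ℤ) * (g * ψ ‖ z ‖ + Q ^ d * [ z ≟ᵛ 0ᵛ ])
    coneKernel-Gauss {d} {g} gauss z = begin
      Q * coneKernel z
        -- The factor 2 is free inside `ψ` and turns the dot product into the polar form of the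
        -- norm, so that completing the square returns ‖z‖ itself.
        ≡⟨ cong (Q *_) (∑-cong (vectors d) λ ξ → cong ([ ‖ ξ ‖ ≟ 0# ] *_) (sym (ψ-scale two≢0 (ξ · z)))) ⟩
      Q * (∑[ ξ ← vectors d ] [ ‖ ξ ‖ ≟ 0# ] * ψ (two ⊙ (ξ · z)))
        ≡⟨ cone (vectors d) ‖_‖ (λ ξ → two ⊙ (ξ · z)) g ‖ z ‖ square ⟩
      (Q - 1ℤ) * (g * ψ ‖ z ‖) + (∑[ ξ ← vectors d ] ψ (two ⊙ (ξ · z)))
        ≡⟨ cong (_+_ ((Q - 1ℤ) * (g * ψ ‖ z ‖))) (trans (∑-cong (vectors d) λ ξ → ψ-scale two≢0 (ξ · z)) (∑ψ-dot z)) ⟩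
      (Q - 1ℤ) * (g * ψ ‖ z ‖) + (Q - 1ℤ) * (Q ^ d * [ z ≟ᵛ 0ᵛ ])
        ≡⟨ sym (*-distribˡ-+ (Q - 1ℤ) _ _) ⟩
      (Q - 1ℤ) * (g * ψ ‖ z ‖ + Q ^ d * [ z ≟ᵛ 0ᵛ ]) ∎
      where
      open ≡-Reasoning
      square : ∀ l → ∑[ ξ ← vectors d ] ψ (l ⊙ (two ⊙ (ξ · z)) ⊕ ‖ ξ ‖) ≡ g * ψ (l ⊙ l ⊙ ‖ z ‖)
      square l = trans (complete-square l z ψ) (trans (∑-cong (vectors d) λ ξ → cong ψ (R.+-comm ‖ ξ ‖ _))
        (trans (gauss _) (cong (g *_) (ψ-⊖ _))))

    -- The cone of ‖ξ‖ - a² is transformed at the point (z, 0). Nothing there depends on `a`, so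
    -- summing it out leaves the number of square roots of ‖ξ‖ as a weight.
    coneWithSquare-Gauss : ∀ {d g} → GaussSum (cartesianProduct (vectors d) elements) normWithSquare g → ∀ (z : Point d) →
      Q * (∑[ ξ ← vectors d ] (∑[ a ] [ a ⊙ a ≟ ‖ ξ ‖ ]) * ψ (ξ · z)) ≡
      (Q - 1ℤ) * (g * ψ ‖ z ‖ + Q * (Q ^ d * [ z ≟ᵛ 0ᵛ ]))
    coneWithSquare-Gauss {d} {g} gauss z = begin
      Q * (∑[ ξ ← vectors d ] (∑[ a ] [ a ⊙ a ≟ ‖ ξ ‖ ]) * ψ (ξ · z))
        ≡⟨ cong (Q *_) (∑-cong (vectors d) λ ξ → trans (sym (∑-*ʳ elements _ (ψ (ξ · z)))) (∑-cong elements λ a →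
             cong₂ _*_ ([]-⇔ (a ⊙ a ≟ ‖ ξ ‖) (normWithSquare (ξ , a) ≟ 0#)
               (λ e → trans (cong (‖ ξ ‖ ⊝_) e) (R.-‿inverseʳ _)) (λ e → sym (⊝-zero⇒≡ e)))
               (sym (ψ-scale two≢0 (ξ · z))))) ⟩
      Q * (∑[ ξ ← vectors d ] ∑[ a ] [ normWithSquare (ξ , a) ≟ 0# ] * ψ (two ⊙ (ξ · z)))
        ≡⟨ cong (Q *_) (sym (∑-cartesian _,_ (vectors d) elements _)) ⟩
      Q * (∑[ p ← V ] [ normWithSquare p ≟ 0# ] * ψ (two ⊙ (proj₁ p · z)))
        ≡⟨ cone V normWithSquare (λ p → two ⊙ (proj₁ p · z)) g ‖ z ‖ square ⟩
      (Q - 1ℤ) * (g * ψ ‖ z ‖) + (∑[ p ← V ] ψ (two ⊙ (proj₁ p · z)))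
        ≡⟨ cong (_+_ ((Q - 1ℤ) * (g * ψ ‖ z ‖))) (begin
             ∑[ p ← V ] ψ (two ⊙ (proj₁ p · z))
               ≡⟨ ∑-cartesian _,_ (vectors d) elements _ ⟩
             ∑[ ξ ← vectors d ] ∑[ a ] ψ (two ⊙ (ξ · z))
               ≡⟨ ∑-cong (vectors d) (λ ξ → trans (∑F-const _) (cong (Q *_) (ψ-scale two≢0 (ξ · z)))) ⟩
             ∑[ ξ ← vectors d ] Q * ψ (ξ · z)
               ≡⟨ trans (∑-*ˡ (vectors d) Q _) (cong (Q *_) (∑ψ-dot z)) ⟩
             Q * ((Q - 1ℤ) * (Q ^ d * [ z ≟ᵛ 0ᵛ ])) ∎) ⟩
      (Q - 1ℤ) * (g * ψ ‖ z ‖) + Q * ((Q - 1ℤ) * (Q ^ d * [ z ≟ᵛ 0ᵛ ]))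
        ≡⟨ lemma Q (Q - 1ℤ) (g * ψ ‖ z ‖) (Q ^ d * [ z ≟ᵛ 0ᵛ ]) ⟩
      (Q - 1ℤ) * (g * ψ ‖ z ‖ + Q * (Q ^ d * [ z ≟ᵛ 0ᵛ ])) ∎
      where
      open ≡-Reasoning
      V : List (Point d × Carrier)
      V = cartesianProduct (vectors d) elements
      lemma : ∀ k j x y → j * x + k * (j * y) ≡ j * (x + k * y)
      lemma = solve-∀
      square : ∀ l → ∑[ p ← V ] ψ (l ⊙ (two ⊙ (proj₁ p · z)) ⊕ normWithSquare p) ≡ g * ψ (l ⊙ l ⊙ ‖ z ‖)
      square l = begin
        ∑[ p ← V ] ψ (l ⊙ (two ⊙ (proj₁ p · z)) ⊕ normWithSquare p)
          ≡⟨ trans (∑-cartesian _,_ (vectors d) elements _) (∑-swap (vectors d) elements _) ⟩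
        ∑[ a ] ∑[ ξ ← vectors d ] ψ (l ⊙ (two ⊙ (ξ · z)) ⊕ (‖ ξ ‖ ⊝ a ⊙ a))
          ≡⟨ ∑-cong elements (λ a → trans (∑-cong (vectors d) λ ξ → cong ψ (sym (R.+-assoc _ ‖ ξ ‖ (⊖ (a ⊙ a)))))
               (complete-square l z λ s → ψ (s ⊝ a ⊙ a))) ⟩
        ∑[ a ] ∑[ ξ ← vectors d ] ψ (‖ ξ ‖ ⊝ l ⊙ l ⊙ ‖ z ‖ ⊝ a ⊙ a)
          ≡⟨ ∑-cong elements (λ a → ∑-cong (vectors d) λ ξ → cong ψ (solve 3 (λ n s t → n :+ s :+ t := s :+ (n :+ t))
               refl ‖ ξ ‖ (⊖ (l ⊙ l ⊙ ‖ z ‖)) (⊖ (a ⊙ a)))) ⟩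
        ∑[ a ] ∑[ ξ ← vectors d ] ψ (⊖ (l ⊙ l ⊙ ‖ z ‖) ⊕ (‖ ξ ‖ ⊝ a ⊙ a))
          ≡⟨ trans (∑-swap elements (vectors d) _) (sym (∑-cartesian _,_ (vectors d) elements _)) ⟩
        ∑[ p ← V ] ψ (⊖ (l ⊙ l ⊙ ‖ z ‖) ⊕ normWithSquare p)
          ≡⟨ trans (gauss _) (cong (g *_) (ψ-⊖ _)) ⟩
        g * ψ (l ⊙ l ⊙ ‖ z ‖) ∎

    -- Half the polar form of `pairForm ρ`. Building `ρ` into the frequencies makes completing the
    -- square return `pairForm ρ` again, rather than the dual form with the inverse of `ρ`.
    pairing : ∀ {d} → Carrier → Point d × Point d → Point d × Point d → Carrier
    pairing ρ (x , y) (z , w) = y · w ⊕ ρ ⊙ (x · z)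

    pairKernel : ∀ {d} → Carrier → Point d × Point d → ℤ
    pairKernel {d} ρ p = ∑[ ξ ← pairs d ] [ pairForm ρ ξ ≟ 0# ] * ψ (pairing ρ ξ p)

    pairKernel-Gauss : ∀ {d ρ} → ρ ≢ 0# → GaussSum (pairs d) (pairForm ρ) (Q ^ d) → ∀ z w →
      Q * pairKernel ρ (z , w) ≡
      (Q - 1ℤ) * (Q ^ d * ψ (pairForm ρ (z , w)) + (Q ^ d * [ z ≟ᵛ 0ᵛ ]) * (Q ^ d * [ w ≟ᵛ 0ᵛ ]))
    pairKernel-Gauss {d} {ρ} ρ≢0 gauss z w = begin
      Q * pairKernel ρ (z , w)
        ≡⟨ cong (Q *_) (∑-cong (pairs d) λ ξ → cong ([ pairForm ρ ξ ≟ 0# ] *_) (sym (ψ-scale two≢0 (pairing ρ ξ (z , w))))) ⟩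
      Q * (∑[ ξ ← pairs d ] [ pairForm ρ ξ ≟ 0# ] * ψ (two ⊙ pairing ρ ξ (z , w)))
        ≡⟨ cone (pairs d) (pairForm ρ) (λ ξ → two ⊙ pairing ρ ξ (z , w)) (Q ^ d) (pairForm ρ (z , w)) square ⟩
      (Q - 1ℤ) * (Q ^ d * ψ (pairForm ρ (z , w))) + (∑[ ξ ← pairs d ] ψ (two ⊙ pairing ρ ξ (z , w)))
        ≡⟨ cong (_+_ ((Q - 1ℤ) * (Q ^ d * ψ (pairForm ρ (z , w))))) (begin
             ∑[ ξ ← pairs d ] ψ (two ⊙ pairing ρ ξ (z , w))
               ≡⟨ trans (∑-cong (pairs d) λ ξ → ψ-scale two≢0 (pairing ρ ξ (z , w))) (∑-cartesian _,_ (vectors d) (vectors d) _) ⟩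
             ∑[ x ← vectors d ] ∑[ y ← vectors d ] ψ (y · w ⊕ ρ ⊙ (x · z))
               ≡⟨ ∑-cong (vectors d) (λ x → trans (∑-cong (vectors d) λ y → cong ψ (R.+-comm (y · w) _))
                    (trans (∑ψ-linear w (ρ ⊙ (x · z))) (cong (λ p → [ w ≟ᵛ 0ᵛ ] * (Q ^ d * p)) (ψ-scale ρ≢0 (x · z))))) ⟩
             ∑[ x ← vectors d ] [ w ≟ᵛ 0ᵛ ] * (Q ^ d * ψ (x · z))
               ≡⟨ trans (∑-*ˡ (vectors d) [ w ≟ᵛ 0ᵛ ] _) (cong ([ w ≟ᵛ 0ᵛ ] *_) (∑-*ˡ (vectors d) (Q ^ d) _)) ⟩
             [ w ≟ᵛ 0ᵛ ] * (Q ^ d * (∑[ x ← vectors d ] ψ (x · z)))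
               ≡⟨ cong (λ s → [ w ≟ᵛ 0ᵛ ] * (Q ^ d * s)) (∑ψ-dot z) ⟩
             [ w ≟ᵛ 0ᵛ ] * (Q ^ d * ((Q - 1ℤ) * (Q ^ d * [ z ≟ᵛ 0ᵛ ])))
               ≡⟨ lemma (Q - 1ℤ) (Q ^ d) [ z ≟ᵛ 0ᵛ ] [ w ≟ᵛ 0ᵛ ] ⟩
             (Q - 1ℤ) * ((Q ^ d * [ z ≟ᵛ 0ᵛ ]) * (Q ^ d * [ w ≟ᵛ 0ᵛ ])) ∎) ⟩
      (Q - 1ℤ) * (Q ^ d * ψ (pairForm ρ (z , w))) + (Q - 1ℤ) * ((Q ^ d * [ z ≟ᵛ 0ᵛ ]) * (Q ^ d * [ w ≟ᵛ 0ᵛ ]))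
        ≡⟨ sym (*-distribˡ-+ (Q - 1ℤ) _ _) ⟩
      (Q - 1ℤ) * (Q ^ d * ψ (pairForm ρ (z , w)) + (Q ^ d * [ z ≟ᵛ 0ᵛ ]) * (Q ^ d * [ w ≟ᵛ 0ᵛ ])) ∎
      where
      open ≡-Reasoning
      lemma : ∀ k D i j → j * (D * (k * (D * i))) ≡ k * ((D * i) * (D * j))
      lemma = solve-∀
      square : ∀ l → ∑[ ξ ← pairs d ] ψ (l ⊙ (two ⊙ pairing ρ ξ (z , w)) ⊕ pairForm ρ ξ) ≡
        Q ^ d * ψ (l ⊙ l ⊙ pairForm ρ (z , w))
      square l = begin
        ∑[ ξ ← pairs d ] ψ (l ⊙ (two ⊙ pairing ρ ξ (z , w)) ⊕ pairForm ρ ξ)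
          ≡⟨ ∑-cartesian _,_ (vectors d) (vectors d) _ ⟩
        ∑[ x ← vectors d ] ∑[ y ← vectors d ] ψ (l ⊙ (two ⊙ (y · w ⊕ ρ ⊙ (x · z))) ⊕ (‖ y ‖ ⊕ ρ ⊙ ‖ x ‖))
          ≡⟨ ∑-cong (vectors d) (λ x → trans
               (∑-cong (vectors d) λ y → cong ψ (solve 7 (λ l t r p s m n →
                  l :* (t :* (p :+ r :* s)) :+ (n :+ r :* m) := (l :* (t :* p) :+ n) :+ r :* (l :* (t :* s) :+ m))
                  refl l two ρ (y · w) (x · z) ‖ x ‖ ‖ y ‖))
               -- The square in `y` is completed with `x` fixed inside the function; the next step
               -- completes the one in `x` around the whole sum over `y`.
               (complete-square l w λ s → ψ (s ⊕ ρ ⊙ (l ⊙ (two ⊙ (x · z)) ⊕ ‖ x ‖)))) ⟩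
        ∑[ x ← vectors d ] ∑[ y ← vectors d ] ψ (‖ y ‖ ⊝ l ⊙ l ⊙ ‖ w ‖ ⊕ ρ ⊙ (l ⊙ (two ⊙ (x · z)) ⊕ ‖ x ‖))
          ≡⟨ complete-square l z (λ s → ∑[ y ← vectors d ] ψ (‖ y ‖ ⊝ l ⊙ l ⊙ ‖ w ‖ ⊕ ρ ⊙ s)) ⟩
        ∑[ x ← vectors d ] ∑[ y ← vectors d ] ψ (‖ y ‖ ⊝ l ⊙ l ⊙ ‖ w ‖ ⊕ ρ ⊙ (‖ x ‖ ⊝ l ⊙ l ⊙ ‖ z ‖))
          ≡⟨ ∑-cong (vectors d) (λ x → ∑-cong (vectors d) λ y → cong ψ (regroup ‖ x ‖ ‖ y ‖)) ⟩
        ∑[ x ← vectors d ] ∑[ y ← vectors d ] ψ (⊖ (l ⊙ l ⊙ pairForm ρ (z , w)) ⊕ (‖ y ‖ ⊕ ρ ⊙ ‖ x ‖))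
          ≡⟨ sym (∑-cartesian _,_ (vectors d) (vectors d) _) ⟩
        ∑[ ξ ← pairs d ] ψ (⊖ (l ⊙ l ⊙ pairForm ρ (z , w)) ⊕ pairForm ρ ξ)
          ≡⟨ trans (gauss _) (cong (Q ^ d *_) (ψ-⊖ _)) ⟩
        Q ^ d * ψ (l ⊙ l ⊙ pairForm ρ (z , w)) ∎
        where
        regroup : ∀ m n → n ⊝ l ⊙ l ⊙ ‖ w ‖ ⊕ ρ ⊙ (m ⊝ l ⊙ l ⊙ ‖ z ‖) ≡ ⊖ (l ⊙ l ⊙ (‖ w ‖ ⊕ ρ ⊙ ‖ z ‖)) ⊕ (n ⊕ ρ ⊙ m)
        regroup m n = begin
          n ⊝ l ⊙ l ⊙ ‖ w ‖ ⊕ ρ ⊙ (m ⊝ l ⊙ l ⊙ ‖ z ‖)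
            ≡⟨ cong₂ (λ s t → n ⊕ s ⊕ ρ ⊙ (m ⊕ t)) (R.-‿distribˡ-* _ _) (R.-‿distribˡ-* _ _) ⟩
          n ⊕ ⊖ (l ⊙ l) ⊙ ‖ w ‖ ⊕ ρ ⊙ (m ⊕ ⊖ (l ⊙ l) ⊙ ‖ z ‖)
            ≡⟨ solve 6 (λ r k m n z w → n :+ k :* w :+ r :* (m :+ k :* z) := k :* (w :+ r :* z) :+ (n :+ r :* m))
                 refl ρ (⊖ (l ⊙ l)) m n ‖ z ‖ ‖ w ‖ ⟩
          ⊖ (l ⊙ l) ⊙ (‖ w ‖ ⊕ ρ ⊙ ‖ z ‖) ⊕ (n ⊕ ρ ⊙ m)
            ≡⟨ cong (_⊕ (n ⊕ ρ ⊙ m)) (sym (R.-‿distribˡ-* _ _)) ⟩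
          ⊖ (l ⊙ l ⊙ (‖ w ‖ ⊕ ρ ⊙ ‖ z ‖)) ⊕ (n ⊕ ρ ⊙ m) ∎

    isotropicPairKernel : ∀ {d} → Carrier → Point d × Point d → ℤ
    isotropicPairKernel {d} ρ (z , w) = ∑[ x ← vectors d ] ∑[ y ← vectors d ]
      [ ‖ x ‖ ≟ 0# ] * [ ‖ y ‖ ≟ 0# ] * ψ (y · w ⊕ ρ ⊙ (x · z))

    -- The cone is invariant under dilation, so the two characters decouple on average over ρ.
    isotropicPairKernel-splits : ∀ {d ρ} → ρ ≢ 0# → ∀ (z w : Point d) →
      (Q - 1ℤ) * isotropicPairKernel ρ (z , w) ≡ coneKernel z * coneKernel w
    isotropicPairKernel-splits {d} {ρ} ρ≢0 z w = begin
      (Q - 1ℤ) * I ρ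
        ≡⟨ lemma₁ Q (I ρ) (I 0#) ⟩
      (I 0# - I ρ + Q * I ρ) - I 0#
        ≡⟨ cong (_- I 0#) (sym (trans (∑-cong elements dilate) (trans (∑-+ elements _ _)
             (cong₂ _+_ (pick (λ _ → I 0# - I ρ) 0#) (∑F-const (I ρ)))))) ⟩
      (∑[ l ] I l) - I 0#
        ≡⟨ cong (_- I 0#) pencils ⟩
      (∑[ x ← vectors d ] ∑[ y ← vectors d ] (k x * ψ (x · z) * (k y * ψ (y · w)) + k x * k y * ψ (y · w ⊕ 0# ⊙ (x · z)))) - I 0#
        ≡⟨ cong (_- I 0#) (trans (∑∑-+ (vectors d) (vectors d) _ _)
             (cong (_+ I 0#) (sym (∑-*-∑ (vectors d) (vectors d) _ _)))) ⟩
      coneKernel z * coneKernel w + I 0# - I 0#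
        ≡⟨ lemma₂ _ _ ⟩
      coneKernel z * coneKernel w ∎
      where
      open ≡-Reasoning
      k : Point d → ℤ
      k x = [ ‖ x ‖ ≟ 0# ]
      I : Carrier → ℤ
      I l = isotropicPairKernel l (z , w)
      lemma₁ : ∀ q i j → (q - 1ℤ) * i ≡ (j - i + q * i) - j
      lemma₁ = solve-∀
      lemma₂ : ∀ i j → i + j - j ≡ i
      lemma₂ = solve-∀
      dilate-1 : ∀ {l} → l ≢ 0# → I l ≡ I 1#
      dilate-1 {l} l≢0 = trans
        (∑-cong (vectors d) λ x → ∑-cong (vectors d) λ y → cong₂ (λ i s → i * k y * ψ (y · w ⊕ s))
          ([]-⇔ (‖ x ‖ ≟ 0#) (‖ l • x ‖ ≟ 0#) (to x) (from x))
          (sym (trans (R.*-identityˡ _) (•-· l x z))))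
        (∑-scaleᵛ l≢0 λ x → ∑[ y ← vectors d ] k x * k y * ψ (y · w ⊕ 1# ⊙ (x · z)))
        where
        to : ∀ x → ‖ x ‖ ≡ 0# → ‖ l • x ‖ ≡ 0#
        to x e = trans (‖•‖ l x) (trans (cong (l ⊙ l ⊙_) e) (R.zeroʳ _))
        from : ∀ x → ‖ l • x ‖ ≡ 0# → ‖ x ‖ ≡ 0#
        from x e = ⊙-zero l≢0 (⊙-zero l≢0 (trans (sym (R.*-assoc l l ‖ x ‖)) (trans (sym (‖•‖ l x)) e)))
      dilate : ∀ l → I l ≡ [ l ≟ 0# ] * (I 0# - I ρ) + I ρ
      dilate l with l ≟ 0#
      ... | yes refl = lemma (I 0#) (I ρ)
        where
        lemma : ∀ i j → i ≡ 1ℤ * (i - j) + j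
        lemma = solve-∀
      ... | no l≢0 = trans (trans (dilate-1 l≢0) (sym (dilate-1 ρ≢0))) (lemma (I 0#) (I ρ))
        where
        lemma : ∀ i j → j ≡ 0ℤ * (i - j) + j
        lemma = solve-∀
      pencil : ∀ x y → ∑[ l ] k x * k y * ψ (y · w ⊕ l ⊙ (x · z)) ≡
        k x * ψ (x · z) * (k y * ψ (y · w)) + k x * k y * ψ (y · w ⊕ 0# ⊙ (x · z))
      pencil x y = begin
        ∑[ l ] k x * k y * ψ (y · w ⊕ l ⊙ (x · z))
          ≡⟨ trans (∑-*ˡ elements (k x * k y) _) (cong (k x * k y *_) (trans (∑-cong elements λ l → cong ψ (R.+-comm (y · w) _))
               (∑ψ-pencil (x · z) (y · w)))) ⟩
        k x * k y * (Q * [ x · z ≟ 0# ] * ψ (y · w))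
          ≡⟨ lemma Q (k x) (k y) [ x · z ≟ 0# ] (ψ (y · w)) ⟩
        k x * ψ (x · z) * (k y * ψ (y · w)) + k x * k y * ψ (y · w)
          ≡⟨ cong (λ s → k x * ψ (x · z) * (k y * ψ (y · w)) + k x * k y * ψ s)
               (sym (trans (cong (y · w ⊕_) (R.zeroˡ _)) (R.+-identityʳ _))) ⟩
        k x * ψ (x · z) * (k y * ψ (y · w)) + k x * k y * ψ (y · w ⊕ 0# ⊙ (x · z)) ∎
        where
        lemma : ∀ q i j b p → i * j * (q * b * p) ≡ i * (q * b - 1ℤ) * (j * p) + i * j * p
        lemma = solve-∀
      pencils : ∑[ l ] I l ≡ ∑[ x ← vectors d ] ∑[ y ← vectors d ]
        (k x * ψ (x · z) * (k y * ψ (y · w)) + k x * k y * ψ (y · w ⊕ 0# ⊙ (x · z)))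
      pencils = begin
        ∑[ l ] ∑[ x ← vectors d ] ∑[ y ← vectors d ] k x * k y * ψ (y · w ⊕ l ⊙ (x · z))
          ≡⟨ ∑-swap elements (vectors d) _ ⟩
        ∑[ x ← vectors d ] ∑[ l ] ∑[ y ← vectors d ] k x * k y * ψ (y · w ⊕ l ⊙ (x · z))
          ≡⟨ ∑-cong (vectors d) (λ x → trans (∑-swap elements (vectors d) _) (∑-cong (vectors d) (pencil x))) ⟩
        ∑[ x ← vectors d ] ∑[ y ← vectors d ]
          (k x * ψ (x · z) * (k y * ψ (y · w)) + k x * k y * ψ (y · w ⊕ 0# ⊙ (x · z))) ∎

  -- Energies of a point set and the number of its isotropic pairs.

  module Bound {c q} (F : FiniteField c q) (odd : ¬ (2 ∣ q)) {d} (E : List (FiniteField.Point F d)) (unique : Unique E) where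
    open Counting F odd public

    n : ℤ
    n = + length E

    A : List (Point d × Point d)
    A = cartesianProduct E E

    ∑ᴱ : (Point d → ℤ) → ℤ
    ∑ᴱ h = ∑[ x ← E ] ∑[ x′ ← E ] h (x -ᵛ x′)

    ∑ᴬ : (Point d → Point d → ℤ) → ℤ
    ∑ᴬ h = ∑[ a ← A ] ∑[ a′ ← A ] h (proj₁ a -ᵛ proj₁ a′) (proj₂ a -ᵛ proj₂ a′)

    ∑ᴱ-cong : ∀ {f g} → (∀ z → f z ≡ g z) → ∑ᴱ f ≡ ∑ᴱ g
    ∑ᴱ-cong f≗g = ∑-cong E λ x → ∑-cong E λ x′ → f≗g (x -ᵛ x′)

    ∑ᴬ-cong : ∀ {f g} → (∀ z w → f z w ≡ g z w) → ∑ᴬ f ≡ ∑ᴬ g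
    ∑ᴬ-cong f≗g = ∑-cong A λ a → ∑-cong A λ a′ → f≗g (proj₁ a -ᵛ proj₁ a′) (proj₂ a -ᵛ proj₂ a′)

    ∑ᴱ-linear : ∀ k l f g → ∑ᴱ (λ z → k * f z + l * g z) ≡ k * ∑ᴱ f + l * ∑ᴱ g
    ∑ᴱ-linear k l f g = trans (∑∑-+ E E _ _) (cong₂ _+_ (∑∑-*ˡ E E k _) (∑∑-*ˡ E E l _))

    ∑ᴬ-linear : ∀ k l f g → ∑ᴬ (λ z w → k * f z w + l * g z w) ≡ k * ∑ᴬ f + l * ∑ᴬ g
    ∑ᴬ-linear k l f g = trans (∑∑-+ A A _ _) (cong₂ _+_ (∑∑-*ˡ A A k _) (∑∑-*ˡ A A l _))

    ∑ᴬ-product : ∀ f g → ∑ᴬ (λ z w → f z * g w) ≡ ∑ᴱ f * ∑ᴱ g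
    ∑ᴬ-product f g = begin
      ∑[ a ← A ] ∑[ a′ ← A ] f (proj₁ a -ᵛ proj₁ a′) * g (proj₂ a -ᵛ proj₂ a′)
        ≡⟨ ∑-cong A (λ a → trans (∑-cartesian _,_ E E _) (sym (∑-*-∑ E E _ _))) ⟩
      ∑[ a ← A ] (∑[ x′ ← E ] f (proj₁ a -ᵛ x′)) * (∑[ y′ ← E ] g (proj₂ a -ᵛ y′))
        ≡⟨ trans (∑-cartesian _,_ E E _) (sym (∑-*-∑ E E _ _)) ⟩
      ∑ᴱ f * ∑ᴱ g ∎
      where open ≡-Reasoning

    ∑ᴱ-1 : ∑ᴱ (λ _ → 1ℤ) ≡ n * n
    ∑ᴱ-1 = trans (∑∑-const E E 1ℤ) (cong (n *_) (*-identityʳ n))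

    ∑ᴬ-1 : ∑ᴬ (λ _ _ → 1ℤ) ≡ n * n * (n * n)
    ∑ᴬ-1 = trans (∑ᴬ-product (λ _ → 1ℤ) (λ _ → 1ℤ)) (cong₂ _*_ ∑ᴱ-1 ∑ᴱ-1)

    ∑ᴱ-diagonal : ∑ᴱ (λ z → [ z ≟ᵛ 0ᵛ ]) ≡ n
    ∑ᴱ-diagonal = trans (∑-cong-∈ E λ {x} x∈E → trans
        (∑-cong E λ x′ → []-⇔ (x -ᵛ x′ ≟ᵛ 0ᵛ) (x′ ≟ᵛ x) (λ e → sym (-ᵛ-zero⇒≡ x x′ e)) (λ { refl → -ᵛ-self x′ }))
        (unique⇒∑≡1 _≟ᵛ_ unique x∈E))
      (trans (∑-const E 1ℤ) (*-identityʳ n))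

    ∑ᴱ-ψ : ∀ (f : Point d → Carrier) → ∑ᴱ (λ z → ψ (f z)) ≡ Q * ∑ᴱ (λ z → [ f z ≟ 0# ]) - n * n
    ∑ᴱ-ψ f = trans (∑∑-+ E E _ _) (cong₂ _+_ (∑∑-*ˡ E E Q _)
      (trans (∑∑-const E E (- 1ℤ)) (lemma n)))
      where
      lemma : ∀ i → i * (i * - 1ℤ) ≡ - (i * i)
      lemma = solve-∀

    ∑ᴬ-ψ : ∀ (f : Point d → Point d → Carrier) →
      ∑ᴬ (λ z w → ψ (f z w)) ≡ Q * ∑ᴬ (λ z w → [ f z w ≟ 0# ]) - n * n * (n * n)
    ∑ᴬ-ψ f = trans (∑ᴬ-cong λ z w → lemma Q [ f z w ≟ 0# ])
      (trans (∑ᴬ-linear Q (- 1ℤ) (λ z w → [ f z w ≟ 0# ]) (λ _ _ → 1ℤ)) (cong (_+_ (Q * ∑ᴬ (λ z w → [ f z w ≟ 0# ])))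
        (trans (cong (- 1ℤ *_) ∑ᴬ-1) (-1*i≡-i _))))
      where
      lemma : ∀ k i → k * i - 1ℤ ≡ k * i + - 1ℤ * 1ℤ
      lemma = solve-∀

    -- The sum over nontrivial χ of the absolute square of the sum of χ(ξ · x) over x in E.
    energy : Point d → ℤ
    energy ξ = ∑ᴱ (λ z → ψ (ξ · z))

    energy-nonneg : ∀ ξ → 0ℤ ≤ energy ξ
    energy-nonneg ξ = subst (0ℤ ≤_)
      (∑-cong E λ x → ∑-cong E λ x′ → cong ψ (sym (·-difference ξ x x′)))
      (∑∑ψ-differences-nonneg E (ξ ·_))

    -- Plancherel: the sum over all frequencies leaves only the diagonal of E × E.
    ∑-energy : ∑[ ξ ← vectors d ] energy ξ ≡ (Q - 1ℤ) * (Q ^ d * n)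
    ∑-energy = begin
      ∑[ ξ ← vectors d ] energy ξ                              ≡⟨ sym (∑-swap₃ E E (vectors d) _) ⟩
      ∑ᴱ (λ z → ∑[ ξ ← vectors d ] ψ (ξ · z))                  ≡⟨ ∑ᴱ-cong ∑ψ-dot ⟩
      ∑ᴱ (λ z → (Q - 1ℤ) * (Q ^ d * [ z ≟ᵛ 0ᵛ ]))              ≡⟨ trans (∑∑-*ˡ E E (Q - 1ℤ) _) (cong ((Q - 1ℤ) *_) (∑∑-*ˡ E E (Q ^ d) _)) ⟩
      (Q - 1ℤ) * (Q ^ d * ∑ᴱ (λ z → [ z ≟ᵛ 0ᵛ ]))              ≡⟨ cong (λ k → (Q - 1ℤ) * (Q ^ d * k)) ∑ᴱ-diagonal ⟩
      (Q - 1ℤ) * (Q ^ d * n)                                   ∎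
      where open ≡-Reasoning

    module Weighted (weight : Point d → ℤ) (M : ℤ) (0≤weight : ∀ ξ → 0ℤ ≤ weight ξ) (weight≤M : ∀ ξ → weight ξ ≤ M) where

      total : ℤ
      total = ∑ᴱ (λ z → ∑[ ξ ← vectors d ] weight ξ * ψ (ξ · z))

      total≡ : total ≡ ∑[ ξ ← vectors d ] weight ξ * energy ξ
      total≡ = trans (∑-swap₃ E E (vectors d) _) (∑-cong (vectors d) λ ξ → ∑∑-*ˡ E E (weight ξ) _)

      total-nonneg : 0ℤ ≤ total
      total-nonneg = subst (0ℤ ≤_) (sym total≡) (∑-nonneg (vectors d) λ ξ → nonneg-* (0≤weight ξ) (energy-nonneg ξ))

      total-≤ : total ≤ M * ((Q - 1ℤ) * (Q ^ d * n))
      total-≤ = subst₂ _≤_ (sym total≡) (trans (∑-*ˡ (vectors d) M energy) (cong (M *_) ∑-energy))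
        (∑-mono (vectors d) λ ξ → *-monoʳ-≤-nonNeg (energy ξ) {{ℤ.nonNegative (energy-nonneg ξ)}} (weight≤M ξ))

      -- A Gauss sum evaluation of `total` is trapped between zero and `M` times the Plancherel
      -- total, because all energies are nonnegative.
      bounds : ∀ {X} → Q * total ≡ (Q - 1ℤ) * X → 0ℤ ≤ X × 0ℤ ≤ M * (Q * (Q ^ d * n)) - X
      bounds {X} e =
        nonneg-cancel (Q - 1ℤ) 0<Q-1 (subst (0ℤ ≤_) e (nonneg-* (<⇒≤ (positive⁻¹ Q)) total-nonneg)) ,
        nonneg-cancel (Q - 1ℤ) 0<Q-1 (subst (0ℤ ≤_) (trans (lemma Q M (Q ^ d * n) total)
          (trans (cong (λ k → (Q - 1ℤ) * (M * (Q * (Q ^ d * n))) - k) e) (lemma′ (Q - 1ℤ) _ X)))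
          (nonneg-* (<⇒≤ (positive⁻¹ Q)) (i≤j⇒0≤j-i total-≤)))
        where
        lemma : ∀ k m x t → k * (m * ((k - 1ℤ) * x) - t) ≡ (k - 1ℤ) * (m * (k * x)) - k * t
        lemma = solve-∀
        lemma′ : ∀ k x y → k * x - k * y ≡ k * (x - y)
        lemma′ = solve-∀

    isotropicPairs : ℤ
    isotropicPairs = ∑ᴱ (λ z → [ ‖ z ‖ ≟ 0# ])

    private
      D U : ℤ
      D = Q ^ d
      U = Q * isotropicPairs - n * n

    ∑ᴱ-coneKernel : ∀ {g} → GaussSum (vectors d) ‖_‖ g → Q * ∑ᴱ coneKernel ≡ (Q - 1ℤ) * (g * U + D * n)
    ∑ᴱ-coneKernel {g} gauss = begin
      Q * ∑ᴱ coneKernel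
        ≡⟨ sym (∑∑-*ˡ E E Q _) ⟩
      ∑ᴱ (λ z → Q * coneKernel z)
        ≡⟨ ∑ᴱ-cong (coneKernel-Gauss {g = g} gauss) ⟩
      ∑ᴱ (λ z → (Q - 1ℤ) * (g * ψ ‖ z ‖ + D * [ z ≟ᵛ 0ᵛ ]))
        ≡⟨ trans (∑∑-*ˡ E E (Q - 1ℤ) _) (cong ((Q - 1ℤ) *_) (∑ᴱ-linear g D (λ z → ψ ‖ z ‖) (λ z → [ z ≟ᵛ 0ᵛ ]))) ⟩
      (Q - 1ℤ) * (g * ∑ᴱ (λ z → ψ ‖ z ‖) + D * ∑ᴱ (λ z → [ z ≟ᵛ 0ᵛ ]))
        ≡⟨ cong₂ (λ i j → (Q - 1ℤ) * (g * i + D * j)) (∑ᴱ-ψ ‖_‖) ∑ᴱ-diagonal ⟩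
      (Q - 1ℤ) * (g * U + D * n) ∎
      where open ≡-Reasoning

    isotropic-even : ∀ {g} → GaussSum (vectors d) ‖_‖ g →
      0ℤ ≤ g * U + D * n × 0ℤ ≤ Q * (D * n) - (g * U + D * n)
    isotropic-even {g} gauss = proj₁ both , subst (λ k → 0ℤ ≤ k - (g * U + D * n)) (*-identityˡ (Q * (D * n))) (proj₂ both)
      where
      open Weighted (λ ξ → [ ‖ ξ ‖ ≟ 0# ]) 1ℤ (λ ξ → []-nonneg (‖ ξ ‖ ≟ 0#)) (λ ξ → []-≤1 (‖ ξ ‖ ≟ 0#))
      both : 0ℤ ≤ g * U + D * n × 0ℤ ≤ 1ℤ * (Q * (D * n)) - (g * U + D * n)
      both = bounds (∑ᴱ-coneKernel {g} gauss)

    -- A field element has at most two square roots, so the weight bound is 2 and `g * U` ranges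
    -- over an interval symmetric about zero. With g² = QD from `norm-odd` in place of D, the
    -- resulting bound on `U` is better by √Q than in even dimension.
    isotropic-odd : ∀ {g} → GaussSum (cartesianProduct (vectors d) elements) normWithSquare g →
      0ℤ ≤ g * U + Q * (D * n) × 0ℤ ≤ + 2 * (Q * (D * n)) - (g * U + Q * (D * n))
    isotropic-odd {g} gauss = bounds (begin
      Q * total
        ≡⟨ sym (∑∑-*ˡ E E Q _) ⟩
      ∑ᴱ (λ z → Q * (∑[ ξ ← vectors d ] roots ξ * ψ (ξ · z)))
        ≡⟨ ∑ᴱ-cong (coneWithSquare-Gauss {g = g} gauss) ⟩
      ∑ᴱ (λ z → (Q - 1ℤ) * (g * ψ ‖ z ‖ + Q * (D * [ z ≟ᵛ 0ᵛ ])))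
        ≡⟨ trans (∑∑-*ˡ E E (Q - 1ℤ) _) (cong ((Q - 1ℤ) *_) (trans (∑ᴱ-linear g Q (λ z → ψ ‖ z ‖) (λ z → D * [ z ≟ᵛ 0ᵛ ]))
             (cong (λ k → g * ∑ᴱ (λ z → ψ ‖ z ‖) + Q * k) (∑∑-*ˡ E E D _)))) ⟩
      (Q - 1ℤ) * (g * ∑ᴱ (λ z → ψ ‖ z ‖) + Q * (D * ∑ᴱ (λ z → [ z ≟ᵛ 0ᵛ ])))
        ≡⟨ cong₂ (λ i j → (Q - 1ℤ) * (g * i + Q * (D * j))) (∑ᴱ-ψ ‖_‖) ∑ᴱ-diagonal ⟩
      (Q - 1ℤ) * (g * U + Q * (D * n)) ∎)
      where
      open ≡-Reasoning
      roots : Point d → ℤ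
      roots ξ = ∑[ a ] [ a ⊙ a ≟ ‖ ξ ‖ ]
      open Weighted roots (+ 2) (λ ξ → ∑-nonneg elements λ a → []-nonneg (a ⊙ a ≟ ‖ ξ ‖)) (λ ξ → ∑-roots≤2 ‖ ξ ‖)

    -- Counting pairs of pairs in a given ratio.

    module Ratio (ρ : Carrier) (ρ≢0 : ρ ≢ 0#) (gaussᵖ : GaussSum (pairs d) (pairForm ρ) (Q ^ d)) where

      ratioPairs : ℤ
      ratioPairs = ∑ᴬ (λ z w → [ pairForm ρ (z , w) ≟ 0# ])

      private
        W : ℤ
        W = Q * ratioPairs - n * n * (n * n)

      pairEnergy : Point d × Point d → ℤ
      pairEnergy ξ = ∑ᴬ (λ z w → ψ (pairing ρ ξ (z , w)))

      pairEnergy-nonneg : ∀ ξ → 0ℤ ≤ pairEnergy ξ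
      pairEnergy-nonneg (ξ , ζ) = subst (0ℤ ≤_)
        (∑-cong A λ a → ∑-cong A λ a′ → cong ψ (sym (difference (proj₁ a) (proj₂ a) (proj₁ a′) (proj₂ a′))))
        (∑∑ψ-differences-nonneg A (λ a → ζ · proj₂ a ⊕ ρ ⊙ (ξ · proj₁ a)))
        where
        open ≡-Reasoning
        difference : ∀ x y x′ y′ → ζ · (y -ᵛ y′) ⊕ ρ ⊙ (ξ · (x -ᵛ x′)) ≡ (ζ · y ⊕ ρ ⊙ (ξ · x)) ⊝ (ζ · y′ ⊕ ρ ⊙ (ξ · x′))
        difference x y x′ y′ = begin
          ζ · (y -ᵛ y′) ⊕ ρ ⊙ (ξ · (x -ᵛ x′))
            ≡⟨ cong₂ (λ s t → s ⊕ ρ ⊙ t) (·-difference ζ y y′) (·-difference ξ x x′) ⟩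
          ζ · y ⊕ ⊖ (ζ · y′) ⊕ ρ ⊙ (ξ · x ⊕ ⊖ (ξ · x′))
            ≡⟨ solve 5 (λ r a b s t → a :+ b :+ r :* (s :+ t) := (a :+ r :* s) :+ (b :+ r :* t)) refl
                 ρ (ζ · y) (⊖ (ζ · y′)) (ξ · x) (⊖ (ξ · x′)) ⟩
          ζ · y ⊕ ρ ⊙ (ξ · x) ⊕ (⊖ (ζ · y′) ⊕ ρ ⊙ ⊖ (ξ · x′))
            ≡⟨ cong (ζ · y ⊕ ρ ⊙ (ξ · x) ⊕_) (trans (cong (⊖ (ζ · y′) ⊕_) (sym (R.-‿distribʳ-* ρ _))) (R.-‿+-comm _ _)) ⟩
          (ζ · y ⊕ ρ ⊙ (ξ · x)) ⊝ (ζ · y′ ⊕ ρ ⊙ (ξ · x′)) ∎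

      pairTotal : ℤ
      pairTotal = ∑ᴬ (λ z w → pairKernel ρ (z , w))

      pairTotal≡ : pairTotal ≡ ∑[ ξ ← pairs d ] [ pairForm ρ ξ ≟ 0# ] * pairEnergy ξ
      pairTotal≡ = trans (∑-swap₃ A A (pairs d) _) (∑-cong (pairs d) λ ξ → ∑∑-*ˡ A A [ pairForm ρ ξ ≟ 0# ] _)

      pairTotal-Gauss : Q * pairTotal ≡ (Q - 1ℤ) * (D * W + (D * n) * (D * n))
      pairTotal-Gauss = begin
        Q * pairTotal
          ≡⟨ sym (∑∑-*ˡ A A Q _) ⟩
        ∑ᴬ (λ z w → Q * pairKernel ρ (z , w))
          ≡⟨ ∑ᴬ-cong (pairKernel-Gauss ρ≢0 gaussᵖ) ⟩
        ∑ᴬ (λ z w → (Q - 1ℤ) * (D * ψ (pairForm ρ (z , w)) + (D * [ z ≟ᵛ 0ᵛ ]) * (D * [ w ≟ᵛ 0ᵛ ])))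
          ≡⟨ trans (∑∑-*ˡ A A (Q - 1ℤ) _) (cong ((Q - 1ℤ) *_) (trans (∑∑-+ A A _ _) (cong₂ _+_
               (trans (∑∑-*ˡ A A D _) (cong (D *_) (∑ᴬ-ψ λ z w → pairForm ρ (z , w))))
               (trans (∑ᴬ-product (λ z → D * [ z ≟ᵛ 0ᵛ ]) (λ w → D * [ w ≟ᵛ 0ᵛ ])) (cong₂ _*_ diagonal diagonal))))) ⟩
        (Q - 1ℤ) * (D * W + (D * n) * (D * n)) ∎
        where
        open ≡-Reasoning
        diagonal : ∑ᴱ (λ z → D * [ z ≟ᵛ 0ᵛ ]) ≡ D * n
        diagonal = trans (∑∑-*ˡ E E D _) (cong (D *_) ∑ᴱ-diagonal)

      pair-nonneg : 0ℤ ≤ D * W + (D * n) * (D * n)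
      pair-nonneg = nonneg-cancel (Q - 1ℤ) 0<Q-1 (subst (0ℤ ≤_) pairTotal-Gauss (nonneg-* (<⇒≤ (positive⁻¹ Q))
        (subst (0ℤ ≤_) (sym pairTotal≡) (∑-nonneg (pairs d) λ ξ →
          nonneg-* ([]-nonneg (pairForm ρ ξ ≟ 0#)) (pairEnergy-nonneg ξ)))))

      isotropicTotal≤pairTotal : ∑ᴬ (λ z w → isotropicPairKernel ρ (z , w)) ≤ pairTotal
      isotropicTotal≤pairTotal = subst₂ _≤_ (sym expand) (sym pairTotal≡)
        (∑-mono (pairs d) λ ξ → *-monoʳ-≤-nonNeg (pairEnergy ξ) {{ℤ.nonNegative (pairEnergy-nonneg ξ)}} (isotropic≤ ξ))
        where
        weight : Point d × Point d → ℤ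
        weight (x , y) = [ ‖ x ‖ ≟ 0# ] * [ ‖ y ‖ ≟ 0# ]
        expand : ∑ᴬ (λ z w → isotropicPairKernel ρ (z , w)) ≡ ∑[ ξ ← pairs d ] weight ξ * pairEnergy ξ
        expand = trans (∑ᴬ-cong λ z w → sym (∑-cartesian _,_ (vectors d) (vectors d) λ ξ → weight ξ * ψ (pairing ρ ξ (z , w))))
          (trans (∑-swap₃ A A (pairs d) _) (∑-cong (pairs d) λ ξ → ∑∑-*ˡ A A (weight ξ) _))
        isotropic≤ : ∀ ξ → weight ξ ≤ [ pairForm ρ ξ ≟ 0# ]
        isotropic≤ (x , y) = bound (‖ x ‖ ≟ 0#) (‖ y ‖ ≟ 0#)
          where
          bound : (D₁ : Dec (‖ x ‖ ≡ 0#)) (D₂ : Dec (‖ y ‖ ≡ 0#)) → [ D₁ ] * [ D₂ ] ≤ [ pairForm ρ (x , y) ≟ 0# ]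
          bound (yes x≡0) (yes y≡0) = ≤-reflexive (sym ([]-yes (pairForm ρ (x , y) ≟ 0#)
            (trans (cong₂ (λ s t → s ⊕ ρ ⊙ t) y≡0 x≡0) (trans (R.+-identityˡ _) (R.zeroʳ ρ)))))
          bound (yes _) (no _) = []-nonneg (pairForm ρ (x , y) ≟ 0#)
          bound (no _)  (yes _) = []-nonneg (pairForm ρ (x , y) ≟ 0#)
          bound (no _)  (no _) = []-nonneg (pairForm ρ (x , y) ≟ 0#)

      -- Of the energies on the cone of the pair form only those on isotropic × isotropic are kept; they account
      -- for the square of the isotropic count, which is what has to be discarded later.
      pair-even : ∀ {g} → GaussSum (vectors d) ‖_‖ g →
        0ℤ ≤ Q * (D * W + (D * n) * (D * n)) - (g * U + D * n) * (g * U + D * n)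
      pair-even {g} gauss = nonneg-cancel ((Q - 1ℤ) * (Q - 1ℤ)) (positive-* 0<Q-1 0<Q-1)
        (subst (0ℤ ≤_) identity (nonneg-* (nonneg-* (<⇒≤ (positive⁻¹ Q)) (<⇒≤ (positive⁻¹ Q)))
          (nonneg-* (<⇒≤ 0<Q-1) (i≤j⇒0≤j-i isotropicTotal≤pairTotal))))
        where
        open ≡-Reasoning
        S I X Y : ℤ
        S = ∑ᴱ coneKernel
        I = ∑ᴬ (λ z w → isotropicPairKernel ρ (z , w))
        X = g * U + D * n
        Y = D * W + (D * n) * (D * n)
        splits : (Q - 1ℤ) * I ≡ S * S
        splits = trans (sym (∑∑-*ˡ A A (Q - 1ℤ) _)) (trans (∑ᴬ-cong (isotropicPairKernel-splits ρ≢0)) (∑ᴬ-product coneKernel coneKernel))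
        lemma₁ : ∀ k j p i → k * k * (j * (p - i)) ≡ k * (j * (k * p)) - k * k * (j * i)
        lemma₁ = solve-∀
        lemma₂ : ∀ k j y s → k * (j * (j * y)) - k * k * (s * s) ≡ k * (j * (j * y)) - (k * s) * (k * s)
        lemma₂ = solve-∀
        lemma₃ : ∀ k j y x → k * (j * (j * y)) - (j * x) * (j * x) ≡ j * j * (k * y - x * x)
        lemma₃ = solve-∀
        identity : Q * Q * ((Q - 1ℤ) * (pairTotal - I)) ≡ (Q - 1ℤ) * (Q - 1ℤ) * (Q * Y - X * X)
        identity = begin
          Q * Q * ((Q - 1ℤ) * (pairTotal - I))
            ≡⟨ lemma₁ Q (Q - 1ℤ) pairTotal I ⟩
          Q * ((Q - 1ℤ) * (Q * pairTotal)) - Q * Q * ((Q - 1ℤ) * I)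
            ≡⟨ cong₂ (λ s t → Q * ((Q - 1ℤ) * s) - Q * Q * t) pairTotal-Gauss splits ⟩
          Q * ((Q - 1ℤ) * ((Q - 1ℤ) * Y)) - Q * Q * (S * S)
            ≡⟨ lemma₂ Q (Q - 1ℤ) Y S ⟩
          Q * ((Q - 1ℤ) * ((Q - 1ℤ) * Y)) - (Q * S) * (Q * S)
            ≡⟨ cong (λ s → Q * ((Q - 1ℤ) * ((Q - 1ℤ) * Y)) - s * s) (∑ᴱ-coneKernel {g} gauss) ⟩
          Q * ((Q - 1ℤ) * ((Q - 1ℤ) * Y)) - ((Q - 1ℤ) * X) * ((Q - 1ℤ) * X)
            ≡⟨ lemma₃ Q (Q - 1ℤ) Y X ⟩
          (Q - 1ℤ) * (Q - 1ℤ) * (Q * Y - X * X) ∎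

      anisotropicRatioPairs : ℤ
      anisotropicRatioPairs = ∑ᴬ (λ z w → [ pairForm ρ (z , w) ≟ 0# ] * (1ℤ - [ ‖ z ‖ ≟ 0# ]))

      -- On the cone of the pair form an isotropic `z` forces `w` to be isotropic, and any two
      -- isotropic vectors lie on the cone. So the removed part is a full product.
      anisotropicRatioPairs≡ : anisotropicRatioPairs ≡ ratioPairs - isotropicPairs * isotropicPairs
      anisotropicRatioPairs≡ = begin
        anisotropicRatioPairs
          ≡⟨ ∑ᴬ-cong (λ z w → split z w (‖ z ‖ ≟ 0#)) ⟩
        ∑ᴬ (λ z w → 1ℤ * [ pairForm ρ (z , w) ≟ 0# ] + - 1ℤ * ([ ‖ z ‖ ≟ 0# ] * [ ‖ w ‖ ≟ 0# ]))
          ≡⟨ ∑ᴬ-linear 1ℤ (- 1ℤ) (λ z w → [ pairForm ρ (z , w) ≟ 0# ]) (λ z w → [ ‖ z ‖ ≟ 0# ] * [ ‖ w ‖ ≟ 0# ]) ⟩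
        1ℤ * ratioPairs + - 1ℤ * ∑ᴬ (λ z w → [ ‖ z ‖ ≟ 0# ] * [ ‖ w ‖ ≟ 0# ])
          ≡⟨ cong₂ _+_ (*-identityˡ ratioPairs) (trans (-1*i≡-i _)
               (cong -_ (∑ᴬ-product (λ z → [ ‖ z ‖ ≟ 0# ]) (λ w → [ ‖ w ‖ ≟ 0# ])))) ⟩
        ratioPairs - isotropicPairs * isotropicPairs ∎
        where
        open ≡-Reasoning
        lemma : ∀ i → i * (1ℤ - 1ℤ) ≡ 1ℤ * i + - 1ℤ * (1ℤ * i)
        lemma = solve-∀
        lemma′ : ∀ i j → i * (1ℤ - 0ℤ) ≡ 1ℤ * i + - 1ℤ * (0ℤ * j)
        lemma′ = solve-∀
        split : ∀ z w (D₁ : Dec (‖ z ‖ ≡ 0#)) → [ pairForm ρ (z , w) ≟ 0# ] * (1ℤ - [ D₁ ]) ≡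
          1ℤ * [ pairForm ρ (z , w) ≟ 0# ] + - 1ℤ * ([ D₁ ] * [ ‖ w ‖ ≟ 0# ])
        split z w (no _)    = lemma′ [ pairForm ρ (z , w) ≟ 0# ] [ ‖ w ‖ ≟ 0# ]
        split z w (yes z≡0) = trans (lemma [ pairForm ρ (z , w) ≟ 0# ])
          (cong (λ i → 1ℤ * [ pairForm ρ (z , w) ≟ 0# ] + - 1ℤ * (1ℤ * i))
            ([]-⇔ (pairForm ρ (z , w) ≟ 0#) (‖ w ‖ ≟ 0#) (trans (sym same)) (trans same)))
          where
          same : pairForm ρ (z , w) ≡ ‖ w ‖
          same = trans (cong (λ s → ‖ w ‖ ⊕ ρ ⊙ s) z≡0) (trans (cong (‖ w ‖ ⊕_) (R.zeroʳ ρ)) (R.+-identityʳ _))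

      3≤Q : 0ℤ ≤ Q - + 3
      3≤Q = i≤j⇒0≤j-i (+≤+ 3≤q)

      0<Q^ : ∀ d → 0ℤ < Q ^ d
      0<Q^ zero    = +<+ (s≤s z≤n)
      0<Q^ (suc d) = positive-* (positive⁻¹ Q) (0<Q^ d)

      many-even : ∀ {g} → g * g ≡ D → GaussSum (vectors d) ‖_‖ g → 0ℤ ≤ n * n - + 400 * D →
        0ℤ ≤ + 25 * (Q * anisotropicRatioPairs) - + 8 * (n * n * (n * n))
      many-even {g} g²≡ gauss large = subst (λ N → 0ℤ ≤ + 25 * (Q * N) - + 8 * (n * n * (n * n))) (sym anisotropicRatioPairs≡)
        (count-even {Q} {D} {n} {ratioPairs} {isotropicPairs} {g} 3≤Q (0<Q^ d) (+≤+ z≤n) large g²≡ (pair-even {g} gauss)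
          (proj₁ (isotropic-even {g} gauss)) (proj₂ (isotropic-even {g} gauss)))

      many-odd : ∀ {g} → g * g ≡ Q * D → GaussSum (cartesianProduct (vectors d) elements) normWithSquare g →
        0ℤ ≤ n * n - + 400 * D → 0ℤ ≤ + 25 * (Q * anisotropicRatioPairs) - + 8 * (n * n * (n * n))
      many-odd {g} g²≡ gauss large = subst (λ N → 0ℤ ≤ + 25 * (Q * N) - + 8 * (n * n * (n * n))) (sym anisotropicRatioPairs≡)
        (count-odd {Q} {D} {n} {ratioPairs} {isotropicPairs} {g} 3≤Q (0<Q^ d) (+≤+ z≤n) large g²≡ pair-nonneg
          (proj₁ (isotropic-odd {g} gauss)) (proj₂ (isotropic-odd {g} gauss)))

  pos-^ : ∀ m k → (+ m) ^ k ≡ + (m ℕ.^ k)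
  pos-^ m ℕ.zero    = refl
  pos-^ m (ℕ.suc k) = trans (cong (+ m *_) (pos-^ m k)) (sym (pos-* m (m ℕ.^ k)))

  parity : ∀ d → (∃ λ m → d ≡ m ℕ.* 2) ⊎ (∃ λ m → d ≡ ℕ.suc (m ℕ.* 2))
  parity ℕ.zero = inj₁ (0 , refl)
  parity (ℕ.suc d) with parity d
  ... | inj₁ (m , e) = inj₂ (m , cong ℕ.suc e)
  ... | inj₂ (m , e) = inj₁ (ℕ.suc m , cong ℕ.suc e)

  injective-from-< : ∀ {b n} {B : Set b} {f : Fin n → B} → (∀ i j → i Fin.< j → f j ≢ f i) → Injective _≡_ _≡_ f
  injective-from-< {f = f} distinct {i} {j} e with Fin.<-cmp i j
  ... | tri< i<j _ _ = ⊥-elim (distinct i j i<j (sym e))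
  ... | tri≈ _ i≡j _ = i≡j
  ... | tri> _ _ j<i = ⊥-elim (distinct j i j<i e)

  -- From the count to a pair of paths.

  module Paths {c q} (F : FiniteField c q) (odd : ¬ (2 ∣ q)) {d} (E : FiniteSubset (FiniteField.Point F d))
    (r : FiniteField.Carrier F) (r≢0 : r ≢ FiniteField.0# F) where
    open Bound F odd (FiniteSubset.elements E) (FiniteSubset.distinct E)

    private
      elementsᴱ : List (Point d)
      elementsᴱ = FiniteSubset.elements E

    Pair : Set c
    Pair = Point d × Point d

    Adj : Pair → Pair → Set c
    Adj (x , y) (x′ , y′) = ‖ y -ᵛ y′ ‖ ≡ r ⊙ ‖ x -ᵛ x′ ‖ × r ⊙ ‖ x -ᵛ x′ ‖ ≢ 0#

    adj? : Decidable Adj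
    adj? (x , y) (x′ , y′) = (‖ y -ᵛ y′ ‖ ≟ r ⊙ ‖ x -ᵛ x′ ‖) ×-dec ¬? (r ⊙ ‖ x -ᵛ x′ ‖ ≟ 0#)

    ‖-ᵛ‖-comm : ∀ {d} (x y : Point d) → ‖ x -ᵛ y ‖ ≡ ‖ y -ᵛ x ‖
    ‖-ᵛ‖-comm []      []      = refl
    ‖-ᵛ‖-comm (a ∷ x) (b ∷ y) = cong₂ _⊕_ (trans (cong (λ s → s ⊙ s) (sym (R.⁻¹-anti-homo-// b a))) (⊖-square (b ⊝ a))) (‖-ᵛ‖-comm x y)

    ‖-ᵛ‖-self : ∀ {d} (x : Point d) → ‖ x -ᵛ x ‖ ≡ 0#
    ‖-ᵛ‖-self []      = refl
    ‖-ᵛ‖-self (a ∷ x) = trans (cong₂ _⊕_ (trans (cong (_⊙ (a ⊝ a)) (R.-‿inverseʳ a)) (R.zeroˡ _)) (‖-ᵛ‖-self x)) (R.+-identityˡ 0#)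

    adj-sym : Symmetric Adj
    adj-sym {x , y} {x′ , y′} (e , ne) =
      trans (‖-ᵛ‖-comm y′ y) (trans e (cong (r ⊙_) (‖-ᵛ‖-comm x x′))) ,
      λ e′ → ne (trans (cong (r ⊙_) (‖-ᵛ‖-comm x x′)) e′)

    adj⇒apart : ∀ {a b} → Adj a b → proj₁ b ≢ proj₁ a × proj₂ b ≢ proj₂ a
    adj⇒apart {x , y} (e , ne) =
      (λ { refl → ne (trans (cong (r ⊙_) (‖-ᵛ‖-self x)) (R.zeroʳ r)) }) ,
      (λ { refl → ne (trans (sym e) (‖-ᵛ‖-self y)) })

    containsPair : Path₅ _≟ᵛ_ (FiniteSubset.distinct E) {n} refl adj? (λ {a} {b} → adj-sym {a} {b}) → ContainsPair F 4-path r E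
    containsPair path = x , y , injective-from-< (λ i j i<j → proj₁ (apart i j i<j)) ,
      injective-from-< (λ i j i<j → proj₂ (apart i j i<j)) ,
      (λ i → proj₁ (∈-cartesianProduct⁻ elementsᴱ elementsᴱ (vertex∈ i))) ,
      (λ i → proj₂ (∈-cartesianProduct⁻ elementsᴱ elementsᴱ (vertex∈ i))) , edges
      where
      open Path₅ path
      vertex : Fin 5 → Pair
      vertex zero                         = a₁
      vertex (suc zero)                   = a₂
      vertex (suc (suc zero))             = a₃
      vertex (suc (suc (suc zero)))       = a₄
      vertex (suc (suc (suc (suc zero)))) = a₅
      x y : Fin 5 → Point d
      x i = proj₁ (vertex i)
      y i = proj₂ (vertex i)
      vertex∈ : ∀ i → vertex i ∈ A
      vertex∈ zero                         = a₁∈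
      vertex∈ (suc zero)                   = a₂∈
      vertex∈ (suc (suc zero))             = a₃∈
      vertex∈ (suc (suc (suc zero)))       = a₄∈
      vertex∈ (suc (suc (suc (suc zero)))) = a₅∈
      apart : ∀ i j → i Fin.< j → x j ≢ x i × y j ≢ y i
      apart zero (suc zero) _                                             = adj⇒apart a₁₂
      apart zero (suc (suc zero)) _                                       = All.head a₃-apart
      apart zero (suc (suc (suc zero))) _                                 = All.head a₄-apart
      apart zero (suc (suc (suc (suc zero)))) _                           = All.head a₅-apart
      apart (suc zero) (suc (suc zero)) _                                 = adj⇒apart a₂₃
      apart (suc zero) (suc (suc (suc zero))) _                           = All.head (All.tail a₄-apart)
      apart (suc zero) (suc (suc (suc (suc zero)))) _                     = All.head (All.tail a₅-apart)
      apart (suc (suc zero)) (suc (suc (suc zero))) _                     = adj⇒apart a₃₄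
      apart (suc (suc zero)) (suc (suc (suc (suc zero)))) _               = All.head (All.tail (All.tail a₅-apart))
      apart (suc (suc (suc zero))) (suc (suc (suc (suc zero)))) _         = adj⇒apart a₄₅
      apart (suc zero) (suc zero) (s≤s ())
      apart (suc (suc zero)) (suc zero) (s≤s ())
      apart (suc (suc zero)) (suc (suc zero)) (s≤s (s≤s ()))
      apart (suc (suc (suc i))) (suc zero) (s≤s ())
      apart (suc (suc (suc i))) (suc (suc zero)) (s≤s (s≤s ()))
      apart (suc (suc (suc i))) (suc (suc (suc zero))) (s≤s (s≤s (s≤s ())))
      apart (suc (suc (suc (suc i)))) (suc (suc (suc (suc zero)))) (s≤s (s≤s (s≤s (s≤s ()))))
      forward : ∀ i j → ℕ.suc (toℕ i) ≡ toℕ j → Adj (vertex i) (vertex j)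
      forward zero (suc zero) _                                           = a₁₂
      forward (suc zero) (suc (suc zero)) _                               = a₂₃
      forward (suc (suc zero)) (suc (suc (suc zero))) _                   = a₃₄
      forward (suc (suc (suc zero))) (suc (suc (suc (suc zero)))) _       = a₄₅
      edges : ∀ i j → Graph.Adj 4-path i j → Adj (vertex i) (vertex j)
      edges i j (inj₁ e) = forward i j e
      edges i j (inj₂ e) = adj-sym {vertex j} {vertex i} (forward j i e)

    private
      -- The pair form adds its two norms, so the ratio `r` enters it with a minus sign.
      ρ : Carrier
      ρ = ⊖ r

      ρ≢0 : ρ ≢ 0#
      ρ≢0 = ⊖-nonzero r≢0

      adj-weight : ∀ (z w : Point d) → [ (‖ w ‖ ≟ r ⊙ ‖ z ‖) ×-dec ¬? (r ⊙ ‖ z ‖ ≟ 0#) ] ≡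
        [ pairForm ρ (z , w) ≟ 0# ] * (1ℤ - [ ‖ z ‖ ≟ 0# ])
      adj-weight z w = weight (‖ z ‖ ≟ 0#) (‖ w ‖ ≟ r ⊙ ‖ z ‖) (r ⊙ ‖ z ‖ ≟ 0#) (pairForm ρ (z , w) ≟ 0#)
        where
        form≡ : pairForm ρ (z , w) ≡ ‖ w ‖ ⊝ r ⊙ ‖ z ‖
        form≡ = cong (‖ w ‖ ⊕_) (sym (R.-‿distribˡ-* r ‖ z ‖))
        to : ‖ w ‖ ≡ r ⊙ ‖ z ‖ → pairForm ρ (z , w) ≡ 0#
        to e = trans form≡ (trans (cong (_⊝ r ⊙ ‖ z ‖) e) (R.-‿inverseʳ _))
        from : pairForm ρ (z , w) ≡ 0# → ‖ w ‖ ≡ r ⊙ ‖ z ‖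
        from e = ⊝-zero⇒≡ (trans (sym form≡) e)
        weight : (D₁ : Dec (‖ z ‖ ≡ 0#)) (D₂ : Dec (‖ w ‖ ≡ r ⊙ ‖ z ‖)) (D₃ : Dec (r ⊙ ‖ z ‖ ≡ 0#))
          (D₄ : Dec (pairForm ρ (z , w) ≡ 0#)) →
          [ D₂ ×-dec ¬? D₃ ] ≡ [ D₄ ] * (1ℤ - [ D₁ ])
        weight (yes z≡0) D₂ D₃ D₄ = trans ([]-no (D₂ ×-dec ¬? D₃) λ (_ , ne) → ne (trans (cong (r ⊙_) z≡0) (R.zeroʳ r)))
          (sym (*-zeroʳ [ D₄ ]))
        weight (no z≢0) D₂ D₃ D₄ = trans ([]-⇔ (D₂ ×-dec ¬? D₃) D₄ (λ (e , _) → to e) (λ e → from e , λ rz≡0 → z≢0 (⊙-zero r≢0 rz≡0)))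
          (sym (*-identityʳ [ D₄ ]))

    -- By `adj-weight` the degree sum of the graph on `A` is `anisotropicRatioPairs`, so the lower
    -- bound from the energies is a lower bound on ordered edges.
    contains-if-many : (gaussᵖ : GaussSum (pairs d) (pairForm ρ) (Q ^ d)) →
      75 ℕ.* q ℕ.< 2 ℕ.* length elementsᴱ →
      0ℤ ≤ + 25 * (Q * Ratio.anisotropicRatioPairs ρ ρ≢0 gaussᵖ) - + 8 * (n * n * (n * n)) → ContainsPair F 4-path r E
    contains-if-many gaussᵖ steep many = containsPair (path₅ _≟ᵛ_ (FiniteSubset.distinct E) refl adj? (λ {a} {b} → adj-sym {a} {b})
      (subst (+ 12 * (n * (n * n)) <_) (sym degrees) (many⇒dense {Q} {n} (+≤+ z≤n) (+≤+ z≤n) steepℤ many)))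
      where
      degrees : ∑[ a ← A ] ∑[ a′ ← A ] [ adj? a a′ ] ≡ Ratio.anisotropicRatioPairs ρ ρ≢0 gaussᵖ
      degrees = ∑ᴬ-cong {λ z w → [ (‖ w ‖ ≟ r ⊙ ‖ z ‖) ×-dec ¬? (r ⊙ ‖ z ‖ ≟ 0#) ]}
        {λ z w → [ pairForm ρ (z , w) ≟ 0# ] * (1ℤ - [ ‖ z ‖ ≟ 0# ])} adj-weight
      steepℤ : 0ℤ < + 2 * n - + 75 * Q
      steepℤ = subst (_< + 2 * n - + 75 * Q) (+-inverseʳ (+ 75 * Q)) (+-monoˡ-< (- (+ 75 * Q))
        (subst₂ _<_ (pos-* 75 q) (pos-* 2 (length elementsᴱ)) (+<+ steep)))

    private
      largeℤ : 400 ℕ.* q ℕ.^ d ℕ.≤ length elementsᴱ ℕ.* length elementsᴱ → 0ℤ ≤ n * n - + 400 * Q ^ d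
      largeℤ h = i≤j⇒0≤j-i (subst₂ _≤_ (trans (pos-* 400 (q ℕ.^ d)) (cong (+ 400 *_) (sym (pos-^ q d))))
        (pos-* (length elementsᴱ) (length elementsᴱ)) (+≤+ h))

    contains-even : ∀ m → d ≡ m ℕ.* 2 → Large q d (length elementsᴱ) → ContainsPair F 4-path r E
    contains-even m d≡2m (large , steep) = contains-if-many gaussᵖ steep
      (Ratio.many-even ρ ρ≢0 gaussᵖ {proj₁ gauss} (proj₁ (proj₂ gauss)) (proj₂ (proj₂ gauss)) (largeℤ large))
      where
      gauss : ∃ λ g → g * g ≡ Q ^ d × GaussSum (vectors d) ‖_‖ g
      gauss = subst (λ d → ∃ λ g → g * g ≡ Q ^ d × GaussSum (vectors d) ‖_‖ g) (sym d≡2m) (norm-even m)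
      gaussᵖ : GaussSum (pairs d) (pairForm ρ) (Q ^ d)
      gaussᵖ = pairForm-even {d} {proj₁ gauss} ρ≢0 (proj₁ (proj₂ gauss)) (proj₂ (proj₂ gauss))

    contains-odd : ∀ m → d ≡ ℕ.suc (m ℕ.* 2) → (∃ λ s → r ≡ s ⊙ s) → Large q d (length elementsᴱ) → ContainsPair F 4-path r E
    contains-odd m d≡2m+1 (s , r≡s²) (large , steep) = contains-if-many gaussᵖ steep
      (Ratio.many-odd ρ ρ≢0 gaussᵖ {proj₁ gauss} (proj₁ (proj₂ gauss)) (proj₂ (proj₂ gauss)) (largeℤ large))
      where
      GaussOdd : ℕ → Set c
      GaussOdd d = ∃ λ g → g * g ≡ Q * Q ^ d × GaussSum (cartesianProduct (vectors d) elements) normWithSquare g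
      gauss : GaussOdd d
      gauss = subst GaussOdd (sym d≡2m+1) (norm-odd m)
      s≢0 : s ≢ 0#
      s≢0 s≡0 = r≢0 (trans r≡s² (trans (cong (_⊙ s) s≡0) (R.zeroˡ s)))
      gaussᵖ : GaussSum (pairs d) (pairForm ρ) (Q ^ d)
      gaussᵖ = subst (λ r → GaussSum (pairs d) (pairForm (⊖ r)) (Q ^ d)) (sym r≡s²) (pairForm-square s≢0 d)

-- The ranges of dimensions.

open import Defs
open FiniteField using (Carrier; Point; 0#; NonzeroSquare)
open import Data.Nat using (ℕ; _+_; _*_; _^_; _≥_)
open import Data.Nat.Properties using (≤-trans; n≤1+n)
open Thresholds
open FiniteFields

theorem1p6 : ∀ {c} (q : ℕ) → OddPrimePower q →
    (F : FiniteField c q) (d : ℕ) (E : FiniteSubset (Point F d)) →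
    (q ≥ 5 → d ≡ 2 ⊎ d ≡ 4 → (r : Carrier F) → r ≢ 0# F →
    ∣ E ∣ ≥ 36 · q ^[ 2 * d + 1 / 3 ] → ContainsPair F 4-path r E)
    × (d ≡ 3 → (r : Carrier F) → NonzeroSquare F r →
    ∣ E ∣ ≥ 9 · q ^[ 2 * d + 1 / 3 ] → ContainsPair F 4-path r E)
    × (d ≡ 5 → (r : Carrier F) → NonzeroSquare F r →
    ∣ E ∣ ≥ 12 * q ^ 3 → ContainsPair F 4-path r E)
    × (q ≥ 5 → d ≥ 6 → 2 ∣ d → (r : Carrier F) → r ≢ 0# F →
    ∣ E ∣ ≥ 313 · q ^[ d / 2 ] → ContainsPair F 4-path r E)
    × (d ≥ 7 → ¬ (2 ∣ d) → (r : Carrier F) → NonzeroSquare F r →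
    ∣ E ∣ ≥ 313 · q ^[ d / 2 ] → ContainsPair F 4-path r E)
theorem1p6 q (odd , _) F d E = dimension-2-4 , dimension-3 , dimension-5 , even-dimension , odd-dimension
  where
  open OddField F odd using (3≤q)
  open Paths F odd E

  dimension-2-4 : q ≥ 5 → d ≡ 2 ⊎ d ≡ 4 → (r : Carrier F) → r ≢ 0# F →
    ∣ E ∣ ≥ 36 · q ^[ 2 * d + 1 / 3 ] → ContainsPair F 4-path r E
  dimension-2-4 q≥5 (inj₁ refl) r r≢0 h = contains-even r r≢0 1 refl (large-2 {q} {∣ E ∣} q≥5 h)
  dimension-2-4 q≥5 (inj₂ refl) r r≢0 h = contains-even r r≢0 2 refl (large-4 {q} {∣ E ∣} q≥5 h)

  dimension-3 : d ≡ 3 → (r : Carrier F) → NonzeroSquare F r →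
    ∣ E ∣ ≥ 9 · q ^[ 2 * d + 1 / 3 ] → ContainsPair F 4-path r E
  dimension-3 refl r (r≢0 , square) h = contains-odd r r≢0 1 refl square (large-3 {q} {∣ E ∣} 3≤q h)

  dimension-5 : d ≡ 5 → (r : Carrier F) → NonzeroSquare F r →
    ∣ E ∣ ≥ 12 * q ^ 3 → ContainsPair F 4-path r E
  dimension-5 refl r (r≢0 , square) h = contains-odd r r≢0 2 refl square (large-5 {q} {∣ E ∣} 3≤q h)

  even-dimension : q ≥ 5 → d ≥ 6 → 2 ∣ d → (r : Carrier F) → r ≢ 0# F →
    ∣ E ∣ ≥ 313 · q ^[ d / 2 ] → ContainsPair F 4-path r E
  even-dimension _ d≥6 (divides m d≡2m) r r≢0 h = contains-even r r≢0 m d≡2m (large-≥6 {q} {∣ E ∣} {d} 3≤q d≥6 h)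

  odd-dimension : d ≥ 7 → ¬ (2 ∣ d) → (r : Carrier F) → NonzeroSquare F r →
    ∣ E ∣ ≥ 313 · q ^[ d / 2 ] → ContainsPair F 4-path r E
  odd-dimension d≥7 2∤d r (r≢0 , square) h with parity d
  ... | inj₁ (m , d≡2m)   = ⊥-elim (2∤d (divides m d≡2m))
  ... | inj₂ (m , d≡2m+1) = contains-odd r r≢0 m d≡2m+1 square (large-≥6 {q} {∣ E ∣} {d} 3≤q (≤-trans (n≤1+n 6) d≥7) h)
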